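{- Let $d\ge 3$ be a fixed integer and let $G\in\mathcal{G}_{n,d}$ be a random $d$-regular graph. Then with high probability $\mathcal{D}_r(G,\mathcal{T}_n)=\left(\frac{d}{2}-1-o_r(1)\right)n$. Explicitly: for every $\varepsilon>0$ there is $r_0=r_0(d,\varepsilon)$ such that for every fixed integer $r\ge r_0$, with probability tending to $1$ as $n\to\infty$, $$\left(\tfrac{d}{2}-1-\varepsilon\right)n\ \le\ \mathcal{D}_r(G,\mathcal{T}_n)\ \le\ \left(\tfrac{d}{2}-1+\varepsilon\right)n.$$ In other words, with high probability in every $r$-colouring of $E(G)$ there is a spanning tree with at least $\left(\frac{d}{2r}-o\left(\frac1r\right)\right)n$ edges of the same colour, and the constant $\frac{d}{2r}$ is tight.
   Context: $\mathcal{G}_{n,d}$ denotes the uniform distribution over the set of all (simple, labelled) $d$-regular graphs on $n$ vertices, with $dn$ even. "With high probability" means with probability tending to $1$ as $n\to\infty$ (over $n$ with $dn$ even). The notation $o_r(1)$ denotes a quantity tending to $0$ as $r\to\infty$. (Such $G$ is connected with high probability, so the quantity below is defined with high probability.) Spanning-tree discrepancy: for a connected $n$-vertex graph $G$, an $r$-colouring $f:E(G)\to[r]$ of its edges, and a spanning tree $T$ of $G$ (which has $n-1$ edges), put $D_f(T) := r\cdot\left(\max_{1\le i\le r}|f^{ -1}(i)\cap E(T)| - \frac{n-1}{r}\right)$. The $r$-colour spanning-tree discrepancy of $G$ is $\mathcal{D}_r(G,\mathcal{T}_n) := \min_{f:E(G)\to[r]}\ \max_{T} D_f(T)$, where the maximum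 is over all spanning trees $T$ of $G$. -}

module Defs where

open import Data.Bool.Base using (true; false)
open import Data.Empty using (⊥)
open import Data.Fin as Fin using (Fin; toℕ; fromℕ<)
open import Data.Fin.Properties using (all?; any?; injective⇒≤; toℕ-fromℕ<)
open import Data.Fin.Subset using (Subset; _∈_; _∉_; _∩_; ∣_∣)
open import Data.Fin.Subset.Properties using (_∈?_)
open import Data.Integer as ℤ using (+_)
open import Data.List as List using (List; []; _∷_; _∷ʳ_; length; filter; allFin; cartesianProduct; cartesianProductWith; mapMaybe)
import Data.List.Extrema
import Data.List.Extrema.Nat as ℕExtrema
open import Data.List.Membership.Propositional.Properties using (∈-lookup)
open import Data.List.Relation.Unary.All using () renaming (lookup to lookupAll)
open import Data.List.Relation.Unary.AllPairs using (_∷_)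
open import Data.List.Relation.Unary.Linked using (Linked; linked?)
open import Data.List.Relation.Unary.Unique.Propositional using (Unique)
import Data.List.Relation.Unary.Unique.DecPropositional as DecUnique
open import Data.Maybe using (Maybe; just; nothing)
open import Data.Maybe.Properties using (≡-dec)
open import Data.Nat as ℕ using (ℕ; zero; suc; s≤s; NonZero)
open import Data.Nat.Divisibility using (_∣_)
open import Data.Product using (Σ; ∃; ∃-syntax; _×_; _,_; proj₁; proj₂)
open import Data.Product.Properties using () renaming (≡-dec to ×-≡-dec)
open import Data.Rational as ℚ using (ℚ; 0ℚ; 1ℚ; _/_; _*_; _-_)
import Data.Rational.Properties as ℚP
open import Data.Sum using (_⊎_)
open import Data.Vec as Vec using (Vec; []; _∷_; toList; fromList)
open import Data.Vec.Properties using (toList∘fromList)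
open import Function.Base using (_∘_)
open import Function.Definitions using (Injective)
open import Level using (0ℓ)
open import Relation.Binary using (Rel; DecTotalOrder) renaming (Decidable to Decidable₂)
open import Relation.Binary.PropositionalEquality using (_≡_; refl; sym; cong; subst)
open import Relation.Nullary using (Dec; no; ¬_; contradiction)
open import Relation.Nullary.Decidable using (map′; does; ¬?; _×-dec_; _⊎-dec_; _→-dec_)
open import Relation.Unary using (Pred; Decidable)

-- All vectors with entries drawn from xs; when xs lists a type without
-- repetition, so does vectors xs k list Vec A k.
vectors : {A : Set} → List A → (k : ℕ) → List (Vec A k)
vectors xs zero    = [] ∷ []
vectors xs (suc k) = cartesianProductWith _∷_ xs (vectors xs k)

subsets : (n : ℕ) → List (Subset n)
subsets = vectors (true ∷ false ∷ [])

maximum minimum : List ℚ → Maybe ℚ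
maximum []       = nothing
maximum (x ∷ xs) = just (max x xs)
  where open Data.List.Extrema (DecTotalOrder.totalOrder ℚP.≤-decTotalOrder)
minimum []       = nothing
minimum (x ∷ xs) = just (min x xs)
  where open Data.List.Extrema (DecTotalOrder.totalOrder ℚP.≤-decTotalOrder)

module _ {n : ℕ} where

  unique? : Decidable (Unique {A = Fin n})
  unique? = DecUnique.unique? Fin._≟_

  unique⇒lookup-injective : {xs : List (Fin n)} → Unique xs → Injective _≡_ _≡_ (List.lookup xs)
  unique⇒lookup-injective (_ ∷ _) {Fin.zero}  {Fin.zero}  _ = refl
  unique⇒lookup-injective {x ∷ xs} (x∉ ∷ _) {Fin.zero}  {Fin.suc j} eq =
    contradiction eq (lookupAll x∉ (∈-lookup {xs = xs} j))
  unique⇒lookup-injective {x ∷ xs} (x∉ ∷ _) {Fin.suc i} {Fin.zero}  eq =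
    contradiction (sym eq) (lookupAll x∉ (∈-lookup {xs = xs} i))
  unique⇒lookup-injective (_ ∷ u) {Fin.suc i} {Fin.suc j} eq =
    cong Fin.suc (unique⇒lookup-injective u eq)

  unique⇒length≤ : {xs : List (Fin n)} → Unique xs → length xs ℕ.≤ n
  unique⇒length≤ u = injective⇒≤ (unique⇒lookup-injective u)

  anyVec? : ∀ {k} {P : Pred (Vec (Fin n) k) 0ℓ} → Decidable P → Dec (∃ P)
  anyVec? {zero}  P? = map′ ([] ,_) (λ { ([] , p) → p }) (P? [])
  anyVec? {suc k} P? = map′ (λ { (x , xs , p) → x ∷ xs , p }) (λ { (x ∷ xs , p) → x , xs , p })
                            (any? λ x → anyVec? λ xs → P? (x ∷ xs))

  -- A repetition-free list over Fin n has length at most n, so the search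
  -- is finite.
  anyUnique? : {P : Pred (List (Fin n)) 0ℓ} → Decidable P → Dec (∃[ xs ] Unique xs × P xs)
  anyUnique? {P} P? = map′ to from
      (any? {suc n} λ k → anyVec? {toℕ k} λ v → unique? (toList v) ×-dec P? (toList v))
    where
    Found : ℕ → Set
    Found k = Σ (Vec (Fin n) k) λ v → Unique (toList v) × P (toList v)

    to : (Σ (Fin (suc n)) (Found ∘ toℕ)) → ∃[ xs ] Unique xs × P xs
    to (_ , v , p) = toList v , p

    from : (∃[ xs ] Unique xs × P xs) → Σ (Fin (suc n)) (Found ∘ toℕ)
    from (xs , p) = fromℕ< l , subst Found (sym (toℕ-fromℕ< l))
                      (fromList xs , subst (λ ys → Unique ys × P ys) (sym (toList∘fromList xs)) p)
      where l = s≤s (unique⇒length≤ (proj₁ p))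

module _ {n : ℕ} (_~_ : Rel (Fin n) 0ℓ) where

  Path : Fin n → Fin n → Set
  Path u v = ∃[ xs ] Unique xs × Linked _~_ xs × List.head xs ≡ just u × List.last xs ≡ just v

  Connected : Set
  Connected = ∀ u v → Path u v

  -- x ∷ xs lists the (at least three) distinct vertices in cyclic order.
  IsCycle : List (Fin n) → Set
  IsCycle []       = ⊥
  IsCycle (x ∷ xs) = 3 ℕ.≤ length (x ∷ xs) × Linked _~_ (x ∷ xs ∷ʳ x)

  Acyclic : Set
  Acyclic = ¬ (∃[ xs ] Unique xs × IsCycle xs)

  IsTree : Set
  IsTree = Connected × Acyclic

module _ {n : ℕ} {_~_ : Rel (Fin n) 0ℓ} (_~?_ : Decidable₂ _~_) where

  connected? : Dec (Connected _~_)
  connected? = all? λ u → all? λ v → anyUnique? λ xs →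
    linked? _~?_ xs ×-dec ≡-dec Fin._≟_ (List.head xs) (just u)
                    ×-dec ≡-dec Fin._≟_ (List.last xs) (just v)

  isCycle? : Decidable (IsCycle _~_)
  isCycle? []       = no λ ()
  isCycle? (x ∷ xs) = 3 ℕ.≤? length (x ∷ xs) ×-dec linked? _~?_ (x ∷ xs ∷ʳ x)

  isTree? : Dec (IsTree _~_)
  isTree? = connected? ×-dec ¬? (anyUnique? isCycle?)

-- Entry v is the neighbourhood of v, i.e. row v of the adjacency matrix.
Graph : ℕ → Set
Graph n = Vec (Subset n) n

module _ {n : ℕ} where

  neighbours : Graph n → Fin n → Subset n
  neighbours = Vec.lookup

  IsSimple : Graph n → Set
  IsSimple G = (∀ u v → v ∈ neighbours G u → u ∈ neighbours G v)
             × (∀ v → v ∉ neighbours G v)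

  IsRegular : ℕ → Graph n → Set
  IsRegular d G = ∀ v → ∣ neighbours G v ∣ ≡ d

  isSimple? : Decidable IsSimple
  isSimple? G = (all? λ u → all? λ v → (v ∈? neighbours G u) →-dec (u ∈? neighbours G v))
          ×-dec (all? λ v → ¬? (v ∈? neighbours G v))

  isRegular? : ∀ d → Decidable (IsRegular d)
  isRegular? d G = all? λ v → ∣ neighbours G v ∣ ℕ.≟ d

  -- Each edge is listed once, as the pair (u , v) with u < v.
  edges : Graph n → List (Fin n × Fin n)
  edges G = filter (λ (u , v) → (u Fin.<? v) ×-dec (v ∈? neighbours G u))
                   (cartesianProduct (allFin n) (allFin n))

  ∣E∣ : Graph n → ℕ
  ∣E∣ G = length (edges G)

  -- Edges are referred to by their position in the list edges G, so that
  -- E(G) is Fin (∣E∣ G).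
  endpoints : (G : Graph n) → Fin (∣E∣ G) → Fin n × Fin n
  endpoints G = List.lookup (edges G)

  EdgeSet : Graph n → Set
  EdgeSet G = Subset (∣E∣ G)

  Colouring : ℕ → Graph n → Set
  Colouring r G = Vec (Fin r) (∣E∣ G)

  -- Adjacency in the spanning subgraph of G with edge set T.
  Joins : (G : Graph n) → EdgeSet G → Rel (Fin n) 0ℓ
  Joins G T u v = ∃[ e ] e ∈ T × (endpoints G e ≡ (u , v) ⊎ endpoints G e ≡ (v , u))

  joins? : ∀ G T → Decidable₂ (Joins G T)
  joins? G T u v = any? λ e → (e ∈? T) ×-dec ((endpoints G e ≟× (u , v)) ⊎-dec (endpoints G e ≟× (v , u)))
    where _≟×_ = ×-≡-dec Fin._≟_ Fin._≟_

  IsSpanningTree : (G : Graph n) → EdgeSet G → Set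
  IsSpanningTree G T = IsTree (Joins G T)

  isSpanningTree? : ∀ G → Decidable (IsSpanningTree G)
  isSpanningTree? G T = isTree? (joins? G T)

  spanningTrees : (G : Graph n) → List (EdgeSet G)
  spanningTrees G = filter (isSpanningTree? G) (subsets (∣E∣ G))

  colourings : ∀ r (G : Graph n) → List (Colouring r G)
  colourings r G = vectors (allFin r) (∣E∣ G)

  -- f⁻¹(i)
  colourClass : ∀ {r} (G : Graph n) → Colouring r G → Fin r → EdgeSet G
  colourClass G f i = Vec.map (λ c → does (c Fin.≟ i)) f

  largestClass : ∀ {r} (G : Graph n) → Colouring r G → EdgeSet G → ℕ
  largestClass {r} G f T = ℕExtrema.max 0 (List.map (λ i → ∣ colourClass G f i ∩ T ∣) (allFin r))

  treeDiscrepancy : ∀ {r} .{{_ : NonZero r}} (G : Graph n) → Colouring r G → EdgeSet G → ℚ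
  treeDiscrepancy {r} G f T =
    (+ r / 1) * ((+ largestClass G f T / 1) - ((+ n ℤ.- + 1) / r))

  -- The minimum over all colourings of the maximum over all spanning
  -- trees.  It is `nothing` exactly when G has no spanning tree, i.e. when
  -- G is disconnected.
  discrepancy : ∀ r .{{_ : NonZero r}} → Graph n → Maybe ℚ
  discrepancy r G = minimum (mapMaybe (λ f → maximum (List.map (treeDiscrepancy G f) (spanningTrees G)))
                                      (colourings r G))

regularGraphs : ∀ n → ℕ → List (Graph n)
regularGraphs n d = filter (λ G → isSimple? G ×-dec isRegular? d G) (vectors (subsets n) n)

-- The probability of P under the uniform distribution on the entries of a
-- list, with value 0 for the empty list (so a limit of 1 is not obtained
-- vacuously).
uniformProbability : {A : Set} → List A → {P : Pred A 0ℓ} → Decidable P → ℚ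
uniformProbability []          P? = 0ℚ
uniformProbability xs@(_ ∷ _) P? = + length (filter P? xs) / length xs

WithHighProbability : ℕ → (P : ∀ {n} → Pred (Graph n) 0ℓ) → (∀ {n} → Decidable (P {n})) → Set
WithHighProbability d P P? =
  ∀ (δ : ℚ) → 0ℚ ℚ.< δ → ∃[ N ] ∀ n → N ℕ.≤ n → 2 ∣ d ℕ.* n →
    ℚ.∣ uniformProbability (regularGraphs n d) P? - 1ℚ ∣ ℚ.< δ

{-# OPTIONS --safe #-}

-- Everything is a double count of switchings uv, xy → ux, vy in d-regular graphs. Switching edges out of a vertex set
-- bounds the probability that k vertices span h edges by (d²k²/n)^h / h!, so by a union bound all but a fraction O(1/n)
-- of the d-regular graphs have no set of k ≤ n / C vertices spanning more than (1 + 1/q) k edges, and o(n) short cycles.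
-- Connectivity follows: switching an edge inside a component with an edge outside it creates a two-edge cut, and a
-- graph without dense sets has only O(n) pairs of edges forming such a cut.
--
-- In such a graph take E / r edges of the most frequent of r colours. Every component of the subgraph that they form is
-- a tree, or has a short cycle, or is large and has excess at most a fraction 1/q of its size; hence almost all of them
-- lie in a forest, which Kruskal's algorithm extends to a spanning tree. Conversely, in an equitable colouring no tree
-- has more than E / r + 1 edges of one colour.
module Submission where

open import Defs

-- Switchings act on simple graphs directly, so uniform probabilities on `regularGraphs` are
-- compared by counting alone, without a multigraph model. In the union bound the n^k choices of k
-- vertices cancel against the first k edges; each further edge gains a factor k / n against a total
-- loss of `growth d ^ k`. An excess of k / q edges wins once k ≤ n / `scale d q`, since then (k /
-- n)^(1 / q) ≤ 1 / (4 * growth d), and one more edge leaves the overall factor 1 / n. Only sets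
-- this small are controlled, which is why r must be large: the cyclic part of E / r chosen edges
-- has to be small enough. At excess zero the expected number is bounded but does not vanish, so
-- short cycles cannot be excluded, only counted by Markov's inequality. For connectivity the
-- obstacle is that a switching may create a dense set; its images are therefore counted among all
-- graphs, the dense ones with a trivial bound. Inequalities are kept free of division and
-- subtraction until the final passage to rationals.

module RegularGraphs where

  open import Data.Bool as Bool using (Bool; true; false)
  open import Data.Empty using (⊥)
  open import Data.Fin as Fin using (Fin; toℕ; fromℕ<)
  import Data.Fin.Properties as FinP
  open import Data.Fin.Subset using (Subset; _∈_; _∉_; _⊆_; _⊂_; _∩_; _∪_; ⁅_⁆; ∣_∣) renaming (⊥ to ⊥ₛ; ⊤ to ⊤ₛ)
  open import Data.Fin.Subset.Properties using (_∈?_; anySubset?; ⊆-antisym; ∉⊥; ∈⊤; x∈⁅x⁆; x∈⁅y⁆⇒x≡y; x∈p∩q⁺; x∈p∩q⁻; x∈p∪q⁺; x∈p∪q⁻; p⊆p∪q; p⊆q⇒∣p∣≤∣q∣; p⊂q⇒∣p∣<∣q∣; ∣p∩q∣≤∣p∣)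
  open import Data.List as List using (List; []; _∷_; _++_; length; filter; allFin)
  import Data.List.Properties as ListP
  import Data.List.Extrema.Nat as ℕExtrema
  open import Data.List.Membership.Propositional using (find) renaming (_∈_ to _∈ₗ_)
  import Data.List.Membership.Propositional.Properties as ∈P
  open import Data.List.Relation.Unary.All as All using (All; []; _∷_)
  import Data.List.Relation.Unary.All.Properties as AllP
  open import Data.List.Relation.Unary.AllPairs as AllPairs using (AllPairs; []; _∷_)
  open import Data.List.Relation.Unary.Any as Any using (Any; here; there)
  import Data.List.Relation.Unary.Any.Properties as AnyP
  open import Data.List.Relation.Unary.Linked as Linked using (Linked; []; [-]; _∷_)
  open import Data.List.Relation.Unary.Unique.Propositional using (Unique)
  import Data.List.Relation.Unary.Unique.Propositional.Properties as UniqueP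
  open import Data.Maybe using (just)
  open import Data.Nat using (ℕ; zero; suc; _+_; _*_; _∸_; _^_; _/_; _%_; _!; _≤_; _<_; z≤n; s≤s; NonZero; >-nonZero; >-nonZero⁻¹; _≤?_; _<?_; _≟_) renaming (∣_-_∣ to distance)
  open import Data.Nat.Divisibility using (_∣_; divides)
  open import Data.Nat.Properties
  open import Data.Nat.DivMod using (m≡m%n+[m/n]*n; m%n<n; m/n<m; m/n*n≤m; m<n*o⇒m/o<n)
  open import Data.Nat.Tactic.RingSolver using (solve-∀)
  open import Data.Product using (∃-syntax; _×_; _,_; proj₁; proj₂)
  open import Data.Sum using (_⊎_; inj₁; inj₂)
  open import Data.Vec as Vec using (Vec)
  import Data.Vec.Properties as VecP
  open import Function.Base using (_∘_; id; case_of_)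
  open import Relation.Binary.Definitions using (tri<; tri≈; tri>)
  open import Relation.Binary.PropositionalEquality
  open import Relation.Nullary using (Dec; yes; no; ¬_; contradiction)
  open import Relation.Nullary.Decidable using (does; ¬?; _×-dec_; _⊎-dec_; _→-dec_; dec-true; dec-false)
  open import Relation.Unary using (Decidable)

  -- Finite sums and indicators

  ∑ : {A : Set} → List A → (A → ℕ) → ℕ
  ∑ []       f = 0
  ∑ (x ∷ xs) f = f x + ∑ xs f

  infixr 6.5 ∑
  syntax ∑ xs (λ x → e) = ∑[ x ← xs ] e

  𝟙 : {P : Set} → Dec P → ℕ
  𝟙 (yes _) = 1
  𝟙 (no _)  = 0

  module _ {P : Set} where

    𝟙-yes : (P? : Dec P) → P → 𝟙 P? ≡ 1
    𝟙-yes (yes _) _ = refl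
    𝟙-yes (no ¬p) p = contradiction p ¬p

    1≤𝟙 : (P? : Dec P) → P → 1 ≤ 𝟙 P?
    1≤𝟙 P? p = ≤-reflexive (sym (𝟙-yes P? p))

    𝟙-no : (P? : Dec P) → ¬ P → 𝟙 P? ≡ 0
    𝟙-no (yes p) ¬p = contradiction p ¬p
    𝟙-no (no _)  _  = refl

    𝟙-positive : (P? : Dec P) → 1 ≤ 𝟙 P? → P
    𝟙-positive (yes p) _ = p

    𝟙≤1 : (P? : Dec P) → 𝟙 P? ≤ 1
    𝟙≤1 (yes _) = s≤s z≤n
    𝟙≤1 (no _)  = z≤n

    𝟙-≤ : ∀ (P? : Dec P) {m} → (P → 1 ≤ m) → 𝟙 P? ≤ m
    𝟙-≤ (yes p) 1≤m = 1≤m p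
    𝟙-≤ (no _)  _   = z≤n

  module _ {P Q : Set} where

    𝟙-mono : (P? : Dec P) (Q? : Dec Q) → (P → Q) → 𝟙 P? ≤ 𝟙 Q?
    𝟙-mono P? Q? f = 𝟙-≤ P? λ p → 1≤𝟙 Q? (f p)

    𝟙-cong : (P? : Dec P) (Q? : Dec Q) → (P → Q) → (Q → P) → 𝟙 P? ≡ 𝟙 Q?
    𝟙-cong (yes p) Q? f g = sym (𝟙-yes Q? (f p))
    𝟙-cong (no ¬p) Q? f g = sym (𝟙-no Q? (¬p ∘ g))

    𝟙-× : (P? : Dec P) (Q? : Dec Q) → 𝟙 (P? ×-dec Q?) ≡ 𝟙 P? * 𝟙 Q?
    𝟙-× (yes p) (yes q) = refl
    𝟙-× (yes p) (no ¬q) = refl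
    𝟙-× (no ¬p) _       = refl

    𝟙-⊎ : (P? : Dec P) (Q? : Dec Q) → 𝟙 (P? ⊎-dec Q?) ≤ 𝟙 P? + 𝟙 Q?
    𝟙-⊎ (yes p) _       = s≤s z≤n
    𝟙-⊎ (no ¬p) (yes q) = s≤s z≤n
    𝟙-⊎ (no ¬p) (no ¬q) = z≤n

    𝟙-⊎-disjoint : (P? : Dec P) (Q? : Dec Q) → (P → ¬ Q) → 𝟙 (P? ⊎-dec Q?) ≡ 𝟙 P? + 𝟙 Q?
    𝟙-⊎-disjoint (yes p) (yes q) d = contradiction q (d p)
    𝟙-⊎-disjoint (yes p) (no ¬q) d = refl
    𝟙-⊎-disjoint (no ¬p) (yes q) d = refl
    𝟙-⊎-disjoint (no ¬p) (no ¬q) d = refl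

  module _ {A : Set} where

    ∑-cong : ∀ (xs : List A) {f g} → (∀ x → f x ≡ g x) → ∑ xs f ≡ ∑ xs g
    ∑-cong []       eq = refl
    ∑-cong (x ∷ xs) eq = cong₂ _+_ (eq x) (∑-cong xs eq)

    ∑-mono-∈ : ∀ (xs : List A) {f g} → (∀ {x} → x ∈ₗ xs → f x ≤ g x) → ∑ xs f ≤ ∑ xs g
    ∑-mono-∈ []       le = z≤n
    ∑-mono-∈ (x ∷ xs) le = +-mono-≤ (le (here refl)) (∑-mono-∈ xs (le ∘ there))

    ∑-mono : ∀ (xs : List A) {f g} → (∀ x → f x ≤ g x) → ∑ xs f ≤ ∑ xs g
    ∑-mono xs le = ∑-mono-∈ xs λ {x} _ → le x

    ∑-zero : ∀ (xs : List A) → ∑ xs (λ _ → 0) ≡ 0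
    ∑-zero []       = refl
    ∑-zero (_ ∷ xs) = ∑-zero xs

    ∑-+ : ∀ (xs : List A) f g → ∑[ x ← xs ] (f x + g x) ≡ ∑ xs f + ∑ xs g
    ∑-+ []       f g = refl
    ∑-+ (x ∷ xs) f g rewrite ∑-+ xs f g = interchange (f x) (g x) (∑ xs f) (∑ xs g)
      where
      interchange : ∀ a b c d → a + b + (c + d) ≡ a + c + (b + d)
      interchange = solve-∀

    ∑-*ˡ : ∀ (xs : List A) c f → ∑[ x ← xs ] (c * f x) ≡ c * ∑ xs f
    ∑-*ˡ []       c f = sym (*-zeroʳ c)
    ∑-*ˡ (x ∷ xs) c f rewrite ∑-*ˡ xs c f = sym (*-distribˡ-+ c (f x) (∑ xs f))

    ∑-*ʳ : ∀ (xs : List A) c f → ∑[ x ← xs ] (f x * c) ≡ ∑ xs f * c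
    ∑-*ʳ []       c f = refl
    ∑-*ʳ (x ∷ xs) c f rewrite ∑-*ʳ xs c f = sym (*-distribʳ-+ c (f x) (∑ xs f))

    ∑-const : ∀ (xs : List A) c → ∑[ _ ← xs ] c ≡ length xs * c
    ∑-const []       c = refl
    ∑-const (_ ∷ xs) c = cong (c +_) (∑-const xs c)

    ∑-∈ : ∀ {xs : List A} f {x} → x ∈ₗ xs → f x ≤ ∑ xs f
    ∑-∈ {_ ∷ xs} f (here refl) = m≤m+n _ _
    ∑-∈ {y ∷ xs} f (there x∈)  = ≤-trans (∑-∈ f x∈) (m≤n+m _ (f y))

    ∑-++ : ∀ (xs ys : List A) f → ∑ (xs ++ ys) f ≡ ∑ xs f + ∑ ys f
    ∑-++ []       ys f = refl
    ∑-++ (x ∷ xs) ys f rewrite ∑-++ xs ys f = sym (+-assoc (f x) _ _)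

    ∑-filter : ∀ {P : A → Set} (P? : Decidable P) xs f →
               ∑ (filter P? xs) f ≡ ∑[ x ← xs ] (𝟙 (P? x) * f x)
    ∑-filter P? []       f = refl
    ∑-filter P? (x ∷ xs) f with P? x
    ... | yes _ = cong₂ _+_ (sym (+-identityʳ (f x))) (∑-filter P? xs f)
    ... | no _  = ∑-filter P? xs f

    length-filter : ∀ {P : A → Set} (P? : Decidable P) xs → length (filter P? xs) ≡ ∑[ x ← xs ] 𝟙 (P? x)
    length-filter P? []       = refl
    length-filter P? (x ∷ xs) with P? x
    ... | yes _ = cong suc (length-filter P? xs)
    ... | no _  = length-filter P? xs

    ∑-positive : ∀ (xs : List A) f → 1 ≤ ∑ xs f → ∃[ x ] x ∈ₗ xs × 1 ≤ f x
    ∑-positive (x ∷ xs) f le with f x in eq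
    ... | suc _ = x , here refl , ≤-trans (s≤s z≤n) (≤-reflexive (sym eq))
    ... | zero  with y , y∈ , le′ ← ∑-positive xs f le = y , there y∈ , le′

    ∑-map : ∀ {B : Set} (g : A → B) xs f → ∑ (List.map g xs) f ≡ ∑ xs (f ∘ g)
    ∑-map g []       f = refl
    ∑-map g (x ∷ xs) f = cong (f (g x) +_) (∑-map g xs f)

  module _ {A B : Set} where

    ∑-swap : ∀ (xs : List A) (ys : List B) (f : A → B → ℕ) →
             (∑[ x ← xs ] ∑[ y ← ys ] f x y) ≡ (∑[ y ← ys ] ∑[ x ← xs ] f x y)
    ∑-swap []       ys f = sym (∑-zero ys)
    ∑-swap (x ∷ xs) ys f = trans (cong (∑ ys (f x) +_) (∑-swap xs ys f)) (sym (∑-+ ys (f x) _))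

    ∑-* : ∀ (xs : List A) (ys : List B) f g →
          ∑ xs f * ∑ ys g ≡ (∑[ x ← xs ] ∑[ y ← ys ] (f x * g y))
    ∑-* xs ys f g = trans (sym (∑-*ʳ xs (∑ ys g) f)) (∑-cong xs λ x → sym (∑-*ˡ ys (f x) g))

    -- Only elements of positive weight need an image, so `φ` is unconstrained off the support of
    -- `f`. Each step deletes one occurrence of `φ x` from `ys`; injectivity keeps the later images
    -- among what is left.
    ∑-injection : ∀ {xs : List A} {ys : List B} (φ : A → B) {f g} → Unique xs →
      (∀ {x} → x ∈ₗ xs → 1 ≤ f x → φ x ∈ₗ ys × f x ≤ g (φ x)) →
      (∀ {x x′} → x ∈ₗ xs → x′ ∈ₗ xs → 1 ≤ f x → 1 ≤ f x′ → φ x ≡ φ x′ → x ≡ x′) →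
      ∑ xs f ≤ ∑ ys g
    ∑-injection {[]}          φ _        _   _   = z≤n
    ∑-injection {x ∷ xs} {ys} φ {f} {g} (x∉ ∷ u) fit inj with f x in eq
    ... | zero  = ∑-injection φ u (fit ∘ there) (λ x∈ x′∈ → inj (there x∈) (there x′∈))
    ... | suc m with fit (here refl) (subst (1 ≤_) (sym eq) (s≤s z≤n))
    ...   | φx∈ , fx≤ with ys₁ , ys₂ , refl ← ∈P.∈-∃++ φx∈ = begin
      suc m + ∑ xs f ≤⟨ +-mono-≤ (≤-trans (≤-reflexive (sym eq)) fx≤) (∑-injection φ u fit′ (λ x∈ x′∈ → inj (there x∈) (there x′∈))) ⟩
      g (φ x) + ∑ (ys₁ ++ ys₂) g ≡⟨ cong (g (φ x) +_) (∑-++ ys₁ ys₂ g) ⟩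
      g (φ x) + (∑ ys₁ g + ∑ ys₂ g) ≡⟨ move (g (φ x)) (∑ ys₁ g) (∑ ys₂ g) ⟩
      ∑ ys₁ g + (g (φ x) + ∑ ys₂ g) ≡⟨ ∑-++ ys₁ (φ x ∷ ys₂) g ⟨
      ∑ (ys₁ ++ φ x ∷ ys₂) g ∎
      where
      open ≤-Reasoning
      move : ∀ a b c → a + (b + c) ≡ b + (a + c)
      move = solve-∀
      fit′ : ∀ {x′} → x′ ∈ₗ xs → 1 ≤ f x′ → φ x′ ∈ₗ ys₁ ++ ys₂ × f x′ ≤ g (φ x′)
      fit′ {x′} x′∈ 1≤ with fit (there x′∈) 1≤
      ... | φx′∈ , le with ∈P.∈-++⁻ ys₁ φx′∈
      ...   | inj₁ l         = ∈P.∈-++⁺ˡ l , le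
      ...   | inj₂ (there l) = ∈P.∈-++⁺ʳ ys₁ l , le
      ...   | inj₂ (here eq′) = contradiction (inj (here refl) (there x′∈) (subst (1 ≤_) (sym eq) (s≤s z≤n)) 1≤ (sym eq′)) (All.lookup x∉ x′∈)

  ∑-unique-⊆ : ∀ {A : Set} {xs ys : List A} f → Unique xs → (∀ {x} → x ∈ₗ xs → x ∈ₗ ys) → ∑ xs f ≤ ∑ ys f
  ∑-unique-⊆ f u sub = ∑-injection id u (λ x∈ _ → sub x∈ , ≤-refl) λ _ _ _ _ eq → eq

  ∑-fins-const : ∀ n c → ∑ (allFin n) (λ _ → c) ≡ n * c
  ∑-fins-const n c = trans (∑-const (allFin n) c) (cong (_* c) (ListP.length-tabulate {n = n} id))

  ∑-ones : ∀ n → ∑ (allFin n) (λ _ → 1) ≡ n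
  ∑-ones n = trans (∑-fins-const n 1) (*-identityʳ n)

  ∑-fins-suc : ∀ {n} (f : Fin (suc n) → ℕ) → ∑ (allFin (suc n)) f ≡ f Fin.zero + ∑ (allFin n) (f ∘ Fin.suc)
  ∑-fins-suc {n} f = cong (f Fin.zero +_) (trans (cong (λ l → ∑ l f) (sym (ListP.map-tabulate id Fin.suc))) (∑-map Fin.suc (allFin n) f))

  ∑-point : ∀ {n} (i : Fin n) (f : Fin n → ℕ) → ∑[ j ← allFin n ] (𝟙 (i Fin.≟ j) * f j) ≡ f i
  ∑-point {suc n} Fin.zero f = begin
    ∑[ j ← allFin (suc n) ] (𝟙 (Fin.zero Fin.≟ j) * f j) ≡⟨ ∑-fins-suc (λ j → 𝟙 (Fin.zero Fin.≟ j) * f j) ⟩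
    f Fin.zero + 0 + ∑ (allFin n) (λ _ → 0) ≡⟨ cong (f Fin.zero + 0 +_) (∑-zero (allFin n)) ⟩
    f Fin.zero + 0 + 0 ≡⟨ trans (+-identityʳ _) (+-identityʳ _) ⟩
    f Fin.zero ∎
    where open ≡-Reasoning
  ∑-point {suc n} (Fin.suc i) f = begin
    ∑[ j ← allFin (suc n) ] (𝟙 (Fin.suc i Fin.≟ j) * f j) ≡⟨ ∑-fins-suc (λ j → 𝟙 (Fin.suc i Fin.≟ j) * f j) ⟩
    ∑[ j ← allFin n ] (𝟙 (Fin.suc i Fin.≟ Fin.suc j) * f (Fin.suc j)) ≡⟨ ∑-cong (allFin n) (λ j → cong (_* f (Fin.suc j)) (𝟙-cong (Fin.suc i Fin.≟ Fin.suc j) (i Fin.≟ j) FinP.suc-injective (cong Fin.suc))) ⟩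
    ∑[ j ← allFin n ] (𝟙 (i Fin.≟ j) * f (Fin.suc j)) ≡⟨ ∑-point i (f ∘ Fin.suc) ⟩
    f (Fin.suc i) ∎
    where open ≡-Reasoning

  ∑-point₁ : ∀ {n} (i : Fin n) → ∑[ j ← allFin n ] 𝟙 (i Fin.≟ j) ≡ 1
  ∑-point₁ {n} i = trans (∑-cong (allFin n) λ j → sym (*-identityʳ (𝟙 (i Fin.≟ j)))) (∑-point i λ _ → 1)

  ∣p∣≡∑ : ∀ {n} (p : Subset n) → ∣ p ∣ ≡ ∑[ i ← allFin n ] 𝟙 (i ∈? p)
  ∣p∣≡∑ Vec.[] = refl
  ∣p∣≡∑ {suc n} (b Vec.∷ p) = trans (cases b) (sym (∑-fins-suc λ i → 𝟙 (i ∈? (b Vec.∷ p))))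
    where
    tail : ∣ p ∣ ≡ ∑[ i ← allFin n ] 𝟙 (Fin.suc i ∈? (b Vec.∷ p))
    tail = trans (∣p∣≡∑ p) (∑-cong (allFin n) λ i → 𝟙-cong (i ∈? p) (Fin.suc i ∈? (b Vec.∷ p)) Vec.there λ { (Vec.there q) → q })
    cases : ∀ b′ → ∣ b′ Vec.∷ p ∣ ≡ 𝟙 (Fin.zero ∈? (b′ Vec.∷ p)) + ∑[ i ← allFin n ] 𝟙 (Fin.suc i ∈? (b Vec.∷ p))
    cases true  = cong suc tail
    cases false = tail

  x∈p⇒1≤∣p∣ : ∀ {n} {p : Subset n} {i} → i ∈ p → 1 ≤ ∣ p ∣
  x∈p⇒1≤∣p∣ {p = p} {i} i∈ = ≤-trans (≤-trans (1≤𝟙 (i ∈? p) i∈) (∑-∈ (λ j → 𝟙 (j ∈? p)) (∈P.∈-allFin i))) (≤-reflexive (sym (∣p∣≡∑ p)))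

  module _ {n : ℕ} where

    ∑² : (Fin n → Fin n → ℕ) → ℕ
    ∑² f = ∑[ u ← allFin n ] ∑ (allFin n) (f u)

    infixr 6.5 ∑²
    syntax ∑² (λ u v → e) = ∑²[ u , v ] e

    ∑²-cong : ∀ {f g : Fin n → Fin n → ℕ} → (∀ u v → f u v ≡ g u v) → ∑² f ≡ ∑² g
    ∑²-cong eq = ∑-cong (allFin n) λ u → ∑-cong (allFin n) (eq u)

    ∑²-mono : ∀ {f g : Fin n → Fin n → ℕ} → (∀ u v → f u v ≤ g u v) → ∑² f ≤ ∑² g
    ∑²-mono le = ∑-mono (allFin n) λ u → ∑-mono (allFin n) (le u)

    ∑²-+ : ∀ f g → ∑²[ u , v ] (f u v + g u v) ≡ ∑² f + ∑² g
    ∑²-+ f g = trans (∑-cong (allFin n) λ u → ∑-+ (allFin n) (f u) (g u)) (∑-+ (allFin n) (λ u → ∑ (allFin n) (f u)) (λ u → ∑ (allFin n) (g u)))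

    ∑²-*ˡ : ∀ c f → ∑²[ u , v ] (c * f u v) ≡ c * ∑² f
    ∑²-*ˡ c f = trans (∑-cong (allFin n) λ u → ∑-*ˡ (allFin n) c (f u)) (∑-*ˡ (allFin n) c (λ u → ∑ (allFin n) (f u)))

    ∑²-*ʳ : ∀ c f → ∑²[ u , v ] (f u v * c) ≡ ∑² f * c
    ∑²-*ʳ c f = trans (∑-cong (allFin n) λ u → ∑-*ʳ (allFin n) c (f u)) (∑-*ʳ (allFin n) c (λ u → ∑ (allFin n) (f u)))

    ∑²-zero : ∀ {f : Fin n → Fin n → ℕ} → (∀ u v → f u v ≡ 0) → ∑² f ≡ 0
    ∑²-zero eq = trans (∑²-cong eq) (trans (∑-cong (allFin n) λ _ → ∑-zero (allFin n)) (∑-zero (allFin n)))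

  module _ {n : ℕ} {P : Fin n → Set} (P? : Decidable P) where

    comprehension : Subset n
    comprehension = Vec.tabulate (does ∘ P?)

    ∈-comprehension⁺ : ∀ {i} → P i → i ∈ comprehension
    ∈-comprehension⁺ {i} p = VecP.lookup⇒[]= i comprehension (trans (VecP.lookup∘tabulate (does ∘ P?) i) (dec-true (P? i) p))

    ∈-comprehension⁻ : ∀ {i} → i ∈ comprehension → P i
    ∈-comprehension⁻ {i} i∈ with P? i | trans (sym (VecP.lookup∘tabulate (does ∘ P?) i)) (VecP.[]=⇒lookup i∈)
    ... | yes p | _  = p

  -- Graphs and switchings

  module _ {A : Set} where

    ∈-vectors : ∀ {xs : List A} → (∀ x → x ∈ₗ xs) → ∀ {k} (v : Vec A k) → v ∈ₗ vectors xs k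
    ∈-vectors all Vec.[]      = here refl
    ∈-vectors all (x Vec.∷ v) = ∈P.∈-cartesianProductWith⁺ Vec._∷_ (all x) (∈-vectors all v)

    vectors-unique : ∀ {xs : List A} → Unique xs → ∀ k → Unique (vectors xs k)
    vectors-unique u zero    = [] ∷ []
    vectors-unique u (suc k) = UniqueP.cartesianProductWith⁺ Vec._∷_ VecP.∷-injective u (vectors-unique u k)

  ∈-subsets : ∀ {n} (p : Subset n) → p ∈ₗ subsets n
  ∈-subsets = ∈-vectors λ { true → here refl ; false → there (here refl) }

  subsets-unique : ∀ n → Unique (subsets n)
  subsets-unique = vectors-unique (((λ ()) ∷ []) ∷ [] ∷ [])

  module _ {n : ℕ} where

    Adj : Graph n → Fin n → Fin n → Set
    Adj G u v = v ∈ neighbours G u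

    adj? : ∀ G u v → Dec (Adj G u v)
    adj? G u v = v ∈? neighbours G u

    graph-ext : ∀ {G H : Graph n} → (∀ {u v} → Adj G u v → Adj H u v) → (∀ {u v} → Adj H u v → Adj G u v) → G ≡ H
    graph-ext {G} {H} f g = trans (sym (VecP.tabulate∘lookup G))
      (trans (VecP.tabulate-cong λ u → ⊆-antisym f g) (VecP.tabulate∘lookup H))

    degree : ∀ {d G} → IsRegular d G → ∀ u → ∑[ v ← allFin n ] 𝟙 (adj? G u v) ≡ d
    degree {G = G} reg u = trans (sym (∣p∣≡∑ (neighbours G u))) (reg u)

    -- Both orientations of the edge st are kept, so that sums over ordered pairs count an edge
    -- twice, in agreement with adjacency.
    IsEdge : Fin n → Fin n → Fin n → Fin n → Set
    IsEdge s t a b = (s ≡ a × t ≡ b) ⊎ (t ≡ a × s ≡ b)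

    isEdge? : ∀ s t a b → Dec (IsEdge s t a b)
    isEdge? s t a b = (s Fin.≟ a ×-dec t Fin.≟ b) ⊎-dec (t Fin.≟ a ×-dec s Fin.≟ b)

    edge-sym : ∀ {s t a b} → IsEdge s t a b → IsEdge s t b a
    edge-sym (inj₁ (p , q)) = inj₂ (q , p)
    edge-sym (inj₂ (p , q)) = inj₁ (q , p)

    edge-degree : ∀ {s t} → s ≢ t → ∀ a → ∑[ b ← allFin n ] 𝟙 (isEdge? s t a b) ≡ 𝟙 (s Fin.≟ a) + 𝟙 (t Fin.≟ a)
    edge-degree {s} {t} s≢t a = begin
      ∑[ b ← allFin n ] 𝟙 (isEdge? s t a b)
        ≡⟨ ∑-cong (allFin n) (λ b → 𝟙-⊎-disjoint (s Fin.≟ a ×-dec t Fin.≟ b) (t Fin.≟ a ×-dec s Fin.≟ b) λ (p , _) (q , _) → s≢t (trans p (sym q))) ⟩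
      ∑[ b ← allFin n ] (𝟙 (s Fin.≟ a ×-dec t Fin.≟ b) + 𝟙 (t Fin.≟ a ×-dec s Fin.≟ b))
        ≡⟨ ∑-+ (allFin n) (λ b → 𝟙 (s Fin.≟ a ×-dec t Fin.≟ b)) (λ b → 𝟙 (t Fin.≟ a ×-dec s Fin.≟ b)) ⟩
      (∑[ b ← allFin n ] 𝟙 (s Fin.≟ a ×-dec t Fin.≟ b)) + (∑[ b ← allFin n ] 𝟙 (t Fin.≟ a ×-dec s Fin.≟ b))
        ≡⟨ cong₂ _+_ (half s t) (half t s) ⟩
      𝟙 (s Fin.≟ a) + 𝟙 (t Fin.≟ a) ∎
      where
      open ≡-Reasoning
      half : ∀ p q → ∑[ b ← allFin n ] 𝟙 (p Fin.≟ a ×-dec q Fin.≟ b) ≡ 𝟙 (p Fin.≟ a)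
      half p q = begin
        ∑[ b ← allFin n ] 𝟙 (p Fin.≟ a ×-dec q Fin.≟ b) ≡⟨ ∑-cong (allFin n) (λ b → 𝟙-× (p Fin.≟ a) (q Fin.≟ b)) ⟩
        ∑[ b ← allFin n ] (𝟙 (p Fin.≟ a) * 𝟙 (q Fin.≟ b)) ≡⟨ ∑-*ˡ (allFin n) (𝟙 (p Fin.≟ a)) (λ b → 𝟙 (q Fin.≟ b)) ⟩
        𝟙 (p Fin.≟ a) * ∑ (allFin n) (λ b → 𝟙 (q Fin.≟ b)) ≡⟨ cong (𝟙 (p Fin.≟ a) *_) (∑-point₁ q) ⟩
        𝟙 (p Fin.≟ a) * 1 ≡⟨ *-identityʳ _ ⟩
        𝟙 (p Fin.≟ a) ∎

    edge-total : ∀ {s t} → s ≢ t → ∑²[ a , b ] 𝟙 (isEdge? s t a b) ≡ 2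
    edge-total {s} {t} s≢t = trans (∑-cong (allFin n) (edge-degree s≢t))
      (trans (∑-+ (allFin n) (λ a → 𝟙 (s Fin.≟ a)) (λ a → 𝟙 (t Fin.≟ a))) (cong₂ _+_ (∑-point₁ s) (∑-point₁ t)))

    -- The switching at (u , v , x , y) trades the edges uv and xy for ux and vy.
    Removed Added : Fin n → Fin n → Fin n → Fin n → Fin n → Fin n → Set
    Removed u v x y a b = IsEdge u v a b ⊎ IsEdge x y a b
    Added   u v x y a b = IsEdge u x a b ⊎ IsEdge v y a b

    removed? : ∀ u v x y a b → Dec (Removed u v x y a b)
    removed? u v x y a b = isEdge? u v a b ⊎-dec isEdge? x y a b

    added? : ∀ u v x y a b → Dec (Added u v x y a b)
    added? u v x y a b = isEdge? u x a b ⊎-dec isEdge? v y a b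

    Switched : Graph n → Fin n → Fin n → Fin n → Fin n → Fin n → Fin n → Set
    Switched G u v x y a b = Added u v x y a b ⊎ (Adj G a b × ¬ Removed u v x y a b)

    switched? : ∀ G u v x y a b → Dec (Switched G u v x y a b)
    switched? G u v x y a b = added? u v x y a b ⊎-dec (adj? G a b ×-dec ¬? (removed? u v x y a b))

    switch : Graph n → Fin n → Fin n → Fin n → Fin n → Graph n
    switch G u v x y = Vec.tabulate λ a → comprehension (switched? G u v x y a)

    module _ {G : Graph n} {u v x y a b : Fin n} where

      private
        row : neighbours (switch G u v x y) a ≡ comprehension (switched? G u v x y a)
        row = VecP.lookup∘tabulate (λ a → comprehension (switched? G u v x y a)) a

      adj-switch⁺ : Switched G u v x y a b → Adj (switch G u v x y) a b
      adj-switch⁺ s = subst (b ∈_) (sym row) (∈-comprehension⁺ (switched? G u v x y a) s)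

      adj-switch⁻ : Adj (switch G u v x y) a b → Switched G u v x y a b
      adj-switch⁻ s = ∈-comprehension⁻ (switched? G u v x y a) (subst (b ∈_) row s)

    -- In a simple graph these conditions make u, v, x, y distinct: u = y would contradict `xy`, and
    -- v = x would contradict `uv`, because u and x are not adjacent.
    record Switchable (G : Graph n) (u v x y : Fin n) : Set where
      field
        uv : Adj G u v
        xy : Adj G x y
        ux : ¬ Adj G u x
        vy : ¬ Adj G v y
        u≢x : u ≢ x
        v≢y : v ≢ y

    module _ {G : Graph n} (simple : IsSimple G) {u v x y : Fin n} (sw : Switchable G u v x y) where
      open Switchable sw

      private
        symG : ∀ {a b} → Adj G a b → Adj G b a
        symG = proj₁ simple _ _

        adj-edge : ∀ {s t a b} → Adj G s t → IsEdge s t a b → Adj G a b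
        adj-edge st (inj₁ (refl , refl)) = st
        adj-edge st (inj₂ (refl , refl)) = symG st

        removed⇒adj : ∀ {a b} → Removed u v x y a b → Adj G a b
        removed⇒adj (inj₁ e) = adj-edge uv e
        removed⇒adj (inj₂ e) = adj-edge xy e

        nonadj-edge : ∀ {s t a b} → ¬ Adj G s t → IsEdge s t a b → ¬ Adj G a b
        nonadj-edge st (inj₁ (refl , refl)) = st
        nonadj-edge st (inj₂ (refl , refl)) = st ∘ symG

        added⇒¬adj : ∀ {a b} → Added u v x y a b → ¬ Adj G a b
        added⇒¬adj (inj₁ e) = nonadj-edge ux e
        added⇒¬adj (inj₂ e) = nonadj-edge vy e

      u≢v : u ≢ v
      u≢v refl = proj₂ simple u uv

      x≢y : x ≢ y
      x≢y refl = proj₂ simple x xy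

      u≢y : u ≢ y
      u≢y refl = ux (symG xy)

      -- Exchanging v and x exchanges `Added` and `Removed` by definition, so the switching at (u ,
      -- x , v , y) restores uv and xy.
      switch-involutive : switch (switch G u v x y) u x v y ≡ G
      switch-involutive = graph-ext to from
        where
        to : ∀ {a b} → Adj (switch (switch G u v x y) u x v y) a b → Adj G a b
        to s with adj-switch⁻ {G = switch G u v x y} s
        ... | inj₁ r = removed⇒adj r
        ... | inj₂ (s′ , ¬add) with adj-switch⁻ {G = G} s′
        ...   | inj₁ add       = contradiction add ¬add
        ...   | inj₂ (adj , _) = adj
        from : ∀ {a b} → Adj G a b → Adj (switch (switch G u v x y) u x v y) a b
        from {a} {b} adj = adj-switch⁺ {G = switch G u v x y} (cases (removed? u v x y a b))
          where
          cases : Dec (Removed u v x y a b) → Switched (switch G u v x y) u x v y a b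
          cases (yes r) = inj₁ r
          cases (no ¬r) = inj₂ (adj-switch⁺ {G = G} (inj₂ (adj , ¬r)) , λ add → added⇒¬adj add adj)

      switch-simple : IsSimple (switch G u v x y)
      switch-simple = (λ a b → adj-switch⁺ {G = G} ∘ switched-sym ∘ adj-switch⁻ {G = G}) , λ a → no-loop ∘ adj-switch⁻ {G = G}
        where
        edges-sym : ∀ {p q r s a b} → IsEdge p q a b ⊎ IsEdge r s a b → IsEdge p q b a ⊎ IsEdge r s b a
        edges-sym (inj₁ e) = inj₁ (edge-sym e)
        edges-sym (inj₂ e) = inj₂ (edge-sym e)
        switched-sym : ∀ {a b} → Switched G u v x y a b → Switched G u v x y b a
        switched-sym (inj₁ add)        = inj₁ (edges-sym add)
        switched-sym (inj₂ (adj , ¬r)) = inj₂ (symG adj , ¬r ∘ edges-sym)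
        no-loop : ∀ {a} → ¬ Switched G u v x y a a
        no-loop (inj₁ (inj₁ (inj₁ (refl , q)))) = u≢x (sym q)
        no-loop (inj₁ (inj₁ (inj₂ (refl , q)))) = u≢x q
        no-loop (inj₁ (inj₂ (inj₁ (refl , q)))) = v≢y (sym q)
        no-loop (inj₁ (inj₂ (inj₂ (refl , q)))) = v≢y q
        no-loop {a} (inj₂ (adj , _)) = proj₂ simple a adj

      -- Additive form of "old minus removed plus added", free of truncated subtraction. Summed over
      -- b it preserves degrees, because the removed and the added pair of edges both cover u, v, x,
      -- y once each.
      switch-balance : ∀ a b → 𝟙 (adj? (switch G u v x y) a b) + 𝟙 (removed? u v x y a b) ≡ 𝟙 (adj? G a b) + 𝟙 (added? u v x y a b)
      switch-balance a b = trans (cong (_+ 𝟙 (removed? u v x y a b)) (𝟙-cong (adj? (switch G u v x y) a b) (switched? G u v x y a b) (adj-switch⁻ {G = G}) (adj-switch⁺ {G = G}))) (cases (added? u v x y a b) (adj? G a b) (removed? u v x y a b))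
        where
        cases : (A? : Dec (Added u v x y a b)) (G? : Dec (Adj G a b)) (R? : Dec (Removed u v x y a b)) →
                𝟙 (A? ⊎-dec (G? ×-dec ¬? R?)) + 𝟙 R? ≡ 𝟙 G? + 𝟙 A?
        cases (yes p) (yes q) _       = contradiction q (added⇒¬adj p)
        cases (yes p) (no _)  (yes r) = contradiction (removed⇒adj r) (added⇒¬adj p)
        cases (yes p) (no _)  (no _)  = refl
        cases (no _)  (yes _) (yes _) = refl
        cases (no _)  (yes _) (no _)  = refl
        cases (no _)  (no ¬q) (yes r) = contradiction (removed⇒adj r) ¬q
        cases (no _)  (no _)  (no _)  = refl

      private
        touches : Fin n → Fin n → ℕ
        touches s a = 𝟙 (s Fin.≟ a)

        two-edges : ∀ {p q r s a} → p ≢ q → r ≢ s → (∀ {b} → IsEdge p q a b → ¬ IsEdge r s a b) →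
                    ∑[ b ← allFin n ] 𝟙 (isEdge? p q a b ⊎-dec isEdge? r s a b) ≡ touches p a + touches q a + (touches r a + touches s a)
        two-edges {p} {q} {r} {s} {a} p≢q r≢s disj = trans
          (∑-cong (allFin n) λ b → 𝟙-⊎-disjoint (isEdge? p q a b) (isEdge? r s a b) disj)
          (trans (∑-+ (allFin n) (λ b → 𝟙 (isEdge? p q a b)) (λ b → 𝟙 (isEdge? r s a b)))
                 (cong₂ _+_ (edge-degree p≢q a) (edge-degree r≢s a)))

      switch-degree : ∀ a → ∑[ b ← allFin n ] 𝟙 (adj? (switch G u v x y) a b) ≡ ∑[ b ← allFin n ] 𝟙 (adj? G a b)
      switch-degree a = +-cancelʳ-≡ _ _ _ (begin
        (∑[ b ← allFin n ] 𝟙 (adj? (switch G u v x y) a b)) + (∑[ b ← allFin n ] 𝟙 (removed? u v x y a b))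
          ≡⟨ ∑-+ (allFin n) (λ b → 𝟙 (adj? (switch G u v x y) a b)) (λ b → 𝟙 (removed? u v x y a b)) ⟨
        ∑[ b ← allFin n ] (𝟙 (adj? (switch G u v x y) a b) + 𝟙 (removed? u v x y a b))
          ≡⟨ ∑-cong (allFin n) (switch-balance a) ⟩
        ∑[ b ← allFin n ] (𝟙 (adj? G a b) + 𝟙 (added? u v x y a b))
          ≡⟨ ∑-+ (allFin n) (λ b → 𝟙 (adj? G a b)) (λ b → 𝟙 (added? u v x y a b)) ⟩
        (∑[ b ← allFin n ] 𝟙 (adj? G a b)) + (∑[ b ← allFin n ] 𝟙 (added? u v x y a b))
          ≡⟨ cong ((∑[ b ← allFin n ] 𝟙 (adj? G a b)) +_) added≡removed ⟩
        (∑[ b ← allFin n ] 𝟙 (adj? G a b)) + (∑[ b ← allFin n ] 𝟙 (removed? u v x y a b)) ∎)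
        where
        open ≡-Reasoning
        regroup : ∀ p q r s → p + r + (q + s) ≡ p + q + (r + s)
        regroup = solve-∀
        removed-disjoint : ∀ {b} → IsEdge u v a b → ¬ IsEdge x y a b
        removed-disjoint (inj₁ (p , _)) (inj₁ (q , _)) = u≢x (trans p (sym q))
        removed-disjoint (inj₁ (p , _)) (inj₂ (q , _)) = u≢y (trans p (sym q))
        removed-disjoint (inj₂ (_ , p)) (inj₁ (_ , q)) = u≢y (trans p (sym q))
        removed-disjoint (inj₂ (_ , p)) (inj₂ (_ , q)) = u≢x (trans p (sym q))
        added-disjoint : ∀ {b} → IsEdge u x a b → ¬ IsEdge v y a b
        added-disjoint (inj₁ (p , _)) (inj₁ (q , _)) = u≢v (trans p (sym q))
        added-disjoint (inj₁ (p , _)) (inj₂ (q , _)) = u≢y (trans p (sym q))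
        added-disjoint (inj₂ (_ , p)) (inj₁ (_ , q)) = u≢y (trans p (sym q))
        added-disjoint (inj₂ (_ , p)) (inj₂ (_ , q)) = u≢v (trans p (sym q))
        added≡removed : ∑[ b ← allFin n ] 𝟙 (added? u v x y a b) ≡ ∑[ b ← allFin n ] 𝟙 (removed? u v x y a b)
        added≡removed = trans (two-edges u≢x v≢y added-disjoint)
          (trans (regroup (touches u a) (touches v a) (touches x a) (touches y a))
                 (sym (two-edges u≢v x≢y removed-disjoint)))

      switch-regular : ∀ {d} → IsRegular d G → IsRegular d (switch G u v x y)
      switch-regular reg a = trans (∣p∣≡∑ (neighbours (switch G u v x y) a)) (trans (switch-degree a) (degree {G = G} reg a))

  module _ {n : ℕ} where

    ∑⁴ : (Fin n → Fin n → Fin n → Fin n → ℕ) → ℕ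
    ∑⁴ f = ∑²[ u , v ] ∑² (f u v)

    ∑⁴-mono : ∀ {f g} → (∀ u v x y → f u v x y ≤ g u v x y) → ∑⁴ f ≤ ∑⁴ g
    ∑⁴-mono le = ∑²-mono λ u v → ∑²-mono λ x y → le u v x y

    ∑⁴-swap : ∀ {A : Set} (xs : List A) (f : A → Fin n → Fin n → Fin n → Fin n → ℕ) → ∑[ a ← xs ] ∑⁴ (f a) ≡ ∑⁴ (λ u v x y → ∑[ a ← xs ] f a u v x y)
    ∑⁴-swap xs f =
      trans (∑-swap xs (allFin n) _) (∑-cong (allFin n) λ u →
      trans (∑-swap xs (allFin n) _) (∑-cong (allFin n) λ v →
      trans (∑-swap xs (allFin n) _) (∑-cong (allFin n) λ x → ∑-swap xs (allFin n) (λ a y → f a u v x y))))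

  module _ {n d : ℕ} where

    private
      R = regularGraphs n d
      regularGraph? : Decidable (λ (G : Graph n) → IsSimple G × IsRegular d G)
      regularGraph? G = isSimple? G ×-dec isRegular? d G

    ∈-regularGraphs⁺ : ∀ {G} → IsSimple G → IsRegular d G → G ∈ₗ R
    ∈-regularGraphs⁺ {G} s r = ∈P.∈-filter⁺ regularGraph? (∈-vectors ∈-subsets G) (s , r)

    ∈-regularGraphs⁻ : ∀ {G} → G ∈ₗ R → IsSimple G × IsRegular d G
    ∈-regularGraphs⁻ G∈ = proj₂ (∈P.∈-filter⁻ regularGraph? {xs = vectors (subsets n) n} G∈)

    regularGraphs-unique : Unique R
    regularGraphs-unique = UniqueP.filter⁺ regularGraph? (vectors-unique (subsets-unique n) n)

    module _ {P P′ : Graph n → Fin n → Fin n → Fin n → Fin n → Set}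
             (P? : ∀ G u v x y → Dec (P G u v x y)) (P′? : ∀ G u v x y → Dec (P′ G u v x y)) where

      -- For a fixed quadruple the switching is injective on the graphs satisfying `P`, being undone
      -- by the switching at (u , x , v , y). Moving the sum over quadruples outside therefore
      -- reduces the claim to a reindexing of graphs.
      switching : (∀ {G u v x y} → G ∈ₗ R → P G u v x y → Switchable G u v x y × P′ (switch G u v x y) u v x y) →
                  ∑[ G ← R ] ∑⁴ (λ u v x y → 𝟙 (P? G u v x y)) ≤ ∑[ G ← R ] ∑⁴ (λ u v x y → 𝟙 (P′? G u v x y))
      switching step = begin
        ∑[ G ← R ] ∑⁴ (λ u v x y → 𝟙 (P? G u v x y)) ≡⟨ ∑⁴-swap R (λ G u v x y → 𝟙 (P? G u v x y)) ⟩
        ∑⁴ (λ u v x y → ∑[ G ← R ] 𝟙 (P? G u v x y)) ≤⟨ ∑⁴-mono reindex ⟩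
        ∑⁴ (λ u v x y → ∑[ G ← R ] 𝟙 (P′? G u v x y)) ≡⟨ ∑⁴-swap R (λ G u v x y → 𝟙 (P′? G u v x y)) ⟨
        ∑[ G ← R ] ∑⁴ (λ u v x y → 𝟙 (P′? G u v x y)) ∎
        where
        open ≤-Reasoning
        module _ (u v x y : Fin n) where
          switched-back : ∀ {G} → G ∈ₗ R → 1 ≤ 𝟙 (P? G u v x y) → switch (switch G u v x y) u x v y ≡ G
          switched-back {G} G∈ p = switch-involutive (proj₁ (∈-regularGraphs⁻ G∈)) (proj₁ (step G∈ (𝟙-positive (P? G u v x y) p)))
          fit : ∀ {G} → G ∈ₗ R → 1 ≤ 𝟙 (P? G u v x y) → switch G u v x y ∈ₗ R × 𝟙 (P? G u v x y) ≤ 𝟙 (P′? (switch G u v x y) u v x y)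
          fit {G} G∈ p with simple , reg ← ∈-regularGraphs⁻ G∈ | sw , p′ ← step G∈ (𝟙-positive (P? G u v x y) p) =
            ∈-regularGraphs⁺ (switch-simple simple sw) (switch-regular simple sw reg) ,
            𝟙-mono (P? G u v x y) (P′? (switch G u v x y) u v x y) λ _ → p′
          reindex : ∑[ G ← R ] 𝟙 (P? G u v x y) ≤ ∑[ G ← R ] 𝟙 (P′? G u v x y)
          reindex = ∑-injection (λ G → switch G u v x y) regularGraphs-unique fit λ {G} {H} G∈ H∈ p q eq →
            trans (sym (switched-back G∈ p)) (trans (cong (λ K → switch K u x v y) eq) (switched-back H∈ q))

  -- Dense vertex sets

  module _ {n : ℕ} where

    Inside : Graph n → Subset n → Fin n → Fin n → Set
    Inside G V u v = u ∈ V × v ∈ V × Adj G u v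

    inside? : ∀ G V u v → Dec (Inside G V u v)
    inside? G V u v = u ∈? V ×-dec v ∈? V ×-dec adj? G u v

    -- Each edge inside V is counted twice.
    inner : Graph n → Subset n → ℕ
    inner G V = ∑²[ u , v ] 𝟙 (inside? G V u v)

    module _ {d : ℕ} {G : Graph n} (reg : IsRegular d G) where

      degree-sumˡ : ∀ w → ∑²[ u , v ] (w u * 𝟙 (adj? G u v)) ≡ ∑ (allFin n) w * d
      degree-sumˡ w = trans
        (∑-cong (allFin n) λ u → trans (∑-*ˡ (allFin n) (w u) (λ v → 𝟙 (adj? G u v))) (cong (w u *_) (degree {G = G} reg u)))
        (∑-*ʳ (allFin n) d w)

      degree-sumʳ : IsSimple G → ∀ w → ∑²[ u , v ] (w v * 𝟙 (adj? G u v)) ≡ ∑ (allFin n) w * d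
      degree-sumʳ simple w = trans (∑-swap (allFin n) (allFin n) (λ u v → w v * 𝟙 (adj? G u v))) (trans
        (∑²-cong λ v u → cong (w v *_) (𝟙-cong (adj? G u v) (adj? G v u) (proj₁ simple u v) (proj₁ simple v u)))
        (degree-sumˡ w))

      total-degree : ∑²[ u , v ] 𝟙 (adj? G u v) ≡ n * d
      total-degree = trans (∑-cong (allFin n) (degree {G = G} reg)) (∑-fins-const n d)

    module _ {G : Graph n} (simple : IsSimple G) {u v x y : Fin n} (sw : Switchable G u v x y) (V : Subset n) where

      -- Of the two removed edges only uv can lie inside V, and it accounts for two ordered pairs.
      inner-switch : ¬ (x ∈ V × y ∈ V) → inner G V ≤ inner (switch G u v x y) V + 2
      inner-switch ¬xy = begin
        inner G V ≤⟨ ∑²-mono (λ a b → 𝟙-≤ (inside? G V a b) (kept a b)) ⟩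
        ∑²[ a , b ] (𝟙 (inside? G′ V a b) + 𝟙 (isEdge? u v a b)) ≡⟨ ∑²-+ (λ a b → 𝟙 (inside? G′ V a b)) (λ a b → 𝟙 (isEdge? u v a b)) ⟩
        inner G′ V + (∑²[ a , b ] 𝟙 (isEdge? u v a b)) ≡⟨ cong (inner G′ V +_) (edge-total (u≢v simple sw)) ⟩
        inner G′ V + 2 ∎
        where
        open ≤-Reasoning
        G′ = switch G u v x y
        kept : ∀ a b → Inside G V a b → 1 ≤ 𝟙 (inside? G′ V a b) + 𝟙 (isEdge? u v a b)
        kept a b (a∈ , b∈ , ab) with isEdge? u v a b
        ... | yes _ = m≤n+m 1 _
        ... | no ¬uv = ≤-trans (1≤𝟙 (inside? G′ V a b) (a∈ , b∈ , adj-switch⁺ {G = G} (inj₂ (ab , ¬removed)))) (m≤m+n _ 0)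
          where
          ¬removed : ¬ Removed u v x y a b
          ¬removed (inj₁ e) = ¬uv e
          ¬removed (inj₂ (inj₁ (refl , refl))) = ¬xy (a∈ , b∈)
          ¬removed (inj₂ (inj₂ (refl , refl))) = ¬xy (b∈ , a∈)

  denseGraphs : ∀ {n} → ℕ → Subset n → ℕ → ℕ
  denseGraphs {n} d V h = ∑[ G ← regularGraphs n d ] 𝟙 (2 * h ≤? inner G V)

  module _ {n d : ℕ} (2≤d : 2 ≤ d) (V : Subset n) (small : 2 * (∣ V ∣ + 2 * d + 1) ≤ n) where

    private
      k = ∣ V ∣
      R = regularGraphs n d

      Far : Graph n → Fin n → Fin n → Fin n → Fin n → Set
      Far G u v x y = (x ∉ V × Adj G x y) × ¬ Adj G u x × ¬ Adj G v y × v ≢ y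

      far? : ∀ G u v x y → Dec (Far G u v x y)
      far? G u v x y = (¬? (x ∈? V) ×-dec adj? G x y) ×-dec ¬? (adj? G u x) ×-dec ¬? (adj? G v y) ×-dec ¬? (v Fin.≟ y)

      Forward Backward : ℕ → Graph n → Fin n → Fin n → Fin n → Fin n → Set
      Forward  h G u v x y = 2 * suc h ≤ inner G V × Inside G V u v × Far G u v x y
      Backward h G u v x y = (2 * h ≤ inner G V × u ∈ V × v ∈ V) × Adj G u x × Adj G v y

      forward? : ∀ h G u v x y → Dec (Forward h G u v x y)
      forward? h G u v x y = (2 * suc h ≤? inner G V) ×-dec inside? G V u v ×-dec far? G u v x y

      backward? : ∀ h G u v x y → Dec (Backward h G u v x y)
      backward? h G u v x y = ((2 * h ≤? inner G V) ×-dec (u ∈? V) ×-dec (v ∈? V)) ×-dec adj? G u x ×-dec adj? G v y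

      step : ∀ h {G u v x y} → G ∈ₗ R → Forward h G u v x y →
             Switchable G u v x y × Backward h (switch G u v x y) u v x y
      step h {G} {u} {v} {x} {y} G∈ (dense , (u∈ , v∈ , uv) , (x∉ , xy) , ux , vy , v≢y) =
        sw , ((dense′ , u∈ , v∈) , created (inj₁ (inj₁ (refl , refl))) , created (inj₂ (inj₁ (refl , refl))))
        where
        created : ∀ {a b} → Added u v x y a b → Adj (switch G u v x y) a b
        created = adj-switch⁺ {G = G} {u} {v} {x} {y} ∘ inj₁
        sw : Switchable G u v x y
        sw = record { uv = uv ; xy = xy ; ux = ux ; vy = vy ; u≢x = λ { refl → x∉ u∈ } ; v≢y = v≢y }
        dense′ : 2 * h ≤ inner (switch G u v x y) V
        dense′ = +-cancelʳ-≤ 2 (2 * h) _ (≤-trans (≤-reflexive (lemma h)) (≤-trans dense (inner-switch (proj₁ (∈-regularGraphs⁻ G∈)) sw V (x∉ ∘ proj₁))))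
          where
          lemma : ∀ h → 2 * h + 2 ≡ 2 * suc h
          lemma = solve-∀

      -- Of the n d ordered adjacent pairs (x , y), at most k d have x in V, at most d² have x
      -- adjacent to u, and at most (d + 1) d have y equal or adjacent to v. By `small` these are at
      -- most half of all pairs, and d ≥ 2 leaves at least n.
      far-count : ∀ {G} → G ∈ₗ R → ∀ u v → n ≤ ∑²[ x , y ] 𝟙 (far? G u v x y)
      far-count {G} G∈ u v with simple , reg ← ∈-regularGraphs⁻ G∈ = *-cancelˡ-≤ 2 (arith F total)
        where
        F : ℕ
        F = ∑²[ x , y ] 𝟙 (far? G u v x y)
        split : ∀ x y → 𝟙 (adj? G x y) ≤ 𝟙 (far? G u v x y) +
          (𝟙 (x ∈? V) * 𝟙 (adj? G x y) + 𝟙 (adj? G u x) * 𝟙 (adj? G x y) + (𝟙 (adj? G v y) + 𝟙 (v Fin.≟ y)) * 𝟙 (adj? G x y))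
        split x y with adj? G x y
        ... | no _ = z≤n
        ... | yes _ with x ∈? V | adj? G u x | adj? G v y | v Fin.≟ y
        ...   | yes _ | _     | _     | _     = s≤s z≤n
        ...   | no _  | yes _ | _     | _     = s≤s z≤n
        ...   | no _  | no _  | yes _ | _     = s≤s z≤n
        ...   | no _  | no _  | no _  | yes _ = s≤s z≤n
        ...   | no _  | no _  | no _  | no _  = s≤s z≤n
        total : n * d ≤ F + (k * d + d * d + (d + 1) * d)
        total = begin
          n * d ≡⟨ total-degree {G = G} reg ⟨
          ∑²[ x , y ] 𝟙 (adj? G x y) ≤⟨ ∑-mono (allFin n) (λ x → ∑-mono (allFin n) (split x)) ⟩
          ∑² (λ x y → 𝟙 (far? G u v x y) + (f₁ x y + f₂ x y + f₃ x y)) ≡⟨ ∑²-+ (λ x y → 𝟙 (far? G u v x y)) (λ x y → f₁ x y + f₂ x y + f₃ x y) ⟩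
          F + ∑² (λ x y → f₁ x y + f₂ x y + f₃ x y) ≡⟨ cong (F +_) (trans (∑²-+ (λ x y → f₁ x y + f₂ x y) f₃) (cong (_+ ∑² f₃) (∑²-+ f₁ f₂))) ⟩
          F + (∑² f₁ + ∑² f₂ + ∑² f₃) ≡⟨ cong (F +_) (cong₂ _+_ (cong₂ _+_ (degree-sumˡ {G = G} reg λ x → 𝟙 (x ∈? V)) (degree-sumˡ {G = G} reg λ x → 𝟙 (adj? G u x)))
                                                                                                    (degree-sumʳ {G = G} reg simple λ y → 𝟙 (adj? G v y) + 𝟙 (v Fin.≟ y))) ⟩
          F + (∑ (allFin n) (λ x → 𝟙 (x ∈? V)) * d + ∑ (allFin n) (λ x → 𝟙 (adj? G u x)) * d + ∑ (allFin n) (λ y → 𝟙 (adj? G v y) + 𝟙 (v Fin.≟ y)) * d)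
            ≡⟨ cong (F +_) (cong₂ _+_ (cong₂ _+_ (cong (_* d) (sym (∣p∣≡∑ V))) (cong (_* d) (degree {G = G} reg u)))
                 (cong (_* d) (trans (∑-+ (allFin n) (λ y → 𝟙 (adj? G v y)) (λ y → 𝟙 (v Fin.≟ y))) (cong₂ _+_ (degree {G = G} reg v) (∑-point₁ v))))) ⟩
          F + (k * d + d * d + (d + 1) * d) ∎
          where
          open ≤-Reasoning
          f₁ f₂ f₃ : Fin n → Fin n → ℕ
          f₁ x y = 𝟙 (x ∈? V) * 𝟙 (adj? G x y)
          f₂ x y = 𝟙 (adj? G u x) * 𝟙 (adj? G x y)
          f₃ x y = (𝟙 (adj? G v y) + 𝟙 (v Fin.≟ y)) * 𝟙 (adj? G x y)
        arith : ∀ F → n * d ≤ F + (k * d + d * d + (d + 1) * d) → 2 * n ≤ 2 * F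
        arith F le = +-cancelʳ-≤ (d * n) _ _ (begin
          2 * n + d * n ≤⟨ +-monoˡ-≤ (d * n) (*-monoˡ-≤ n 2≤d) ⟩
          d * n + d * n ≡⟨ lemma₁ d n ⟩
          2 * (n * d) ≤⟨ *-monoʳ-≤ 2 le ⟩
          2 * (F + (k * d + d * d + (d + 1) * d)) ≡⟨ lemma₂ F k d ⟩
          2 * F + d * (2 * (k + 2 * d + 1)) ≤⟨ +-monoʳ-≤ (2 * F) (*-monoʳ-≤ d small) ⟩
          2 * F + d * n ∎)
          where
          open ≤-Reasoning
          lemma₁ : ∀ d n → d * n + d * n ≡ 2 * (n * d)
          lemma₁ = solve-∀
          lemma₂ : ∀ F k d → 2 * (F + (k * d + d * d + (d + 1) * d)) ≡ 2 * F + d * (2 * (k + 2 * d + 1))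
          lemma₂ = solve-∀

      forward-count : ∀ h {G} → G ∈ₗ R → 𝟙 (2 * suc h ≤? inner G V) * (suc h * n) ≤ ∑⁴ (λ u v x y → 𝟙 (forward? h G u v x y))
      forward-count h {G} G∈ = cases (2 * suc h ≤? inner G V)
        where
        cases : Dec (2 * suc h ≤ inner G V) → 𝟙 (2 * suc h ≤? inner G V) * (suc h * n) ≤ ∑⁴ (λ u v x y → 𝟙 (forward? h G u v x y))
        cases (no ¬dense) = ≤-trans (≤-reflexive (cong (_* (suc h * n)) (𝟙-no (2 * suc h ≤? inner G V) ¬dense))) z≤n
        cases (yes dense) = begin
          𝟙 (2 * suc h ≤? inner G V) * (suc h * n) ≤⟨ *-monoˡ-≤ (suc h * n) (𝟙≤1 (2 * suc h ≤? inner G V)) ⟩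
          1 * (suc h * n) ≡⟨ *-identityˡ _ ⟩
          suc h * n ≤⟨ *-monoˡ-≤ n (≤-trans (m≤n*m (suc h) 2) dense) ⟩
          inner G V * n ≡⟨ ∑²-*ʳ n (λ u v → 𝟙 (inside? G V u v)) ⟨
          ∑²[ u , v ] (𝟙 (inside? G V u v) * n) ≤⟨ ∑²-mono (λ u v → pair u v) ⟩
          ∑⁴ (λ u v x y → 𝟙 (forward? h G u v x y)) ∎
          where
          open ≤-Reasoning
          pair : ∀ u v → 𝟙 (inside? G V u v) * n ≤ ∑²[ x , y ] 𝟙 (forward? h G u v x y)
          pair u v with inside? G V u v in eq
          ... | no _   = z≤n
          ... | yes uv = begin
            n + 0 ≡⟨ +-identityʳ n ⟩
            n ≤⟨ far-count G∈ u v ⟩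
            ∑²[ x , y ] 𝟙 (far? G u v x y) ≤⟨ ∑²-mono (λ x y →
                                                                                    𝟙-mono (far? G u v x y) ((2 * suc h ≤? inner G V) ×-dec yes uv ×-dec far? G u v x y) λ far → dense , uv , far) ⟩
            ∑²[ x , y ] 𝟙 ((2 * suc h ≤? inner G V) ×-dec yes uv ×-dec far? G u v x y) ∎

      backward-count : ∀ h {G} → G ∈ₗ R → ∑⁴ (λ u v x y → 𝟙 (backward? h G u v x y)) ≡ 𝟙 (2 * h ≤? inner G V) * (k * k * (d * d))
      backward-count h {G} G∈ with simple , reg ← ∈-regularGraphs⁻ G∈ = begin
        ∑⁴ (λ u v x y → 𝟙 (backward? h G u v x y))
          ≡⟨ ∑²-cong neighbour-pairs ⟩
        ∑²[ u , v ] (D * (𝟙 (u ∈? V) * 𝟙 (v ∈? V)) * (d * d))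
          ≡⟨ trans (∑²-*ʳ (d * d) (λ u v → D * (𝟙 (u ∈? V) * 𝟙 (v ∈? V)))) (cong (_* (d * d)) (∑²-*ˡ D (λ u v → 𝟙 (u ∈? V) * 𝟙 (v ∈? V)))) ⟩
        D * (∑²[ u , v ] (𝟙 (u ∈? V) * 𝟙 (v ∈? V))) * (d * d)
          ≡⟨ cong (λ z → D * z * (d * d)) (trans (sym (∑-* (allFin n) (allFin n) (λ u → 𝟙 (u ∈? V)) (λ v → 𝟙 (v ∈? V)))) (cong₂ _*_ (sym (∣p∣≡∑ V)) (sym (∣p∣≡∑ V)))) ⟩
        D * (k * k) * (d * d)
          ≡⟨ *-assoc D (k * k) (d * d) ⟩
        D * (k * k * (d * d)) ∎
        where
        open ≡-Reasoning
        D = 𝟙 (2 * h ≤? inner G V)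
        neighbour-pairs : ∀ u v → ∑²[ x , y ] 𝟙 (backward? h G u v x y) ≡ D * (𝟙 (u ∈? V) * 𝟙 (v ∈? V)) * (d * d)
        neighbour-pairs u v = begin
          ∑²[ x , y ] 𝟙 (backward? h G u v x y)
            ≡⟨ (∑²-cong λ x y → trans (𝟙-× base (adj? G u x ×-dec adj? G v y)) (cong (𝟙 base *_) (𝟙-× (adj? G u x) (adj? G v y)))) ⟩
          ∑²[ x , y ] (𝟙 base * (𝟙 (adj? G u x) * 𝟙 (adj? G v y)))
            ≡⟨ ∑²-*ˡ (𝟙 base) (λ x y → 𝟙 (adj? G u x) * 𝟙 (adj? G v y)) ⟩
          𝟙 base * (∑²[ x , y ] (𝟙 (adj? G u x) * 𝟙 (adj? G v y)))
            ≡⟨ cong₂ _*_ (trans (𝟙-× (2 * h ≤? inner G V) ((u ∈? V) ×-dec (v ∈? V))) (cong (D *_) (𝟙-× (u ∈? V) (v ∈? V))))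
                 (trans (sym (∑-* (allFin n) (allFin n) (λ x → 𝟙 (adj? G u x)) (λ y → 𝟙 (adj? G v y)))) (cong₂ _*_ (degree {G = G} reg u) (degree {G = G} reg v))) ⟩
          D * (𝟙 (u ∈? V) * 𝟙 (v ∈? V)) * (d * d) ∎
          where base = (2 * h ≤? inner G V) ×-dec (u ∈? V) ×-dec (v ∈? V)

    -- A graph with at least `suc h` edges inside V admits at least `suc h * n` switchings that move
    -- such an edge out. Conversely, in the resulting graph the quadruple is given by u and v in V
    -- and a neighbour of each, hence the k² d² choices.
    dense-step : ∀ h → denseGraphs d V (suc h) * (suc h * n) ≤ denseGraphs d V h * (k * k * (d * d))
    dense-step h = begin
      denseGraphs d V (suc h) * (suc h * n) ≡⟨ ∑-*ʳ R (suc h * n) (λ G → 𝟙 (2 * suc h ≤? inner G V)) ⟨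
      ∑[ G ← R ] (𝟙 (2 * suc h ≤? inner G V) * (suc h * n)) ≤⟨ ∑-mono-∈ R (forward-count h) ⟩
      ∑[ G ← R ] ∑⁴ (λ u v x y → 𝟙 (forward? h G u v x y)) ≤⟨ switching (forward? h) (backward? h) (step h) ⟩
      ∑[ G ← R ] ∑⁴ (λ u v x y → 𝟙 (backward? h G u v x y)) ≤⟨ ∑-mono-∈ R (λ G∈ → ≤-reflexive (backward-count h G∈)) ⟩
      ∑[ G ← R ] (𝟙 (2 * h ≤? inner G V) * (k * k * (d * d))) ≡⟨ ∑-*ʳ R (k * k * (d * d)) (λ G → 𝟙 (2 * h ≤? inner G V)) ⟩
      denseGraphs d V h * (k * k * (d * d)) ∎
      where open ≤-Reasoning

    dense-bound : ∀ h → denseGraphs d V h * (n ^ h * h !) ≤ length R * (k * k * (d * d)) ^ h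
    dense-bound zero    = *-monoˡ-≤ 1 all
      where
      all : denseGraphs d V 0 ≤ length R
      all = ≤-trans (∑-mono R λ G → 𝟙≤1 (0 ≤? inner G V)) (≤-reflexive (trans (∑-const R 1) (*-identityʳ _)))
    dense-bound (suc h) = begin
      denseGraphs d V (suc h) * (n ^ suc h * (suc h) !) ≡⟨ lemma₁ (denseGraphs d V (suc h)) n (n ^ h) (suc h) (h !) ⟩
      denseGraphs d V (suc h) * (suc h * n) * (n ^ h * h !) ≤⟨ *-monoˡ-≤ (n ^ h * h !) (dense-step h) ⟩
      denseGraphs d V h * c * (n ^ h * h !) ≡⟨ lemma₂ (denseGraphs d V h) c (n ^ h * h !) ⟩
      denseGraphs d V h * (n ^ h * h !) * c ≤⟨ *-monoˡ-≤ c (dense-bound h) ⟩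
      length R * c ^ h * c ≡⟨ lemma₃ (length R) (c ^ h) c ⟩
      length R * c ^ suc h ∎
      where
      open ≤-Reasoning
      c = k * k * (d * d)
      lemma₁ : ∀ m n p h f → m * (n * p * (h * f)) ≡ m * (h * n) * (p * f)
      lemma₁ = solve-∀
      lemma₂ : ∀ m c p → m * c * p ≡ m * p * c
      lemma₂ = solve-∀
      lemma₃ : ∀ r p c → r * p * c ≡ r * (c * p)
      lemma₃ = solve-∀

  -- Union bounds over vertex sets

  ^-distribʳ-* : ∀ k m n → (m * n) ^ k ≡ m ^ k * n ^ k
  ^-distribʳ-* zero    m n = refl
  ^-distribʳ-* (suc k) m n = trans (cong (m * n *_) (^-distribʳ-* k m n)) (lemma m n (m ^ k) (n ^ k))
    where
    lemma : ∀ m n p q → m * n * (p * q) ≡ m * p * (n * q)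
    lemma = solve-∀

  -- The bound 2^(a + b) on a binomial coefficient without division: Pascal's rule, multiplied by a!
  -- b!, is the splitting of the leading factor a + b of the factorial.
  [a+b]!≤2^[a+b]*a!*b! : ∀ a b → (a + b) ! ≤ 2 ^ (a + b) * (a ! * b !)
  [a+b]!≤2^[a+b]*a!*b! zero    b = ≤-trans (≤-reflexive (sym (*-identityˡ (b !)))) (*-mono-≤ (m^n>0 2 b) (≤-reflexive (sym (*-identityˡ (b !)))))
  [a+b]!≤2^[a+b]*a!*b! (suc a) zero = begin
    (suc a + 0) ! ≡⟨ cong _! (+-identityʳ (suc a)) ⟩
    (suc a) ! ≤⟨ m≤n*m ((suc a) !) (2 ^ (suc a + 0)) {{m^n≢0 2 (suc a + 0)}} ⟩
    2 ^ (suc a + 0) * (suc a) ! ≡⟨ cong (2 ^ (suc a + 0) *_) (sym (*-identityʳ ((suc a) !))) ⟩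
    2 ^ (suc a + 0) * ((suc a) ! * 0 !) ∎
    where open ≤-Reasoning
  [a+b]!≤2^[a+b]*a!*b! (suc a) (suc b) = begin
    (suc a + suc b) !
      ≡⟨ *-distribʳ-+ ((a + suc b) !) (suc a) (suc b) ⟩
    suc a * (a + suc b) ! + suc b * (a + suc b) !
      ≡⟨ cong (λ z → suc a * (a + suc b) ! + suc b * z !) (+-suc a b) ⟩
    suc a * (a + suc b) ! + suc b * (suc a + b) !
      ≤⟨ +-mono-≤ (*-monoʳ-≤ (suc a) ([a+b]!≤2^[a+b]*a!*b! a (suc b))) (*-monoʳ-≤ (suc b) ([a+b]!≤2^[a+b]*a!*b! (suc a) b)) ⟩
    suc a * (2 ^ (a + suc b) * (a ! * (suc b) !)) + suc b * (2 ^ (suc a + b) * ((suc a) ! * b !))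
      ≡⟨ cong (λ z → suc a * (2 ^ (a + suc b) * (a ! * (suc b) !)) + suc b * (2 ^ z * ((suc a) ! * b !))) (sym (+-suc a b)) ⟩
    suc a * (2 ^ (a + suc b) * (a ! * (suc b) !)) + suc b * (2 ^ (a + suc b) * ((suc a) ! * b !))
      ≡⟨ lemma (suc a) (suc b) (2 ^ (a + suc b)) (a !) (b !) ⟩
    2 ^ (suc a + suc b) * ((suc a) ! * (suc b) !) ∎
    where
    open ≤-Reasoning
    lemma : ∀ a b p x y → a * (p * (x * (b * y))) + b * (p * (a * x * y)) ≡ 2 * p * (a * x * (b * y))
    lemma = solve-∀

  m^k*m!≤[k+m]! : ∀ m k → m ^ k * m ! ≤ (k + m) !
  m^k*m!≤[k+m]! m zero    = ≤-reflexive (*-identityˡ (m !))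
  m^k*m!≤[k+m]! m (suc k) = ≤-trans (≤-reflexive (*-assoc m (m ^ k) (m !))) (*-mono-≤ (m≤n+m m (suc k)) (m^k*m!≤[k+m]! m k))

  -- An integer substitute for k^k ≤ e^k k!: on the one hand k^k k! ≤ (2k)!, on the other the
  -- central binomial coefficient is at most 4^k.
  k^k≤4^k*k! : ∀ k → k ^ k ≤ 4 ^ k * k !
  k^k≤4^k*k! k = *-cancelʳ-≤ (k ^ k) (4 ^ k * k !) (k !) {{k !≢0}} (begin
    k ^ k * k ! ≤⟨ m^k*m!≤[k+m]! k k ⟩
    (k + k) ! ≤⟨ [a+b]!≤2^[a+b]*a!*b! k k ⟩
    2 ^ (k + k) * (k ! * k !) ≡⟨ cong (_* (k ! * k !)) (trans (cong (2 ^_) (cong (k +_) (sym (+-identityʳ k)))) (sym (^-*-assoc 2 2 k))) ⟩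
    4 ^ k * (k ! * k !) ≡⟨ *-assoc (4 ^ k) (k !) (k !) ⟨
    4 ^ k * k ! * k ! ∎)
    where open ≤-Reasoning

  bernoulli : ∀ k n → suc k * n ^ k + n ^ suc k ≤ suc n ^ suc k
  bernoulli zero    n = ≤-reflexive (cong suc (refl {x = n * 1}))
  bernoulli (suc k) n = begin
    suc (suc k) * n ^ suc k + n ^ suc (suc k) ≤⟨ m≤m+n _ (suc k * n ^ k) ⟩
    suc (suc k) * (n * n ^ k) + n * (n * n ^ k) + suc k * n ^ k ≡⟨ lemma k n (n ^ k) ⟩
    suc n * (suc k * n ^ k + n * n ^ k) ≤⟨ *-monoʳ-≤ (suc n) (bernoulli k n) ⟩
    suc n ^ suc (suc k) ∎
    where
    open ≤-Reasoning
    lemma : ∀ k n p → suc (suc k) * (n * p) + n * (n * p) + suc k * p ≡ suc n * (suc k * p + n * p)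
    lemma = solve-∀

  ∑-subsets-suc : ∀ {n} (f : Subset (suc n) → ℕ) →
    ∑ (subsets (suc n)) f ≡ ∑ (subsets n) (f ∘ (true Vec.∷_)) + ∑ (subsets n) (f ∘ (false Vec.∷_))
  ∑-subsets-suc {n} f = trans (∑-++ (List.map (true Vec.∷_) (subsets n)) _ f)
    (cong₂ _+_ (∑-map (true Vec.∷_) (subsets n) f)
      (trans (∑-++ (List.map (false Vec.∷_) (subsets n)) [] f) (trans (+-identityʳ _) (∑-map (false Vec.∷_) (subsets n) f))))

  subsetsOfSize : ℕ → ℕ → ℕ
  subsetsOfSize n k = ∑[ V ← subsets n ] 𝟙 (∣ V ∣ ≟ k)

  -- Pascal's rule on the first element turns the induction step into a comparison of (n + 1)^(k +
  -- 1) with two terms of its binomial expansion, which is `bernoulli`.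
  subsetsOfSize-bound : ∀ n k → k ! * subsetsOfSize n k ≤ n ^ k
  subsetsOfSize-bound zero    zero    = ≤-refl
  subsetsOfSize-bound zero    (suc k) = ≤-reflexive (*-zeroʳ ((suc k) !))
  subsetsOfSize-bound (suc n) zero    = begin
    1 * subsetsOfSize (suc n) 0 ≡⟨ *-identityˡ _ ⟩
    subsetsOfSize (suc n) 0 ≡⟨ ∑-subsets-suc {n} (λ V → 𝟙 (∣ V ∣ ≟ 0)) ⟩
    ∑ (subsets n) (λ V → 0) + subsetsOfSize n 0 ≡⟨ cong (_+ subsetsOfSize n 0) (∑-zero (subsets n)) ⟩
    subsetsOfSize n 0 ≡⟨ *-identityˡ _ ⟨
    1 * subsetsOfSize n 0 ≤⟨ subsetsOfSize-bound n zero ⟩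
    1 ∎
    where open ≤-Reasoning
  subsetsOfSize-bound (suc n) (suc k) = begin
    (suc k) ! * subsetsOfSize (suc n) (suc k)
      ≡⟨ cong ((suc k) ! *_) (trans (∑-subsets-suc {n} (λ V → 𝟙 (∣ V ∣ ≟ suc k)))
           (cong (_+ subsetsOfSize n (suc k)) (∑-cong (subsets n) λ V → 𝟙-cong (suc ∣ V ∣ ≟ suc k) (∣ V ∣ ≟ k) suc-injective (cong suc)))) ⟩
    (suc k) ! * (subsetsOfSize n k + subsetsOfSize n (suc k))
      ≡⟨ lemma (suc k) (k !) (subsetsOfSize n k) (subsetsOfSize n (suc k)) ⟩
    suc k * (k ! * subsetsOfSize n k) + (suc k) ! * subsetsOfSize n (suc k)
      ≤⟨ +-mono-≤ (*-monoʳ-≤ (suc k) (subsetsOfSize-bound n k)) (subsetsOfSize-bound n (suc k)) ⟩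
    suc k * n ^ k + n ^ suc k
      ≤⟨ bernoulli k n ⟩
    suc n ^ suc k ∎
    where
    open ≤-Reasoning
    lemma : ∀ s f a b → s * f * (a + b) ≡ s * (f * a) + s * f * b
    lemma = solve-∀

  -- The base surviving in `union-arithmetic` for h = k + t edges: trading powers for factorials
  -- costs 4^h twice, the switchings contribute (d²)^h, and h ≤ 2k squares 16 d².
  growth : ℕ → ℕ
  growth d = (16 * (d * d)) * (16 * (d * d))

  -- In the hypothesis k! comes from choosing the vertices and (k + t)! from ordering the edges. The
  -- powers k^k and k^(k + t) on the other side are matched with these factorials, so that only the
  -- t excess edges keep a factor k / n.
  union-arithmetic : ∀ {n k d} t {T R} .{{_ : NonZero n}} .{{_ : NonZero k}} .{{_ : NonZero d}} → t ≤ k →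
    k ! * (T * (n ^ (k + t) * (k + t) !)) ≤ n ^ k * (R * (k * k * (d * d)) ^ (k + t)) →
    n ^ t * T ≤ growth d ^ k * (k ^ t * R)
  union-arithmetic {n} {k} {d} t {T} {R} t≤k hyp = *-cancelˡ-≤ (k ^ (k + h) * n ^ k) {{m*n≢0 _ _ {{m^n≢0 k (k + h)}} {{m^n≢0 n k}}}} (begin
    k ^ (k + h) * n ^ k * (n ^ t * T)
      ≡⟨ cong (λ z → z * n ^ k * (n ^ t * T)) (^-distribˡ-+-* k k h) ⟩
    k ^ k * k ^ h * n ^ k * (n ^ t * T)
      ≤⟨ *-monoˡ-≤ (n ^ t * T) (*-monoˡ-≤ (n ^ k) (*-mono-≤ (k^k≤4^k*k! k) (≤-trans (^-monoˡ-≤ h (m≤m+n k t)) (k^k≤4^k*k! h)))) ⟩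
    4 ^ k * k ! * (4 ^ h * h !) * n ^ k * (n ^ t * T)
      ≡⟨ lemma₁ (4 ^ k) (k !) (4 ^ h) (h !) (n ^ k) (n ^ t) T ⟩
    4 ^ k * 4 ^ h * (k ! * (T * (n ^ k * n ^ t * h !)))
      ≡⟨ cong (λ z → 4 ^ k * 4 ^ h * (k ! * (T * (z * h !)))) (sym (^-distribˡ-+-* n k t)) ⟩
    4 ^ k * 4 ^ h * (k ! * (T * (n ^ h * h !)))
      ≤⟨ *-mono-≤ (*-monoˡ-≤ (4 ^ h) (^-monoʳ-≤ 4 (m≤m+n k t))) hyp ⟩
    4 ^ h * 4 ^ h * (n ^ k * (R * (k * k * (d * d)) ^ h))
      ≡⟨ cong (λ z → 4 ^ h * 4 ^ h * (n ^ k * (R * z))) (trans (^-distribʳ-* h (k * k) (d * d)) (cong (_* (d * d) ^ h) (^-distribʳ-* h k k))) ⟩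
    4 ^ h * 4 ^ h * (n ^ k * (R * (k ^ h * k ^ h * (d * d) ^ h)))
      ≡⟨ lemma₂ (4 ^ h) (n ^ k) R (k ^ h) ((d * d) ^ h) ⟩
    4 ^ h * 4 ^ h * (d * d) ^ h * (k ^ h * k ^ h * (n ^ k * R))
      ≡⟨ cong (_* (k ^ h * k ^ h * (n ^ k * R))) (trans (cong (_* (d * d) ^ h) (sym (^-distribʳ-* h 4 4))) (sym (^-distribʳ-* h 16 (d * d)))) ⟩
    (16 * (d * d)) ^ h * (k ^ h * k ^ h * (n ^ k * R))
      ≤⟨ *-monoˡ-≤ (k ^ h * k ^ h * (n ^ k * R)) (^-monoʳ-≤ (16 * (d * d)) {{m*n≢0 16 (d * d) {{_}} {{m*n≢0 d d}}}} (+-monoʳ-≤ k t≤k)) ⟩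
    (16 * (d * d)) ^ (k + k) * (k ^ h * k ^ h * (n ^ k * R))
      ≡⟨ cong₂ (λ y z → y * (k ^ h * z * (n ^ k * R))) (trans (^-distribˡ-+-* (16 * (d * d)) k k) (sym (^-distribʳ-* k (16 * (d * d)) (16 * (d * d))))) (^-distribˡ-+-* k k t) ⟩
    growth d ^ k * (k ^ h * (k ^ k * k ^ t) * (n ^ k * R))
      ≡⟨ lemma₃ (growth d ^ k) (k ^ h) (k ^ k) (k ^ t) (n ^ k) R ⟩
    k ^ k * k ^ h * n ^ k * (growth d ^ k * (k ^ t * R))
      ≡⟨ cong (λ z → z * n ^ k * (growth d ^ k * (k ^ t * R))) (sym (^-distribˡ-+-* k k h)) ⟩
    k ^ (k + h) * n ^ k * (growth d ^ k * (k ^ t * R)) ∎)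
    where
    open ≤-Reasoning
    h = k + t
    lemma₁ : ∀ a b c e f g T → a * b * (c * e) * f * (g * T) ≡ a * c * (b * (T * (f * g * e)))
    lemma₁ = solve-∀
    lemma₂ : ∀ a b R c e → a * a * (b * (R * (c * c * e))) ≡ a * a * e * (c * c * (b * R))
    lemma₂ = solve-∀
    lemma₃ : ∀ g a b c e R → g * (a * (b * c) * (e * R)) ≡ b * a * e * (g * (c * R))
    lemma₃ = solve-∀

  module _ (n d : ℕ) where

    private R = regularGraphs n d

    densePairs : ℕ → ℕ → ℕ
    densePairs k h = ∑[ V ← subsets n ] (𝟙 (∣ V ∣ ≟ k) * denseGraphs d V h)

    module _ (2≤d : 2 ≤ d) {k : ℕ} .{{k≢0 : NonZero k}} (small : 2 * (k + 2 * d + 1) ≤ n) where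

      private instance
        d≢0 : NonZero d
        d≢0 = >-nonZero (≤-trans (s≤s z≤n) 2≤d)
        n≢0 : NonZero n
        n≢0 = >-nonZero (≤-trans (≤-trans (m≤n+m 1 (k + 2 * d)) (m≤n*m _ 2)) small)

      densePairs-bound : ∀ t → t ≤ k → n ^ t * densePairs k (k + t) ≤ growth d ^ k * (k ^ t * length R)
      densePairs-bound t t≤k = union-arithmetic {n} {k} {d} t t≤k (begin
        k ! * (densePairs k h * (n ^ h * h !))
          ≡⟨ cong (k ! *_) (∑-*ʳ (subsets n) (n ^ h * h !) (λ V → 𝟙 (∣ V ∣ ≟ k) * denseGraphs d V h)) ⟨
        k ! * (∑[ V ← subsets n ] (𝟙 (∣ V ∣ ≟ k) * denseGraphs d V h * (n ^ h * h !)))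
          ≤⟨ *-monoʳ-≤ (k !) (∑-mono (subsets n) pointwise) ⟩
        k ! * (∑[ V ← subsets n ] (𝟙 (∣ V ∣ ≟ k) * (length R * c ^ h)))
          ≡⟨ cong (k ! *_) (∑-*ʳ (subsets n) (length R * c ^ h) (λ V → 𝟙 (∣ V ∣ ≟ k))) ⟩
        k ! * (subsetsOfSize n k * (length R * c ^ h))
          ≡⟨ *-assoc (k !) (subsetsOfSize n k) (length R * c ^ h) ⟨
        k ! * subsetsOfSize n k * (length R * c ^ h)
          ≤⟨ *-monoˡ-≤ (length R * c ^ h) (subsetsOfSize-bound n k) ⟩
        n ^ k * (length R * c ^ h) ∎)
        where
        open ≤-Reasoning
        h = k + t
        c = k * k * (d * d)
        pointwise : ∀ V → 𝟙 (∣ V ∣ ≟ k) * denseGraphs d V h * (n ^ h * h !) ≤ 𝟙 (∣ V ∣ ≟ k) * (length R * c ^ h)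
        pointwise V = ≤-trans (≤-reflexive (*-assoc (𝟙 (∣ V ∣ ≟ k)) (denseGraphs d V h) (n ^ h * h !))) (cases (∣ V ∣ ≟ k))
          where
          cases : (k? : Dec (∣ V ∣ ≡ k)) → 𝟙 k? * (denseGraphs d V h * (n ^ h * h !)) ≤ 𝟙 k? * (length R * c ^ h)
          cases (no _)     = z≤n
          cases (yes eq) = *-monoʳ-≤ 1 (≤-trans (dense-bound {n} {d} 2≤d V (subst (λ z → 2 * (z + 2 * d + 1) ≤ n) (sym eq) small) h)
            (≤-reflexive (cong (λ z → length R * (z * z * (d * d)) ^ h) eq)))

      -- The exponent t = k / q + 1 satisfies q t ≥ k, so `scale`^t dominates (4 * growth d)^k. Of
      -- the t factors k / n, all but one are spent against `scale`; the last gives 1 / n and a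
      -- stray k. Of 4^k = 2^k 2^k, one half absorbs this k and the other is the decay needed for
      -- summation over k.
      densePairs-sparse : ∀ q .{{_ : NonZero q}} → 2 ≤ q → (4 * growth d) ^ q * k ≤ n →
        n * densePairs k (k + (k / q + 1)) * 2 ^ k ≤ (4 * growth d) ^ q * length R
      densePairs-sparse q 2≤q Ck≤n = *-cancelˡ-≤ (2 ^ k * A ^ k) {{m*n≢0 _ _ {{m^n≢0 2 k}} {{m^n≢0 A k}}}} (begin
        2 ^ k * A ^ k * (n * T * 2 ^ k)
          ≡⟨ lemma₁ (2 ^ k) (A ^ k) n T ⟩
        2 ^ k * 2 ^ k * A ^ k * (n * T)
          ≡⟨ cong (_* (n * T)) (trans (cong (_* A ^ k) (sym (^-distribʳ-* k 2 2))) (sym (^-distribʳ-* k 4 A))) ⟩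
        (4 * A) ^ k * (n * T)
          ≤⟨ *-monoˡ-≤ (n * T) (^-monoʳ-≤ (4 * A) {{4A≢0}} (k≤q*t)) ⟩
        (4 * A) ^ (q * suc s) * (n * T)
          ≡⟨ cong (_* (n * T)) (sym (^-*-assoc (4 * A) q (suc s))) ⟩
        C * C ^ s * (n * T)
          ≤⟨ divided ⟩
        C * (A ^ k * (k * length R))
          ≤⟨ *-monoʳ-≤ C (*-monoʳ-≤ (A ^ k) (*-monoˡ-≤ (length R) (m≤2^m k))) ⟩
        C * (A ^ k * (2 ^ k * length R))
          ≡⟨ lemma₃ C (A ^ k) (2 ^ k) (length R) ⟩
        2 ^ k * A ^ k * (C * length R) ∎)
        where
        open ≤-Reasoning
        A = growth d
        C = (4 * A) ^ q
        s = k / q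
        T = densePairs k (k + (s + 1))
        instance
          A≢0 : NonZero A
          A≢0 = m*n≢0 (16 * (d * d)) (16 * (d * d)) {{dd≢0}} {{dd≢0}}
            where dd≢0 = m*n≢0 16 (d * d) {{_}} {{m*n≢0 d d}}
          4A≢0 : NonZero (4 * A)
          4A≢0 = m*n≢0 4 A
        m≤2^m : ∀ m → m ≤ 2 ^ m
        m≤2^m zero    = z≤n
        m≤2^m (suc m) = +-mono-≤ (m^n>0 2 m) (≤-trans (m≤2^m m) (≤-reflexive (sym (+-identityʳ _))))
        k≤q*t : k ≤ q * suc s
        k≤q*t = begin
          k ≡⟨ m≡m%n+[m/n]*n k q ⟩
          k % q + s * q ≤⟨ +-monoˡ-≤ (s * q) (<⇒≤ (m%n<n k q)) ⟩
          suc s * q ≡⟨ *-comm (suc s) q ⟩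
          q * suc s ∎
        t≤k : s + 1 ≤ k
        t≤k = ≤-trans (≤-reflexive (+-comm s 1)) (m/n<m k q 2≤q)
        lemma₁ : ∀ a b n T → a * b * (n * T * a) ≡ a * a * b * (n * T)
        lemma₁ = solve-∀
        lemma₂ : ∀ p C c n T → p * (C * c * (n * T)) ≡ C * (n * (c * p) * T)
        lemma₂ = solve-∀
        lemma₃ : ∀ C a b R → C * (a * (b * R)) ≡ b * a * (C * R)
        lemma₃ = solve-∀
        lemma₄ : ∀ C a p k R → C * (a * (k * p * R)) ≡ p * (C * (a * (k * R)))
        lemma₄ = solve-∀
        divided : C * C ^ s * (n * T) ≤ C * (A ^ k * (k * length R))
        divided = *-cancelˡ-≤ (k ^ s) {{m^n≢0 k s}} (begin
          k ^ s * (C * C ^ s * (n * T)) ≡⟨ lemma₂ (k ^ s) C (C ^ s) n T ⟩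
          C * (n * (C ^ s * k ^ s) * T) ≡⟨ cong (λ z → C * (n * z * T)) (sym (^-distribʳ-* s C k)) ⟩
          C * (n * (C * k) ^ s * T) ≤⟨ *-monoʳ-≤ C (*-monoˡ-≤ T (*-monoʳ-≤ n (^-monoˡ-≤ s Ck≤n))) ⟩
          C * (n ^ suc s * T) ≡⟨ cong (λ z → C * (n ^ z * T)) (+-comm 1 s) ⟩
          C * (n ^ (s + 1) * T) ≤⟨ *-monoʳ-≤ C (densePairs-bound (s + 1) t≤k) ⟩
          C * (A ^ k * (k ^ (s + 1) * length R)) ≡⟨ cong (λ z → C * (A ^ k * (k ^ z * length R))) (+-comm s 1) ⟩
          C * (A ^ k * (k * k ^ s * length R)) ≡⟨ lemma₄ C (A ^ k) (k ^ s) k (length R) ⟩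
          k ^ s * (C * (A ^ k * (k * length R))) ∎)

    by-size : ∀ {P : ℕ → Set} (P? : Decidable P) (h : ℕ → ℕ) m → (∀ {k} → P k → k < m) →
      ∑[ G ← R ] ∑[ V ← subsets n ] (𝟙 (P? ∣ V ∣) * 𝟙 (2 * h ∣ V ∣ ≤? inner G V)) ≤ ∑[ k ← List.upTo m ] (𝟙 (P? k) * densePairs k (h k))
    by-size {P} P? h m P⇒< = begin
      ∑[ G ← R ] ∑[ V ← subsets n ] (𝟙 (P? ∣ V ∣) * 𝟙 (2 * h ∣ V ∣ ≤? inner G V))
        ≡⟨ ∑-swap R (subsets n) (λ G V → 𝟙 (P? ∣ V ∣) * 𝟙 (2 * h ∣ V ∣ ≤? inner G V)) ⟩
      ∑[ V ← subsets n ] ∑[ G ← R ] (𝟙 (P? ∣ V ∣) * 𝟙 (2 * h ∣ V ∣ ≤? inner G V))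
        ≡⟨ ∑-cong (subsets n) (λ V → ∑-*ˡ R (𝟙 (P? ∣ V ∣)) (λ G → 𝟙 (2 * h ∣ V ∣ ≤? inner G V))) ⟩
      ∑[ V ← subsets n ] (𝟙 (P? ∣ V ∣) * denseGraphs d V (h ∣ V ∣))
        ≤⟨ ∑-mono (subsets n) (λ V → sized V (P? ∣ V ∣)) ⟩
      ∑[ V ← subsets n ] ∑[ k ← List.upTo m ] (𝟙 (P? k) * (𝟙 (∣ V ∣ ≟ k) * denseGraphs d V (h k)))
        ≡⟨ ∑-swap (subsets n) (List.upTo m) (λ V k → 𝟙 (P? k) * (𝟙 (∣ V ∣ ≟ k) * denseGraphs d V (h k))) ⟩
      ∑[ k ← List.upTo m ] ∑[ V ← subsets n ] (𝟙 (P? k) * (𝟙 (∣ V ∣ ≟ k) * denseGraphs d V (h k)))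
        ≡⟨ ∑-cong (List.upTo m) (λ k → ∑-*ˡ (subsets n) (𝟙 (P? k)) (λ V → 𝟙 (∣ V ∣ ≟ k) * denseGraphs d V (h k))) ⟩
      ∑[ k ← List.upTo m ] (𝟙 (P? k) * densePairs k (h k)) ∎
      where
      open ≤-Reasoning
      sized : ∀ V (p? : Dec (P ∣ V ∣)) → 𝟙 p? * denseGraphs d V (h ∣ V ∣) ≤ ∑[ k ← List.upTo m ] (𝟙 (P? k) * (𝟙 (∣ V ∣ ≟ k) * denseGraphs d V (h k)))
      sized V (no _)  = z≤n
      sized V (yes p) = ≤-trans
        (≤-reflexive (cong₂ _*_ (sym (𝟙-yes (P? ∣ V ∣) p)) (trans (sym (*-identityˡ _)) (cong (_* denseGraphs d V (h ∣ V ∣)) (sym (𝟙-yes (∣ V ∣ ≟ ∣ V ∣) refl))))))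
        (∑-∈ (λ k → 𝟙 (P? k) * (𝟙 (∣ V ∣ ≟ k) * denseGraphs d V (h k))) (∈P.∈-upTo⁺ (P⇒< p)))

  geometric-sum : ∀ (f : ℕ → ℕ) {Z} m → (∀ k → k < m → f k * 2 ^ k ≤ Z) → ∑ (List.upTo m) f ≤ 2 * Z
  geometric-sum f {Z} m bound = *-cancelʳ-≤ _ _ (2 ^ m) {{m^n≢0 2 m}} (≤-trans (m≤m+n _ (2 * Z)) (partial m bound))
    where
    upTo-suc : ∀ m → ∑ (List.upTo (suc m)) f ≡ ∑ (List.upTo m) f + (f m + 0)
    upTo-suc m = trans (cong (λ l → ∑ l f) (sym (ListP.upTo-∷ʳ m))) (∑-++ (List.upTo m) (m ∷ []) f)
    lemma₁ : ∀ S g p Z → (S + (g + 0)) * (2 * p) + 2 * Z ≡ 2 * (S * p + g * p + Z)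
    lemma₁ = solve-∀
    lemma₂ : ∀ S Z → S + Z + Z ≡ S + 2 * Z
    lemma₂ = solve-∀
    -- The invariant is that the sum over k < m is at most 2 Z (1 - 2^(-m)), cleared of
    -- denominators; the summand `2 * Z` on the left makes the induction close.
    partial : ∀ m → (∀ k → k < m → f k * 2 ^ k ≤ Z) → ∑ (List.upTo m) f * 2 ^ m + 2 * Z ≤ 2 * Z * 2 ^ m
    partial zero    _     = ≤-reflexive (sym (*-identityʳ (2 * Z)))
    partial (suc m) bound = begin
      ∑ (List.upTo (suc m)) f * 2 ^ suc m + 2 * Z ≡⟨ cong (λ z → z * 2 ^ suc m + 2 * Z) (upTo-suc m) ⟩
      (∑ (List.upTo m) f + (f m + 0)) * (2 * 2 ^ m) + 2 * Z ≡⟨ lemma₁ (∑ (List.upTo m) f) (f m) (2 ^ m) Z ⟩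
      2 * (∑ (List.upTo m) f * 2 ^ m + f m * 2 ^ m + Z) ≤⟨ *-monoʳ-≤ 2 (+-monoˡ-≤ Z (+-monoʳ-≤ (∑ (List.upTo m) f * 2 ^ m) (bound m ≤-refl))) ⟩
      2 * (∑ (List.upTo m) f * 2 ^ m + Z + Z) ≡⟨ cong (2 *_) (lemma₂ (∑ (List.upTo m) f * 2 ^ m) Z) ⟩
      2 * (∑ (List.upTo m) f * 2 ^ m + 2 * Z) ≤⟨ *-monoʳ-≤ 2 (partial m λ k k<m → bound k (m≤n⇒m≤1+n k<m)) ⟩
      2 * (2 * Z * 2 ^ m) ≡⟨ lemma₃ Z (2 ^ m) ⟩
      2 * Z * 2 ^ suc m ∎
      where
      open ≤-Reasoning
      lemma₃ : ∀ Z p → 2 * (2 * Z * p) ≡ 2 * Z * (2 * p)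
      lemma₃ = solve-∀

  -- Exceptional graphs: dense sets and short cycles

  scale : ℕ → ℕ → ℕ
  scale d q = (4 * growth d) ^ q

  4≤scale : ∀ d q .{{_ : NonZero d}} .{{_ : NonZero q}} → 4 ≤ scale d q
  4≤scale d q@(suc p) = begin
    4 ≤⟨ m≤m*n 4 (growth d) {{A≢0}} ⟩
    4 * growth d ≡⟨ *-identityʳ (4 * growth d) ⟨
    (4 * growth d) ^ 1 ≤⟨ ^-monoʳ-≤ (4 * growth d) {{m*n≢0 4 (growth d) {{_}} {{A≢0}}}} (s≤s {n = p} z≤n) ⟩
    scale d q ∎
    where
    open ≤-Reasoning
    dd≢0 : NonZero (16 * (d * d))
    dd≢0 = m*n≢0 16 (d * d) {{_}} {{m*n≢0 d d}}
    A≢0 : NonZero (growth d)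
    A≢0 = m*n≢0 (16 * (d * d)) (16 * (d * d)) {{dd≢0}} {{dd≢0}}

  half-split : ∀ {n} k d → 4 * k ≤ n → 4 * (2 * d + 1) ≤ n → 2 * (k + 2 * d + 1) ≤ n
  half-split {n} k d 4k≤n big = *-cancelˡ-≤ 2 (begin
    2 * (2 * (k + 2 * d + 1)) ≡⟨ lemma k d ⟩
    4 * k + 4 * (2 * d + 1) ≤⟨ +-mono-≤ 4k≤n big ⟩
    n + n ≡⟨ cong (n +_) (sym (+-identityʳ n)) ⟩
    2 * n ∎)
    where
    open ≤-Reasoning
    lemma : ∀ k d → 2 * (2 * (k + 2 * d + 1)) ≡ 4 * k + 4 * (2 * d + 1)
    lemma = solve-∀

  module _ {n : ℕ} (d q : ℕ) .{{q≢0 : NonZero q}} where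

    -- Rounding k / q down and adding one makes the excess of a dense set at least one, the source
    -- of the factor 1 / n, while in the absence of dense sets the excess is at most the rounded
    -- quotient.
    HasDenseSet : Graph n → Set
    HasDenseSet G = ∃[ V ] (1 ≤ ∣ V ∣ × scale d q * ∣ V ∣ ≤ n) × 2 * (∣ V ∣ + (∣ V ∣ / q + 1)) ≤ inner G V

    hasDenseSet? : Decidable HasDenseSet
    hasDenseSet? G = anySubset? λ V →
      ((1 ≤? ∣ V ∣) ×-dec (scale d q * ∣ V ∣ ≤? n)) ×-dec (2 * (∣ V ∣ + (∣ V ∣ / q + 1)) ≤? inner G V)

    hasDenseSet-count : 2 ≤ d → 2 ≤ q → 4 * (2 * d + 1) ≤ n →
      n * (∑[ G ← regularGraphs n d ] 𝟙 (hasDenseSet? G)) ≤ 2 * (scale d q * length (regularGraphs n d))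
    hasDenseSet-count 2≤d 2≤q big = begin
      n * (∑[ G ← R ] 𝟙 (hasDenseSet? G))
        ≤⟨ *-monoʳ-≤ n (≤-trans (∑-mono R some-set) (by-size n d sized? (λ k → k + (k / q + 1)) (suc n) λ {k} (_ , le) → s≤s (k≤n k le))) ⟩
      n * (∑[ k ← List.upTo (suc n) ] (𝟙 (sized? k) * densePairs n d k (k + (k / q + 1))))
        ≡⟨ ∑-*ˡ (List.upTo (suc n)) n (λ k → 𝟙 (sized? k) * densePairs n d k (k + (k / q + 1))) ⟨
      ∑[ k ← List.upTo (suc n) ] (n * (𝟙 (sized? k) * densePairs n d k (k + (k / q + 1))))
        ≤⟨ geometric-sum (λ k → n * (𝟙 (sized? k) * densePairs n d k (k + (k / q + 1)))) (suc n) (λ k _ → term k (sized? k)) ⟩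
      2 * (C * length R) ∎
      where
      open ≤-Reasoning
      R = regularGraphs n d
      C = scale d q
      instance
        d≢0 : NonZero d
        d≢0 = >-nonZero (≤-trans (s≤s z≤n) 2≤d)
      sized? : Decidable (λ k → 1 ≤ k × C * k ≤ n)
      sized? k = (1 ≤? k) ×-dec (C * k ≤? n)
      4k≤n : ∀ k → C * k ≤ n → 4 * k ≤ n
      4k≤n k Ck≤n = ≤-trans (*-monoˡ-≤ k (4≤scale d q)) Ck≤n
      k≤n : ∀ k → C * k ≤ n → k ≤ n
      k≤n k Ck≤n = ≤-trans (m≤n*m k 4) (4k≤n k Ck≤n)
      some-set : ∀ G → 𝟙 (hasDenseSet? G) ≤ ∑[ V ← subsets n ] (𝟙 (sized? ∣ V ∣) * 𝟙 (2 * (∣ V ∣ + (∣ V ∣ / q + 1)) ≤? inner G V))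
      some-set G = 𝟙-≤ (hasDenseSet? G) λ (V , size , dense) → ≤-trans
        (≤-reflexive (sym (cong₂ _*_ (𝟙-yes (sized? ∣ V ∣) size) (𝟙-yes (2 * (∣ V ∣ + (∣ V ∣ / q + 1)) ≤? inner G V) dense))))
        (∑-∈ (λ V → 𝟙 (sized? ∣ V ∣) * 𝟙 (2 * (∣ V ∣ + (∣ V ∣ / q + 1)) ≤? inner G V)) (∈-subsets V))
      term : ∀ k (s? : Dec (1 ≤ k × C * k ≤ n)) → n * (𝟙 s? * densePairs n d k (k + (k / q + 1))) * 2 ^ k ≤ C * length R
      term k (no _) = ≤-trans (≤-reflexive (cong (_* 2 ^ k) (*-zeroʳ n))) z≤n
      term k (yes (1≤k , Ck≤n)) = ≤-trans (≤-reflexive (cong (λ z → n * z * 2 ^ k) (*-identityˡ _)))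
        (densePairs-sparse n d 2≤d {k} {{>-nonZero 1≤k}} (half-split k d (4k≤n k Ck≤n) big) q 2≤q Ck≤n)

  module _ {n : ℕ} where

    -- A proxy for short cycles: a connected subgraph containing a cycle has at least as many edges
    -- as vertices, so it suffices to count vertex sets, to which the union bound applies directly.
    cyclicSets : ℕ → Graph n → ℕ
    cyclicSets L G = ∑[ V ← subsets n ] (𝟙 ((1 ≤? ∣ V ∣) ×-dec (∣ V ∣ ≤? L)) * 𝟙 (2 * ∣ V ∣ ≤? inner G V))

    -- Excess t = 0 in `densePairs-bound` leaves no power of n, so the mean number of these sets is
    -- bounded in terms of d and L alone.
    cyclicSets-count : ∀ d L → 2 ≤ d → 4 * (2 * d + 1) ≤ n → 4 * L ≤ n →
      ∑ (regularGraphs n d) (cyclicSets L) ≤ ∑ (List.upTo (suc L)) (growth d ^_) * length (regularGraphs n d)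
    cyclicSets-count d L 2≤d big 4L≤n = begin
      ∑ R (cyclicSets L) ≤⟨ by-size n d sized? id (suc L) (λ (_ , le) → s≤s le) ⟩
      ∑[ k ← List.upTo (suc L) ] (𝟙 (sized? k) * densePairs n d k k) ≤⟨ ∑-mono (List.upTo (suc L)) (λ k → term k (sized? k)) ⟩
      ∑[ k ← List.upTo (suc L) ] (growth d ^ k * length R) ≡⟨ ∑-*ʳ (List.upTo (suc L)) (length R) (growth d ^_) ⟩
      ∑ (List.upTo (suc L)) (growth d ^_) * length R ∎
      where
      open ≤-Reasoning
      R = regularGraphs n d
      sized? : Decidable (λ k → 1 ≤ k × k ≤ L)
      sized? k = (1 ≤? k) ×-dec (k ≤? L)
      term : ∀ k (s? : Dec (1 ≤ k × k ≤ L)) → 𝟙 s? * densePairs n d k k ≤ growth d ^ k * length R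
      term k (no _) = z≤n
      term k (yes (1≤k , k≤L)) = begin
        1 * densePairs n d k k ≡⟨ cong (λ z → 1 * densePairs n d k z) (sym (+-identityʳ k)) ⟩
        1 * densePairs n d k (k + 0) ≤⟨ densePairs-bound n d 2≤d {k} {{>-nonZero 1≤k}} (half-split k d (≤-trans (*-monoʳ-≤ 4 k≤L) 4L≤n) big) 0 z≤n ⟩
        growth d ^ k * (1 * length R) ≡⟨ cong (growth d ^ k *_) (*-identityˡ (length R)) ⟩
        growth d ^ k * length R ∎

  markov : ∀ {A : Set} (xs : List A) (Z : A → ℕ) m n → (∑[ x ← xs ] 𝟙 (n ≤? m * Z x)) * n ≤ m * ∑ xs Z
  markov xs Z m n = begin
    (∑[ x ← xs ] 𝟙 (n ≤? m * Z x)) * n ≡⟨ ∑-*ʳ xs n (λ x → 𝟙 (n ≤? m * Z x)) ⟨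
    ∑[ x ← xs ] (𝟙 (n ≤? m * Z x) * n) ≤⟨ ∑-mono xs (λ x → term (Z x) (n ≤? m * Z x)) ⟩
    ∑[ x ← xs ] (m * Z x) ≡⟨ ∑-*ˡ xs m Z ⟩
    m * ∑ xs Z ∎
    where
    open ≤-Reasoning
    term : ∀ z (le? : Dec (n ≤ m * z)) → 𝟙 le? * n ≤ m * z
    term z (yes le) = ≤-trans (≤-reflexive (*-identityˡ n)) le
    term z (no _)   = z≤n

  -- Boundaries

  module _ {n : ℕ} where

    Crossing : Graph n → Subset n → Fin n → Fin n → Set
    Crossing G V u v = (u ∈ V × v ∉ V) × Adj G u v

    crossing? : ∀ G V u v → Dec (Crossing G V u v)
    crossing? G V u v = ((u ∈? V) ×-dec ¬? (v ∈? V)) ×-dec adj? G u v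

    boundary : Graph n → Subset n → ℕ
    boundary G V = ∑²[ u , v ] 𝟙 (crossing? G V u v)

    inner+boundary : ∀ {d} {G : Graph n} → IsRegular d G → ∀ V → inner G V + boundary G V ≡ ∣ V ∣ * d
    inner+boundary {d} {G} reg V = begin
      inner G V + boundary G V
        ≡⟨ ∑²-+ (λ u v → 𝟙 (inside? G V u v)) (λ u v → 𝟙 (crossing? G V u v)) ⟨
      ∑²[ u , v ] (𝟙 (inside? G V u v) + 𝟙 (crossing? G V u v))
        ≡⟨ ∑²-cong (λ u v → cases (u ∈? V) (v ∈? V) (adj? G u v)) ⟩
      ∑²[ u , v ] (𝟙 (u ∈? V) * 𝟙 (adj? G u v))
        ≡⟨ degree-sumˡ {G = G} reg (λ u → 𝟙 (u ∈? V)) ⟩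
      ∑ (allFin n) (λ u → 𝟙 (u ∈? V)) * d
        ≡⟨ cong (_* d) (∣p∣≡∑ V) ⟨
      ∣ V ∣ * d ∎
      where
      open ≡-Reasoning
      cases : ∀ {P Q S : Set} (P? : Dec P) (Q? : Dec Q) (S? : Dec S) →
        𝟙 (P? ×-dec Q? ×-dec S?) + 𝟙 ((P? ×-dec ¬? Q?) ×-dec S?) ≡ 𝟙 P? * 𝟙 S?
      cases (yes _) (yes _) (yes _) = refl
      cases (yes _) (yes _) (no _)  = refl
      cases (yes _) (no _)  (yes _) = refl
      cases (yes _) (no _)  (no _)  = refl
      cases (no _)  _       _       = refl

    inner-complete : ∀ {G : Graph n} → IsSimple G → ∀ V → inner G V + ∣ V ∣ ≤ ∣ V ∣ * ∣ V ∣
    inner-complete {G} simple V = begin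
      inner G V + ∣ V ∣
        ≡⟨ cong (inner G V +_) (trans (∣p∣≡∑ V) (∑-cong (allFin n) λ u → sym (∑-point u (λ v → 𝟙 (v ∈? V))))) ⟩
      inner G V + (∑²[ u , v ] (𝟙 (u Fin.≟ v) * 𝟙 (v ∈? V)))
        ≡⟨ ∑²-+ (λ u v → 𝟙 (inside? G V u v)) (λ u v → 𝟙 (u Fin.≟ v) * 𝟙 (v ∈? V)) ⟨
      ∑²[ u , v ] (𝟙 (inside? G V u v) + 𝟙 (u Fin.≟ v) * 𝟙 (v ∈? V))
        ≤⟨ (∑²-mono λ u v → pointwise u v) ⟩
      ∑²[ u , v ] (𝟙 (u ∈? V) * 𝟙 (v ∈? V))
        ≡⟨ ∑-* (allFin n) (allFin n) (λ u → 𝟙 (u ∈? V)) (λ v → 𝟙 (v ∈? V)) ⟨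
      ∑ (allFin n) (λ u → 𝟙 (u ∈? V)) * ∑ (allFin n) (λ v → 𝟙 (v ∈? V))
        ≡⟨ cong₂ _*_ (sym (∣p∣≡∑ V)) (sym (∣p∣≡∑ V)) ⟩
      ∣ V ∣ * ∣ V ∣ ∎
      where
      open ≤-Reasoning
      pointwise : ∀ u v → 𝟙 (inside? G V u v) + 𝟙 (u Fin.≟ v) * 𝟙 (v ∈? V) ≤ 𝟙 (u ∈? V) * 𝟙 (v ∈? V)
      pointwise u v with u Fin.≟ v
      ... | yes refl = diagonal (u ∈? V) (adj? G u u)
        where
        diagonal : (V? : Dec (u ∈ V)) (A? : Dec (Adj G u u)) → 𝟙 (V? ×-dec V? ×-dec A?) + (𝟙 V? + 0) ≤ 𝟙 V? * 𝟙 V?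
        diagonal _       (yes loop) = contradiction loop (proj₂ simple u)
        diagonal (yes _) (no _)     = ≤-refl
        diagonal (no _)  (no _)     = ≤-refl
      ... | no _ = ≤-trans (≤-reflexive (+-identityʳ _)) (≤-trans
        (𝟙-mono (inside? G V u v) (u ∈? V ×-dec v ∈? V) λ (u∈ , v∈ , _) → u∈ , v∈) (≤-reflexive (𝟙-× (u ∈? V) (v ∈? V))))

    -- Linear form of a dichotomy, so that it can be summed over the classes of a partition: either
    -- K has at least three boundary edges, or its size exceeds n / `scale d q`.
    sparse-boundary : ∀ {d q} .{{_ : NonZero q}} → 3 ≤ d → 8 ≤ q → ∀ {G : Graph n} → IsSimple G → IsRegular d G → ¬ HasDenseSet d q G →
      ∀ K → 1 ≤ ∣ K ∣ → 3 * n ≤ n * boundary G K + 3 * (scale d q * ∣ K ∣)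
    sparse-boundary {d} {q} 3≤d 8≤q {G} simple reg sparse K 1≤k = cases (scale d q * ∣ K ∣ ≤? n)
      where
      open ≤-Reasoning
      degrees : ∣ K ∣ * 3 ≤ inner G K + boundary G K
      degrees = ≤-trans (*-monoʳ-≤ ∣ K ∣ 3≤d) (≤-reflexive (sym (inner+boundary {G = G} reg K)))
      -- At most k (k - 1) of at least 3 k incident pairs stay inside, and 3 k - k (k - 1) ≥ 3 for k
      -- = 1, 2, 3.
      small : ∀ k → 1 ≤ k → k < 4 → k * 3 ≤ inner G K + boundary G K → inner G K + k ≤ k * k → 3 ≤ boundary G K
      small 1 _ _ deg complete = +-cancelˡ-≤ 1 3 _ (≤-trans (s≤s deg) (+-monoˡ-≤ (boundary G K) (≤-trans (≤-reflexive (+-comm 1 (inner G K))) complete)))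
      small 2 _ _ deg complete = ≤-trans (n≤1+n 3) (+-cancelˡ-≤ 4 4 _ (≤-trans (s≤s (s≤s deg)) (+-monoˡ-≤ (boundary G K) (≤-trans (≤-reflexive (+-comm 2 (inner G K))) complete))))
      small 3 _ _ deg complete = +-cancelˡ-≤ 9 3 _ (≤-trans (s≤s (s≤s (s≤s deg))) (+-monoˡ-≤ (boundary G K) (≤-trans (≤-reflexive (+-comm 3 (inner G K))) complete)))
      small (suc (suc (suc (suc _)))) _ (s≤s (s≤s (s≤s (s≤s ())))) _ _
      8j≤k : ∀ k → 8 * (k / q) ≤ k
      8j≤k k = ≤-trans (*-monoˡ-≤ (k / q) 8≤q) (≤-trans (≤-reflexive (*-comm q (k / q))) (m/n*n≤m k q))
      2j+4≤k : ∀ k j → 4 ≤ k → 8 * j ≤ k → 2 * j + 4 ≤ k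
      2j+4≤k k zero    4≤k _  = 4≤k
      2j+4≤k k (suc j) _   8j = ≤-trans (m+n≤o⇒m≤o (2 * suc j + 4) {6 * j + 2} (≤-reflexive (lemma j))) 8j
        where
        lemma : ∀ j → 2 * suc j + 4 + (6 * j + 2) ≡ 8 * suc j
        lemma = solve-∀
      -- With j = k / q, the absence of dense sets leaves a boundary of at least 3 k - (2 k + 2 j +
      -- 1) = k - 2 j - 1. This is at least 3 because q ≥ 8 and k ≥ 4.
      large : ∀ k j → 2 * j + 4 ≤ k → k * 3 ≤ inner G K + boundary G K → inner G K < 2 * (k + (j + 1)) → 3 ≤ boundary G K
      large k j le deg inner< = +-cancelˡ-≤ (2 * (k + (j + 1))) _ _ (begin
        2 * (k + (j + 1)) + 3 ≡⟨ lemma k j ⟩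
        suc (2 * k + (2 * j + 4)) ≤⟨ s≤s (+-monoʳ-≤ (2 * k) le) ⟩
        suc (2 * k + k) ≡⟨ cong suc (lemma′ k) ⟩
        suc (k * 3) ≤⟨ s≤s deg ⟩
        suc (inner G K) + boundary G K ≤⟨ +-monoˡ-≤ (boundary G K) inner< ⟩
        2 * (k + (j + 1)) + boundary G K ∎)
        where
        lemma : ∀ k j → 2 * (k + (j + 1)) + 3 ≡ suc (2 * k + (2 * j + 4))
        lemma = solve-∀
        lemma′ : ∀ k → 2 * k + k ≡ k * 3
        lemma′ = solve-∀
      cases : Dec (scale d q * ∣ K ∣ ≤ n) → 3 * n ≤ n * boundary G K + 3 * (scale d q * ∣ K ∣)
      cases (no Ck≰n) = ≤-trans (*-monoʳ-≤ 3 (<⇒≤ (≰⇒> Ck≰n))) (m≤n+m (3 * (scale d q * ∣ K ∣)) (n * boundary G K))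
      cases (yes Ck≤n) = ≤-trans (≤-reflexive (*-comm 3 n)) (≤-trans (*-monoʳ-≤ n three) (m≤m+n _ _))
        where
        three : 3 ≤ boundary G K
        three with 4 ≤? ∣ K ∣
        ... | no k<4 = small ∣ K ∣ 1≤k (≰⇒> k<4) degrees (inner-complete {G} simple K)
        ... | yes 4≤k = large ∣ K ∣ (∣ K ∣ / q) (2j+4≤k ∣ K ∣ (∣ K ∣ / q) 4≤k (8j≤k ∣ K ∣)) degrees
                          (≰⇒> λ dense → sparse (K , (1≤k , Ck≤n) , dense))

  -- Connectivity

  ∑-cartesianProduct : ∀ {A B : Set} (xs : List A) (ys : List B) f →
    ∑ (List.cartesianProduct xs ys) f ≡ ∑[ x ← xs ] ∑[ y ← ys ] f (x , y)
  ∑-cartesianProduct []       ys f = refl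
  ∑-cartesianProduct (x ∷ xs) ys f = trans (∑-++ (List.map (x ,_) ys) _ f)
    (cong₂ _+_ (∑-map (x ,_) ys f) (∑-cartesianProduct xs ys f))

  module _ {A B : Set} (_≟B_ : ∀ (x y : B) → Dec (x ≡ y)) (ℓ : A → B) where

    Distinct : List A → Set
    Distinct = AllPairs (λ r r′ → ℓ r ≢ ℓ r′)

    distinct-injective : ∀ {rs r r′} → Distinct rs → r ∈ₗ rs → r′ ∈ₗ rs → ℓ r ≡ ℓ r′ → r ≡ r′
    distinct-injective _        (here refl) (here refl) _  = refl
    distinct-injective (r≢ ∷ _) (here refl) (there r′∈) eq = contradiction eq (All.lookup r≢ r′∈)
    distinct-injective (r≢ ∷ _) (there r∈)  (here refl) eq = contradiction (sym eq) (All.lookup r≢ r∈)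
    distinct-injective (_ ∷ ds) (there r∈)  (there r′∈) eq = distinct-injective ds r∈ r′∈ eq

    distinct-sum : ∀ {rs} → Distinct rs → ∀ c → ∑[ r ← rs ] 𝟙 (ℓ r ≟B c) ≤ 1
    distinct-sum []                _ = z≤n
    distinct-sum {r ∷ rs} (r≢ ∷ ds) c with ℓ r ≟B c
    ... | no _     = distinct-sum ds c
    ... | yes refl = s≤s (≤-reflexive (none rs r≢))
      where
      none : ∀ rs → All (λ r′ → ℓ r ≢ ℓ r′) rs → ∑[ r′ ← rs ] 𝟙 (ℓ r′ ≟B ℓ r) ≡ 0
      none []        []        = refl
      none (r′ ∷ rs) (ne ∷ nes) = cong₂ _+_ (𝟙-no (ℓ r′ ≟B ℓ r) (ne ∘ sym)) (none rs nes)

  module _ {n : ℕ} (G : Graph n) where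

    Cuts : Subset n → Fin n → Fin n → Fin n → Fin n → Set
    Cuts V a x b y = ((a ∈ V × b ∈ V) × (x ∉ V × y ∉ V)) × (∀ s t → (s ∈ V × t ∉ V) × Adj G s t → (a ≡ s × x ≡ t) ⊎ (b ≡ s × y ≡ t))

    cuts? : ∀ V a x b y → Dec (Cuts V a x b y)
    cuts? V a x b y = ((a ∈? V ×-dec b ∈? V) ×-dec (¬? (x ∈? V) ×-dec ¬? (y ∈? V))) ×-dec
      (FinP.all? λ s → FinP.all? λ t → crossing? G V s t →-dec ((a Fin.≟ s ×-dec x Fin.≟ t) ⊎-dec (b Fin.≟ s ×-dec y Fin.≟ t)))

    TwoCut : Fin n → Fin n → Fin n → Fin n → Set
    TwoCut a x b y = (Adj G a x × Adj G b y) × a ≢ b × ∃[ V ] Cuts V a x b y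

    twoCut? : ∀ a x b y → Dec (TwoCut a x b y)
    twoCut? a x b y = (adj? G a x ×-dec adj? G b y) ×-dec ¬? (a Fin.≟ b) ×-dec anySubset? λ V → cuts? V a x b y

    module _ (simple : IsSimple G) {a x : Fin n} (ax : Adj G a x)
             (Forward : Fin n → Fin n → Set) (asym : ∀ {b y} → Forward b y → ¬ Forward y b) where

      private
        -- One bit per cut, recording the side on which a vertex lies.
        Label : Set
        Label = List Bool

        _≟L_ : (l m : Label) → Dec (l ≡ m)
        _≟L_ = ListP.≡-dec Bool._≟_

        -- `Forward` selects one orientation, so that (b , y) and (y , b) are never both listed and
        -- distinct pairs are distinct edges.
        OrientedCut : Fin n × Fin n → Set
        OrientedCut (b , y) = Forward b y × TwoCut a x b y

        IsCutEdge : List (Fin n × Fin n) → Fin n → Fin n → Set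
        IsCutEdge ps s t = IsEdge a x s t ⊎ Any (λ (b , y) → IsEdge b y s t) ps

      -- m two-edge cuts through ax split the vertices into at least m + 1 classes such that only the cut edges join
      -- different classes: the side of a new cut separates the ends of its second edge, which shared a class before.
      record Partition (ps : List (Fin n × Fin n)) : Set where
        field
          ℓ        : Fin n → Label
          reps     : List (Fin n)
          distinct : Distinct _≟L_ ℓ reps
          count    : length reps ≡ suc (length ps)
          joins    : ∀ {s t} → Adj G s t → ℓ s ≢ ℓ t → IsCutEdge ps s t

      partition : ∀ ps → Unique ps → All OrientedCut ps → Partition ps
      partition [] _ _ = record
        { ℓ = λ _ → [] ; reps = a ∷ [] ; distinct = [] ∷ [] ; count = refl ; joins = λ _ ne → contradiction refl ne }
      partition ((b , y) ∷ ps) (p∉ ∷ u) ((fwd , (_ , by) , a≢b , V , ((a∈ , b∈) , (x∉ , y∉)) , crossing) ∷ cuts) = record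
        { ℓ = ℓ′ ; reps = proj₁ new ∷ reps ; distinct = proj₂ new ∷ AllPairs.map (λ ne → ne ∘ ListP.∷-injectiveʳ) distinct
        ; count = cong suc count ; joins = joins′ }
        where
        open Partition (partition ps u cuts)
        side : Fin n → Bool
        side v = does (v ∈? V)
        ℓ′ : Fin n → Label
        ℓ′ v = side v ∷ ℓ v
        -- If the adjacent vertices b and y had different labels, by would be an earlier cut edge.
        -- It is not ax, because a ≢ b and because y lies outside V while a lies inside; it is not
        -- in `ps`, by uniqueness for one orientation and by asymmetry for the other.
        same-class : ℓ b ≡ ℓ y
        same-class with ℓ b ≟L ℓ y
        ... | yes eq = eq
        ... | no ne with joins by ne
        ...   | inj₁ (inj₁ (eq , _))     = contradiction eq a≢b
        ...   | inj₁ (inj₂ (_ , refl))   = contradiction a∈ y∉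
        ...   | inj₂ e with _ , p∈ , e′ ← find e with e′ | All.lookup p∉ p∈ | All.lookup cuts p∈
        ...     | inj₁ (refl , refl) | p≢ | _        = contradiction refl p≢
        ...     | inj₂ (refl , refl) | _  | fwd′ , _ = contradiction fwd′ (asym fwd)
        -- The old class shared by b and y has at most one representative, and b and y now lie on
        -- opposite sides of V. So at least one of them is separated from that representative and
        -- can be added.
        new : ∃[ z ] All (λ r → ℓ′ z ≢ ℓ′ r) reps
        new with Any.any? (λ r → ℓ′ b ≟L ℓ′ r) reps
        ... | no ¬b = b , AllP.¬Any⇒All¬ reps ¬b
        ... | yes b∈reps with r , r∈ , eq ← find b∈reps = y , All.tabulate λ {r′} r′∈ eq′ →
          let r≡r′ = distinct-injective _≟L_ ℓ distinct r∈ r′∈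
                       (trans (sym (ListP.∷-injectiveʳ eq)) (trans same-class (ListP.∷-injectiveʳ eq′)))
              b~y = trans (ListP.∷-injectiveˡ eq) (trans (cong side r≡r′) (sym (ListP.∷-injectiveˡ eq′)))
          in case trans (sym (dec-true (b ∈? V) b∈)) (trans b~y (dec-false (y ∈? V) y∉)) of λ ()
        joins′ : ∀ {s t} → Adj G s t → ℓ′ s ≢ ℓ′ t → IsCutEdge ((b , y) ∷ ps) s t
        joins′ {s} {t} st ne with s ∈? V | t ∈? V
        ... | yes s∈ | no t∉ with crossing s t ((s∈ , t∉) , st)
        ...   | inj₁ e = inj₁ (inj₁ e)
        ...   | inj₂ e = inj₂ (here (inj₁ e))
        joins′ {s} {t} st ne | no s∉ | yes t∈ with crossing t s ((t∈ , s∉) , proj₁ simple s t st)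
        ...   | inj₁ (p , q) = inj₁ (inj₂ (q , p))
        ...   | inj₂ (p , q) = inj₂ (here (inj₂ (q , p)))
        joins′ {s} {t} st ne | yes _ | yes _ with joins st (ne ∘ cong (true ∷_))
        ...   | inj₁ e = inj₁ e
        ...   | inj₂ e = inj₂ (there e)
        joins′ {s} {t} st ne | no _  | no _ with joins st (ne ∘ cong (false ∷_))
        ...   | inj₁ e = inj₁ e
        ...   | inj₂ e = inj₂ (there e)

      module _ {C : ℕ} (expansion : ∀ K → 1 ≤ ∣ K ∣ → 3 * n ≤ n * boundary G K + 3 * (C * ∣ K ∣)) where

        -- Three against two: expansion asks for 3 n from each of the m + 1 classes, whereas the m +
        -- 1 cut edges contribute at most two ordered pairs each to all boundaries together. The
        -- difference n (m + 1) must be paid by the class sizes, whose total contribution is at most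
        -- 3 C n.
        cuts-bound : ∀ ps → Unique ps → All OrientedCut ps → length ps ≤ 3 * C
        cuts-bound ps u cuts = ≤-trans (n≤1+n m) (*-cancelˡ-≤ n {{FinP.nonZeroIndex a}} (+-cancelˡ-≤ (2 * (n * suc m)) _ _ (begin
          2 * (n * suc m) + n * suc m
            ≡⟨ lemma₁ n (suc m) ⟩
          suc m * (3 * n)
            ≡⟨ trans (∑-const reps (3 * n)) (cong (_* (3 * n)) count) ⟨
          ∑[ r ← reps ] (3 * n)
            ≤⟨ ∑-mono reps (λ r → expansion (K r) (x∈p⇒1≤∣p∣ {i = r} (K⁺ refl))) ⟩
          ∑[ r ← reps ] (n * boundary G (K r) + 3 * (C * ∣ K r ∣))
            ≡⟨ ∑-+ reps (λ r → n * boundary G (K r)) (λ r → 3 * (C * ∣ K r ∣)) ⟩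
          (∑[ r ← reps ] (n * boundary G (K r))) + (∑[ r ← reps ] (3 * (C * ∣ K r ∣)))
            ≡⟨ cong₂ _+_ (∑-*ˡ reps n (λ r → boundary G (K r))) (trans (∑-*ˡ reps 3 (λ r → C * ∣ K r ∣)) (cong (3 *_) (∑-*ˡ reps C (λ r → ∣ K r ∣)))) ⟩
          n * (∑[ r ← reps ] boundary G (K r)) + 3 * (C * (∑[ r ← reps ] ∣ K r ∣))
            ≤⟨ +-mono-≤ (*-monoʳ-≤ n boundaries) (*-monoʳ-≤ 3 (*-monoʳ-≤ C sizes)) ⟩
          n * (2 * suc m) + 3 * (C * n)
            ≡⟨ lemma₂ n (suc m) C ⟩
          2 * (n * suc m) + n * (3 * C) ∎)))
          where
          open ≤-Reasoning
          open Partition (partition ps u cuts)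
          m = length ps
          K : Fin n → Subset n
          K r = comprehension (λ v → ℓ r ≟L ℓ v)
          K⁺ : ∀ {r v} → ℓ r ≡ ℓ v → v ∈ K r
          K⁺ {r} = ∈-comprehension⁺ (λ v → ℓ r ≟L ℓ v)
          K⁻ : ∀ {r v} → v ∈ K r → ℓ r ≡ ℓ v
          K⁻ {r} = ∈-comprehension⁻ (λ v → ℓ r ≟L ℓ v)
          lemma₁ : ∀ n m → 2 * (n * m) + n * m ≡ m * (3 * n)
          lemma₁ = solve-∀
          lemma₂ : ∀ n m C → n * (2 * m) + 3 * (C * n) ≡ 2 * (n * m) + n * (3 * C)
          lemma₂ = solve-∀
          sizes : ∑[ r ← reps ] ∣ K r ∣ ≤ n
          sizes = begin
            ∑[ r ← reps ] ∣ K r ∣ ≡⟨ ∑-cong reps (λ r → ∣p∣≡∑ (K r)) ⟩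
            ∑[ r ← reps ] ∑[ v ← allFin n ] 𝟙 (v ∈? K r) ≤⟨ ∑-mono reps (λ r → ∑-mono (allFin n) λ v → 𝟙-mono (v ∈? K r) (ℓ r ≟L ℓ v) K⁻) ⟩
            ∑[ r ← reps ] ∑[ v ← allFin n ] 𝟙 (ℓ r ≟L ℓ v) ≡⟨ ∑-swap reps (allFin n) (λ r v → 𝟙 (ℓ r ≟L ℓ v)) ⟩
            ∑[ v ← allFin n ] ∑[ r ← reps ] 𝟙 (ℓ r ≟L ℓ v) ≤⟨ ∑-mono (allFin n) (λ v → distinct-sum _≟L_ ℓ distinct (ℓ v)) ⟩
            ∑[ v ← allFin n ] 1 ≡⟨ ∑-ones n ⟩
            n ∎
          weight : Fin n → Fin n → ℕ
          weight s t = 𝟙 (isEdge? a x s t) + ∑[ (b , y) ← ps ] 𝟙 (isEdge? b y s t)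
          cutEdge-weight : ∀ {s t} → IsCutEdge ps s t → 1 ≤ weight s t
          cutEdge-weight {s} {t} (inj₁ e) = ≤-trans (1≤𝟙 (isEdge? a x s t) e) (m≤m+n _ _)
          cutEdge-weight {s} {t} (inj₂ e) with (b , y) , p∈ , e′ ← find e = ≤-trans
            (≤-trans (1≤𝟙 (isEdge? b y s t) e′) (∑-∈ (λ (b , y) → 𝟙 (isEdge? b y s t)) p∈)) (m≤n+m _ _)
          cut-edge-total : ∀ {b y} → Adj G b y → ∑²[ s , t ] 𝟙 (isEdge? b y s t) ≡ 2
          cut-edge-total {b} {y} by = edge-total {s = b} {y} λ { refl → proj₂ simple b by }
          total-weight : ∑² weight ≤ 2 * suc m
          total-weight = begin
            ∑² weight
              ≡⟨ ∑²-+ (λ s t → 𝟙 (isEdge? a x s t)) (λ s t → ∑[ (b , y) ← ps ] 𝟙 (isEdge? b y s t)) ⟩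
            (∑²[ s , t ] 𝟙 (isEdge? a x s t)) + (∑²[ s , t ] ∑[ (b , y) ← ps ] 𝟙 (isEdge? b y s t))
              ≡⟨ cong₂ _+_ (cut-edge-total ax) (trans
                   (∑-cong (allFin n) λ s → ∑-swap (allFin n) ps (λ t (b , y) → 𝟙 (isEdge? b y s t)))
                   (∑-swap (allFin n) ps (λ s (b , y) → ∑[ t ← allFin n ] 𝟙 (isEdge? b y s t)))) ⟩
            2 + (∑[ (b , y) ← ps ] ∑²[ s , t ] 𝟙 (isEdge? b y s t))
              ≤⟨ +-monoʳ-≤ 2 (∑-mono-∈ ps λ p∈ → ≤-reflexive (cut-edge-total (proj₂ (proj₁ (proj₂ (All.lookup cuts p∈)))))) ⟩
            2 + (∑[ _ ← ps ] 2)
              ≡⟨ cong (2 +_) (∑-const ps 2) ⟩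
            2 + m * 2
              ≡⟨ *-comm (suc m) 2 ⟩
            2 * suc m ∎
          boundaries : ∑[ r ← reps ] boundary G (K r) ≤ 2 * suc m
          boundaries = begin
            ∑[ r ← reps ] boundary G (K r)
              ≤⟨ (∑-mono reps λ r → ∑²-mono λ s t → 𝟙-≤ (crossing? G (K r) s t) λ ((s∈ , t∉) , st) →
                    *-mono-≤ (1≤𝟙 (ℓ r ≟L ℓ s) (K⁻ s∈))
                             (cutEdge-weight (joins st λ eq → t∉ (K⁺ (trans (K⁻ s∈) eq))))) ⟩
            ∑[ r ← reps ] ∑²[ s , t ] (𝟙 (ℓ r ≟L ℓ s) * weight s t)
              ≡⟨ (∑-cong reps λ r → ∑-cong (allFin n) λ s → ∑-*ˡ (allFin n) (𝟙 (ℓ r ≟L ℓ s)) (weight s)) ⟩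
            ∑[ r ← reps ] ∑[ s ← allFin n ] (𝟙 (ℓ r ≟L ℓ s) * ∑ (allFin n) (weight s))
              ≡⟨ ∑-swap reps (allFin n) (λ r s → 𝟙 (ℓ r ≟L ℓ s) * ∑ (allFin n) (weight s)) ⟩
            ∑[ s ← allFin n ] ∑[ r ← reps ] (𝟙 (ℓ r ≟L ℓ s) * ∑ (allFin n) (weight s))
              ≡⟨ (∑-cong (allFin n) λ s → ∑-*ʳ reps (∑ (allFin n) (weight s)) (λ r → 𝟙 (ℓ r ≟L ℓ s))) ⟩
            ∑[ s ← allFin n ] ((∑[ r ← reps ] 𝟙 (ℓ r ≟L ℓ s)) * ∑ (allFin n) (weight s))
              ≤⟨ (∑-mono (allFin n) λ s → *-monoˡ-≤ (∑ (allFin n) (weight s)) (distinct-sum _≟L_ ℓ distinct (ℓ s))) ⟩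
            ∑[ s ← allFin n ] (1 * ∑ (allFin n) (weight s))
              ≡⟨ (∑-cong (allFin n) λ s → *-identityˡ (∑ (allFin n) (weight s))) ⟩
            ∑²[ s , t ] weight s t
              ≤⟨ total-weight ⟩
            2 * suc m ∎

  module _ {n : ℕ} where

    Disconnected : Graph n → Set
    Disconnected G = ∃[ V ] ((∃[ u ] u ∈ V) × (∃[ w ] w ∉ V)) × (∀ s t → ¬ Crossing G V s t)

    disconnected? : Decidable Disconnected
    disconnected? G = anySubset? λ V →
      ((FinP.any? λ u → u ∈? V) ×-dec (FinP.any? λ w → ¬? (w ∈? V))) ×-dec (FinP.all? λ s → FinP.all? λ t → ¬? (crossing? G V s t))

    -- Splitting by b < y and y < b makes each half an oriented family, to which `cuts-bound`
    -- applies with 3 C.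
    twoCut-count : ∀ {G : Graph n} → IsSimple G → ∀ {C} → (∀ K → 1 ≤ ∣ K ∣ → 3 * n ≤ n * boundary G K + 3 * (C * ∣ K ∣)) →
      ∀ {a x} → Adj G a x → ∑²[ b , y ] 𝟙 (twoCut? G a x b y) ≤ 6 * C
    twoCut-count {G = G} simple {C} expansion {a} {x} ax = begin
      ∑²[ b , y ] 𝟙 (twoCut? G a x b y)
        ≡⟨ ∑-cartesianProduct (allFin n) (allFin n) (λ (b , y) → 𝟙 (twoCut? G a x b y)) ⟨
      ∑[ (b , y) ← pairs ] 𝟙 (twoCut? G a x b y)
        ≤⟨ ∑-mono pairs (λ (b , y) → either b y) ⟩
      ∑[ (b , y) ← pairs ] (𝟙 (b Fin.<? y ×-dec twoCut? G a x b y) + 𝟙 (y Fin.<? b ×-dec twoCut? G a x b y))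
        ≡⟨ ∑-+ pairs (λ (b , y) → 𝟙 (b Fin.<? y ×-dec twoCut? G a x b y)) (λ (b , y) → 𝟙 (y Fin.<? b ×-dec twoCut? G a x b y)) ⟩
      (∑[ (b , y) ← pairs ] 𝟙 (b Fin.<? y ×-dec twoCut? G a x b y)) + (∑[ (b , y) ← pairs ] 𝟙 (y Fin.<? b ×-dec twoCut? G a x b y))
        ≤⟨ +-mono-≤ (half (λ b y → b Fin.< y) Fin._<?_ λ p q → FinP.<-asym p q) (half (λ b y → y Fin.< b) (λ b y → y Fin.<? b) λ p q → FinP.<-asym p q) ⟩
      3 * C + 3 * C
        ≡⟨ *-distribʳ-+ C 3 3 ⟨
      6 * C ∎
      where
      open ≤-Reasoning
      pairs = List.cartesianProduct (allFin n) (allFin n)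
      either : ∀ b y → 𝟙 (twoCut? G a x b y) ≤ 𝟙 (b Fin.<? y ×-dec twoCut? G a x b y) + 𝟙 (y Fin.<? b ×-dec twoCut? G a x b y)
      either b y = 𝟙-≤ (twoCut? G a x b y) cases
        where
        cases : TwoCut G a x b y → 1 ≤ 𝟙 (b Fin.<? y ×-dec twoCut? G a x b y) + 𝟙 (y Fin.<? b ×-dec twoCut? G a x b y)
        cases cut@((_ , by) , _) with FinP.<-cmp b y
        ... | tri< lt _ _ = ≤-trans (1≤𝟙 (b Fin.<? y ×-dec twoCut? G a x b y) (lt , cut)) (m≤m+n _ _)
        ... | tri> _ _ gt = ≤-trans (1≤𝟙 (y Fin.<? b ×-dec twoCut? G a x b y) (gt , cut)) (m≤n+m _ _)
        ... | tri≈ _ refl _ = contradiction by (proj₂ simple b)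
      half : (F : Fin n → Fin n → Set) (F? : ∀ b y → Dec (F b y)) → (∀ {b y} → F b y → ¬ F y b) →
             ∑[ (b , y) ← pairs ] 𝟙 (F? b y ×-dec twoCut? G a x b y) ≤ 3 * C
      half F F? asym = ≤-trans (≤-reflexive (sym (length-filter oriented? pairs)))
        (cuts-bound G simple ax F asym {C} expansion (filter oriented? pairs)
          (UniqueP.filter⁺ oriented? (UniqueP.cartesianProduct⁺ (UniqueP.allFin⁺ n) (UniqueP.allFin⁺ n))) (AllP.all-filter oriented? pairs))
        where
        oriented? : Decidable (λ ((b , y) : Fin n × Fin n) → F b y × TwoCut G a x b y)
        oriented? (b , y) = F? b y ×-dec twoCut? G a x b y

  module _ {n d q : ℕ} .{{q≢0 : NonZero q}} (3≤d : 3 ≤ d) (8≤q : 8 ≤ q) where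

    private
      R = regularGraphs n d
      C = scale d q

      Split : Graph n → Fin n → Fin n → Fin n → Fin n → Set
      Split G u v x y = (Adj G u v × Adj G x y) × ∃[ V ] ((u ∈ V × v ∈ V) × (x ∉ V × y ∉ V)) × (∀ s t → ¬ Crossing G V s t)

      split? : ∀ G u v x y → Dec (Split G u v x y)
      split? G u v x y = (adj? G u v ×-dec adj? G x y) ×-dec anySubset? λ V →
        ((u ∈? V ×-dec v ∈? V) ×-dec (¬? (x ∈? V) ×-dec ¬? (y ∈? V))) ×-dec (FinP.all? λ s → FinP.all? λ t → ¬? (crossing? G V s t))

      rejoin : ∀ {G u v x y} → G ∈ₗ R → Split G u v x y → Switchable G u v x y × TwoCut (switch G u v x y) u x v y
      rejoin {G} {u} {v} {x} {y} G∈ ((uv , xy) , V , ((u∈ , v∈) , (x∉ , y∉)) , closed) =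
        sw , (created (inj₁ (inj₁ (refl , refl))) , created (inj₂ (inj₁ (refl , refl)))) , u≢v simple sw , V ,
        ((u∈ , v∈) , (x∉ , y∉)) , cross
        where
        simple = proj₁ (∈-regularGraphs⁻ G∈)
        created : ∀ {a b} → Added u v x y a b → Adj (switch G u v x y) a b
        created = adj-switch⁺ {G = G} {u} {v} {x} {y} ∘ inj₁
        sw : Switchable G u v x y
        sw = record { uv = uv ; xy = xy ; ux = λ ux → closed u x ((u∈ , x∉) , ux) ; vy = λ vy → closed v y ((v∈ , y∉) , vy)
                    ; u≢x = λ { refl → x∉ u∈ } ; v≢y = λ { refl → y∉ v∈ } }
        cross : ∀ s t → Crossing (switch G u v x y) V s t → (u ≡ s × x ≡ t) ⊎ (v ≡ s × y ≡ t)
        cross s t ((s∈ , t∉) , st) with adj-switch⁻ {G = G} {u} {v} {x} {y} st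
        ... | inj₁ (inj₁ (inj₁ e)) = inj₁ e
        ... | inj₁ (inj₁ (inj₂ (refl , _))) = contradiction s∈ x∉
        ... | inj₁ (inj₂ (inj₁ e)) = inj₂ e
        ... | inj₁ (inj₂ (inj₂ (refl , _))) = contradiction s∈ y∉
        ... | inj₂ (st′ , _) = contradiction ((s∈ , t∉) , st′) (closed s t)

      expanding : ∀ {G} → G ∈ₗ R → ¬ HasDenseSet d q G → ∀ K → 1 ≤ ∣ K ∣ → 3 * n ≤ n * boundary G K + 3 * (C * ∣ K ∣)
      expanding {G} G∈ = let simple , reg = ∈-regularGraphs⁻ G∈ in sparse-boundary {d = d} {q} 3≤d 8≤q {G = G} simple reg

      -- A switching may lead out of the graphs without dense sets, so a bound is needed for every
      -- graph. A graph with a dense set is charged all (n d)² pairs of ordered edges, which is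
      -- affordable as only a fraction O(1 / n) of the graphs is of this kind.
      twoCuts : ∀ {G} → G ∈ₗ R → ∑⁴ (λ u v x y → 𝟙 (twoCut? G u x v y)) ≤ 𝟙 (hasDenseSet? d q G) * (n * d * (n * d)) + n * d * (6 * C)
      twoCuts {G} G∈ with simple , reg ← ∈-regularGraphs⁻ G∈ = begin
        ∑⁴ (λ u v x y → 𝟙 (twoCut? G u x v y))
          ≡⟨ (∑-cong (allFin n) λ u → ∑-swap (allFin n) (allFin n) (λ v x → ∑[ y ← allFin n ] 𝟙 (twoCut? G u x v y))) ⟩
        ∑⁴ (λ u x v y → 𝟙 (twoCut? G u x v y))
          ≤⟨ by-cases (hasDenseSet? d q G) ⟩
        𝟙 (hasDenseSet? d q G) * (n * d * (n * d)) + n * d * (6 * C) ∎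
        where
        open ≤-Reasoning
        by-cases : (D? : Dec (HasDenseSet d q G)) → ∑⁴ (λ u x v y → 𝟙 (twoCut? G u x v y)) ≤ 𝟙 D? * (n * d * (n * d)) + n * d * (6 * C)
        by-cases (yes _) = begin
          ∑⁴ (λ u x v y → 𝟙 (twoCut? G u x v y))
            ≤⟨ ∑⁴-mono (λ u x v y → ≤-trans (𝟙-mono (twoCut? G u x v y) (adj? G u x ×-dec adj? G v y) proj₁) (≤-reflexive (𝟙-× (adj? G u x) (adj? G v y)))) ⟩
          ∑⁴ (λ u x v y → 𝟙 (adj? G u x) * 𝟙 (adj? G v y))
            ≡⟨ ∑²-cong (λ u x → trans (∑²-*ˡ (𝟙 (adj? G u x)) (λ v y → 𝟙 (adj? G v y))) (cong (𝟙 (adj? G u x) *_) (total-degree {G = G} reg))) ⟩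
          ∑²[ u , x ] (𝟙 (adj? G u x) * (n * d))
            ≡⟨ trans (∑²-*ʳ (n * d) (λ u x → 𝟙 (adj? G u x))) (cong (_* (n * d)) (total-degree {G = G} reg)) ⟩
          n * d * (n * d)
            ≡⟨ *-identityˡ _ ⟨
          1 * (n * d * (n * d))
            ≤⟨ m≤m+n _ _ ⟩
          1 * (n * d * (n * d)) + n * d * (6 * C) ∎
        by-cases (no sparse) = begin
          ∑⁴ (λ u x v y → 𝟙 (twoCut? G u x v y))
            ≤⟨ (∑²-mono λ u x → per-edge u x (adj? G u x)) ⟩
          ∑²[ u , x ] (𝟙 (adj? G u x) * (6 * C))
            ≡⟨ trans (∑²-*ʳ (6 * C) (λ u x → 𝟙 (adj? G u x))) (cong (_* (6 * C)) (total-degree {G = G} reg)) ⟩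
          n * d * (6 * C) ∎
          where
          per-edge : ∀ u x (A? : Dec (Adj G u x)) → ∑²[ v , y ] 𝟙 (twoCut? G u x v y) ≤ 𝟙 A? * (6 * C)
          per-edge u x (yes ux) = ≤-trans (twoCut-count {G = G} simple {C} (expanding G∈ sparse) ux) (≤-reflexive (sym (*-identityˡ (6 * C))))
          per-edge u x (no ¬ux) = ≤-reflexive (∑²-zero λ v y → 𝟙-no (twoCut? G u x v y) (¬ux ∘ proj₁ ∘ proj₁))

      -- A side without boundary edges has at least n / C vertices by `expanding`, and so has its
      -- complement. Hence the ordered edges uv on one side and xy on the other give at least (n d)²
      -- / C² pairs.
      splits : ∀ {G} → G ∈ₗ R → 𝟙 (disconnected? G ×-dec ¬? (hasDenseSet? d q G)) * (n * d * (n * d)) ≤ C * C * ∑⁴ (λ u v x y → 𝟙 (split? G u v x y))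
      splits {G} G∈ with simple , reg ← ∈-regularGraphs⁻ G∈ = by-cases (disconnected? G ×-dec ¬? (hasDenseSet? d q G))
        where
        open ≤-Reasoning
        by-cases : (D? : Dec (Disconnected G × ¬ HasDenseSet d q G)) → 𝟙 D? * (n * d * (n * d)) ≤ C * C * ∑⁴ (λ u v x y → 𝟙 (split? G u v x y))
        by-cases (no _) = z≤n
        by-cases (yes ((V , ((u₀ , u₀∈) , (w₀ , w₀∉)) , closed) , sparse)) = begin
          1 * (n * d * (n * d))
            ≡⟨ *-identityˡ _ ⟩
          n * d * (n * d)
            ≤⟨ *-mono-≤ (*-monoˡ-≤ d (linear V u₀ u₀∈ closed)) (*-monoˡ-≤ d (linear V′ w₀ (out⁺ w₀∉) closed′)) ⟩
          C * ∣ V ∣ * d * (C * ∣ V′ ∣ * d)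
            ≡⟨ lemma C (∣ V ∣) d (∣ V′ ∣) ⟩
          C * C * ((∣ V ∣ * d) * (∣ V′ ∣ * d))
            ≡⟨ cong (C * C *_) (cong₂ _*_ (sym (pair-count V)) (sym (pair-count V′))) ⟩
          C * C * (∑² α * ∑² β)
            ≡⟨ cong (C * C *_) (trans (sym (∑²-*ʳ (∑² β) α)) (∑²-cong λ u v → sym (∑²-*ˡ (α u v) β))) ⟩
          C * C * ∑⁴ (λ u v x y → α u v * β x y)
            ≤⟨ *-monoʳ-≤ (C * C) (∑⁴-mono pointwise) ⟩
          C * C * ∑⁴ (λ u v x y → 𝟙 (split? G u v x y)) ∎
          where
          V′ = comprehension (λ v → ¬? (v ∈? V))
          α β : Fin n → Fin n → ℕ
          α u v = 𝟙 (u ∈? V) * 𝟙 (adj? G u v)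
          β x y = 𝟙 (x ∈? V′) * 𝟙 (adj? G x y)
          out⁺ : ∀ {v} → v ∉ V → v ∈ V′
          out⁺ = ∈-comprehension⁺ (λ v → ¬? (v ∈? V))
          out⁻ : ∀ {v} → v ∈ V′ → v ∉ V
          out⁻ = ∈-comprehension⁻ (λ v → ¬? (v ∈? V))
          closed′ : ∀ s t → ¬ Crossing G V′ s t
          closed′ s t ((s∈ , t∉) , st) with t ∈? V
          ... | yes t∈ = closed t s ((t∈ , out⁻ s∈) , proj₁ simple s t st)
          ... | no t∉V = t∉ (out⁺ t∉V)
          linear : ∀ K k → k ∈ K → (∀ s t → ¬ Crossing G K s t) → n ≤ C * ∣ K ∣
          linear K k k∈ closed = *-cancelˡ-≤ 3 (≤-trans (expanding G∈ sparse K (x∈p⇒1≤∣p∣ k∈))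
            (≤-reflexive (cong (_+ 3 * (C * ∣ K ∣)) (trans (cong (n *_) no-boundary) (*-zeroʳ n)))))
            where
            no-boundary : boundary G K ≡ 0
            no-boundary = ∑²-zero λ s t → 𝟙-no (crossing? G K s t) (closed s t)
          pair-count : ∀ K → ∑²[ u , v ] (𝟙 (u ∈? K) * 𝟙 (adj? G u v)) ≡ ∣ K ∣ * d
          pair-count K = trans (degree-sumˡ {G = G} reg (λ u → 𝟙 (u ∈? K))) (cong (_* d) (sym (∣p∣≡∑ K)))
          lemma : ∀ C a d b → C * a * d * (C * b * d) ≡ C * C * ((a * d) * (b * d))
          lemma = solve-∀
          pointwise : ∀ u v x y → 𝟙 (u ∈? V) * 𝟙 (adj? G u v) * (𝟙 (x ∈? V′) * 𝟙 (adj? G x y)) ≤ 𝟙 (split? G u v x y)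
          pointwise u v x y = ≤-trans
            (≤-reflexive (sym (trans (𝟙-× (u ∈? V ×-dec adj? G u v) (x ∈? V′ ×-dec adj? G x y)) (cong₂ _*_ (𝟙-× (u ∈? V) (adj? G u v)) (𝟙-× (x ∈? V′) (adj? G x y))))))
            (𝟙-mono ((u ∈? V ×-dec adj? G u v) ×-dec (x ∈? V′ ×-dec adj? G x y)) (split? G u v x y) λ ((u∈ , uv) , (x∈′ , xy)) →
              (uv , xy) , V , ((u∈ , stays V closed u∈ uv) , (out⁻ x∈′ , out⁻ (stays V′ closed′ x∈′ xy))) , closed)
            where
            stays : ∀ K → (∀ s t → ¬ Crossing G K s t) → ∀ {s t} → s ∈ K → Adj G s t → t ∈ K
            stays K closed {s} {t} s∈ st with t ∈? K
            ... | yes t∈ = t∈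
            ... | no t∉  = contradiction ((s∈ , t∉) , st) (closed s t)

    -- Switching an edge of one side of a disconnected graph with an edge of the other side creates a two-edge cut,
    -- of which a graph without dense sets has only O(n), while there are Ω(n²) such switchings.
    disconnected-count : 4 * (2 * d + 1) ≤ n →
      n * (∑[ G ← R ] 𝟙 (disconnected? G ×-dec ¬? (hasDenseSet? d q G))) ≤ 8 * (C * C * C) * length R
    disconnected-count big = *-cancelˡ-≤ N {{N≢0}} (begin
      N * (n * X)
        ≡⟨ lemma₁ N n X ⟩
      n * (X * N)
        ≡⟨ cong (n *_) (∑-*ʳ R N (λ G → 𝟙 (disconnected? G ×-dec ¬? (hasDenseSet? d q G)))) ⟨
      n * (∑[ G ← R ] (𝟙 (disconnected? G ×-dec ¬? (hasDenseSet? d q G)) * N))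
        ≤⟨ *-monoʳ-≤ n (∑-mono-∈ R splits) ⟩
      n * (∑[ G ← R ] (C * C * ∑⁴ (λ u v x y → 𝟙 (split? G u v x y))))
        ≡⟨ cong (n *_) (∑-*ˡ R (C * C) (λ G → ∑⁴ (λ u v x y → 𝟙 (split? G u v x y)))) ⟩
      n * (C * C * (∑[ G ← R ] ∑⁴ (λ u v x y → 𝟙 (split? G u v x y))))
        ≤⟨ *-monoʳ-≤ n (*-monoʳ-≤ (C * C) (switching split? (λ G u v x y → twoCut? G u x v y) rejoin)) ⟩
      n * (C * C * (∑[ G ← R ] ∑⁴ (λ u v x y → 𝟙 (twoCut? G u x v y))))
        ≤⟨ *-monoʳ-≤ n (*-monoʳ-≤ (C * C) (∑-mono-∈ R twoCuts)) ⟩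
      n * (C * C * (∑[ G ← R ] (𝟙 (hasDenseSet? d q G) * N + n * d * (6 * C))))
        ≡⟨ cong (λ z → n * (C * C * z)) (trans (∑-+ R (λ G → 𝟙 (hasDenseSet? d q G) * N) (λ _ → n * d * (6 * C)))
             (cong₂ _+_ (∑-*ʳ R N (λ G → 𝟙 (hasDenseSet? d q G))) (∑-const R (n * d * (6 * C))))) ⟩
      n * (C * C * (D * N + length R * (n * d * (6 * C))))
        ≡⟨ lemma₂ n (C * C) D N (length R) d C ⟩
      C * C * (n * D * N + 6 * C * length R * (n * (n * d)))
        ≤⟨ *-monoʳ-≤ (C * C) (+-mono-≤ (*-monoˡ-≤ N (hasDenseSet-count d q 2≤d 2≤q big)) (*-monoʳ-≤ (6 * C * length R) (*-monoˡ-≤ (n * d) (m≤m*n n d)))) ⟩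
      -- The two terms, with 2 + 6 = 8, are the trivial charge for graphs with dense sets and the
      -- linear bound on two-edge cuts.
      C * C * (2 * (C * length R) * N + 6 * C * length R * N)
        ≡⟨ lemma₃ C (length R) N ⟩
      N * (8 * (C * C * C) * length R) ∎)
      where
      open ≤-Reasoning
      2≤d : 2 ≤ d
      2≤d = ≤-trans (n≤1+n 2) 3≤d
      2≤q : 2 ≤ q
      2≤q = ≤-trans (s≤s (s≤s z≤n)) 8≤q
      instance
        d≢0 : NonZero d
        d≢0 = >-nonZero (≤-trans (s≤s z≤n) 3≤d)
        n≢0 : NonZero n
        n≢0 = >-nonZero (≤-trans (≤-trans (m≤n+m 1 (2 * d)) (m≤n*m _ 4)) big)
      N = n * d * (n * d)
      X = ∑[ G ← R ] 𝟙 (disconnected? G ×-dec ¬? (hasDenseSet? d q G))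
      D = ∑[ G ← R ] 𝟙 (hasDenseSet? d q G)
      N≢0 : NonZero N
      N≢0 = m*n≢0 (n * d) (n * d) {{m*n≢0 n d}} {{m*n≢0 n d}}
      lemma₁ : ∀ N n X → N * (n * X) ≡ n * (X * N)
      lemma₁ = solve-∀
      lemma₂ : ∀ n c D N R d C → n * (c * (D * N + R * (n * d * (6 * C)))) ≡ c * (n * D * N + 6 * C * R * (n * (n * d)))
      lemma₂ = solve-∀
      lemma₃ : ∀ C R N → C * C * (2 * (C * R) * N + 6 * C * R * N) ≡ N * (8 * (C * C * C) * R)
      lemma₃ = solve-∀

  -- Spanning forests

  module _ {n : ℕ} {_~_ : Fin n → Fin n → Set} where

    path-refl : ∀ u → Path _~_ u u
    path-refl u = u ∷ [] , [] ∷ [] , [-] , refl , refl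

    -- A path may not repeat a vertex: if u already occurs on the path from v, the suffix starting
    -- at u is taken instead.
    path-cons : ∀ {u v w} → u ~ v → Path _~_ v w → Path _~_ u w
    path-cons {u} {v} {w} u~v (v ∷ xs , unique , linked , refl , last) with Any.any? (u Fin.≟_) (v ∷ xs)
    ... | no u∉  = u ∷ v ∷ xs , AllP.¬Any⇒All¬ (v ∷ xs) u∉ ∷ unique , u~v ∷ linked , refl , last
    ... | yes u∈ = suffix (v ∷ xs) unique linked last u∈
      where
      suffix : ∀ ys → Unique ys → Linked _~_ ys → List.last ys ≡ just w → u ∈ₗ ys → Path _~_ u w
      suffix (y ∷ ys) un li la (here refl) = y ∷ ys , un , li , refl , la
      suffix (y ∷ z ∷ ys) (_ ∷ un) (_ ∷ li) la (there u∈) = suffix (z ∷ ys) un li la u∈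

    path-trans : ∀ {u v w} → Path _~_ u v → Path _~_ v w → Path _~_ u w
    path-trans {v = v} {w} (xs , _ , linked , head , last) q = go xs linked head last
      where
      go : ∀ {u} xs → Linked _~_ xs → List.head xs ≡ just u → List.last xs ≡ just v → Path _~_ u w
      go (x ∷ [])     _         refl refl = q
      go (x ∷ y ∷ xs) (xy ∷ li) refl la   = path-cons xy (go (y ∷ xs) li refl la)

  path-map : ∀ {n} {_~_ _≈_ : Fin n → Fin n → Set} → (∀ {u v} → u ~ v → u ≈ v) → ∀ {u v} → Path _~_ u v → Path _≈_ u v
  path-map f (xs , unique , linked , ends) = xs , unique , Linked.map f linked , ends

  module _ {A : Set} where

    ¬unique-repeat : ∀ (as : List A) {z} bs {cs} → ¬ Unique (as ++ z ∷ bs ++ z ∷ cs)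
    ¬unique-repeat []       bs (z∉ ∷ _) = All.lookup z∉ (∈P.∈-++⁺ʳ bs (here refl)) refl
    ¬unique-repeat (_ ∷ as) bs (_ ∷ u)  = ¬unique-repeat as bs u

    unique-∷ʳ : ∀ {x : A} {xs} → Unique (x ∷ xs) → Unique (xs List.∷ʳ x)
    unique-∷ʳ (x∉ ∷ u) = UniqueP.++⁺ u ([] ∷ []) λ { (x∈ , here refl) → All.lookup x∉ x∈ refl }

    -- Dropping either the first or the last entry of the closed listing leaves a repetition-free
    -- list, so the only two equal entries are its ends.
    closed-walk-repeat : ∀ {x : A} {xs} → Unique (x ∷ xs) → ∀ as {z} bs cs → x ∷ xs List.∷ʳ x ≡ as ++ z ∷ bs ++ z ∷ cs → as ≡ [] × cs ≡ []
    closed-walk-repeat u (a ∷ as) bs cs eq = contradiction (subst Unique (ListP.∷-injectiveʳ eq) (unique-∷ʳ u)) (¬unique-repeat as bs)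
    closed-walk-repeat {x} {xs} u [] {z} bs cs eq with List.initLast cs
    ... | []       = refl , refl
    ... | cs′ List.∷ʳ′ c = contradiction (subst Unique (ListP.∷ʳ-injectiveˡ (x ∷ xs) _ (trans eq (cong (z ∷_) (sym (ListP.++-assoc bs (z ∷ cs′) (c ∷ [])))))) u) (¬unique-repeat [] bs)

  module _ {n : ℕ} (G : Graph n) where

    tail head : Fin (∣E∣ G) → Fin n
    tail e = proj₁ (endpoints G e)
    head e = proj₂ (endpoints G e)

    Labelling : Set
    Labelling = Fin n → Fin n

    -- A union-find certificate: `joined` and `path` make equality of labels the same as connection
    -- in T, so that testing whether an edge closes a cycle is a comparison of labels.
    record Forest (T : EdgeSet G) (ℓ : Labelling) : Set where
      field
        joined  : ∀ {u v} → Joins G T u v → ℓ u ≡ ℓ v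
        path    : ∀ u v → ℓ u ≡ ℓ v → Path (Joins G T) u v
        acyclic : Acyclic (Joins G T)

    Joins-sym : ∀ {T u v} → Joins G T u v → Joins G T v u
    Joins-sym (e , e∈ , inj₁ eq) = e , e∈ , inj₂ eq
    Joins-sym (e , e∈ , inj₂ eq) = e , e∈ , inj₁ eq

    Joins-⊆ : ∀ {T T′} → T ⊆ T′ → ∀ {u v} → Joins G T u v → Joins G T′ u v
    Joins-⊆ sub (e , e∈ , eq) = e , sub e∈ , eq

    empty-forest : Forest ⊥ₛ id
    empty-forest = record { joined = λ (_ , e∈ , _) → contradiction e∈ ∉⊥ ; path = λ { u _ refl → path-refl u } ; acyclic = no-cycle }
      where
      no-cycle : Acyclic (Joins G ⊥ₛ)
      no-cycle (x ∷ y ∷ xs , _ , _ , (_ , e∈ , _) ∷ _) = contradiction e∈ ∉⊥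
      no-cycle (x ∷ []     , _ , s≤s () , _)

    module _ {T : EdgeSet G} {ℓ : Labelling} (forest : Forest T ℓ) (e : Fin (∣E∣ G)) (bridge : ℓ (tail e) ≢ ℓ (head e)) where
      open Forest forest

      private
        a = tail e
        b = head e
        T′ = T ∪ ⁅ e ⁆

      relabel : Labelling
      relabel w with ℓ w Fin.≟ ℓ a
      ... | yes _ = ℓ b
      ... | no _  = ℓ w

      private
        relabel-yes : ∀ {w} → ℓ w ≡ ℓ a → relabel w ≡ ℓ b
        relabel-yes {w} eq with ℓ w Fin.≟ ℓ a
        ... | yes _ = refl
        ... | no ne = contradiction eq ne

        relabel-no : ∀ {w} → ℓ w ≢ ℓ a → relabel w ≡ ℓ w
        relabel-no {w} ne with ℓ w Fin.≟ ℓ a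
        ... | yes eq = contradiction eq ne
        ... | no _   = refl

      relabel-cong : ∀ {u v} → ℓ u ≡ ℓ v → relabel u ≡ relabel v
      relabel-cong {u} {v} eq with ℓ u Fin.≟ ℓ a | ℓ v Fin.≟ ℓ a
      ... | yes _ | yes _ = refl
      ... | yes p | no ¬q = contradiction (trans (sym eq) p) ¬q
      ... | no ¬p | yes q = contradiction (trans eq q) ¬p
      ... | no _  | no _  = eq

      relabel-edge : relabel a ≡ relabel b
      relabel-edge = trans (relabel-yes refl) (sym (relabel-no (bridge ∘ sym)))

      private
        split : ∀ {u v} → Joins G T′ u v → Joins G T u v ⊎ IsEdge a b u v
        split (e′ , e′∈ , eq) with x∈p∪q⁻ T ⁅ e ⁆ e′∈
        ... | inj₁ old = inj₁ (e′ , old , eq)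
        ... | inj₂ new with refl ← x∈⁅y⁆⇒x≡y e new with eq
        ...   | inj₁ refl = inj₂ (inj₁ (refl , refl))
        ...   | inj₂ refl = inj₂ (inj₂ (refl , refl))

        old-joins : ∀ {u v} → Joins G T u v → Joins G T′ u v
        old-joins = Joins-⊆ (p⊆p∪q ⁅ e ⁆)

        new-joins : Joins G T′ a b
        new-joins = e , x∈p∪q⁺ (inj₂ (x∈⁅x⁆ e)) , inj₁ refl

        joined′ : ∀ {u v} → Joins G T′ u v → relabel u ≡ relabel v
        joined′ j with split j
        ... | inj₁ old = relabel-cong (joined old)
        ... | inj₂ (inj₁ (refl , refl)) = relabel-edge
        ... | inj₂ (inj₂ (refl , refl)) = sym relabel-edge

        path′ : ∀ u v → relabel u ≡ relabel v → Path (Joins G T′) u v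
        path′ u v eq with ℓ u Fin.≟ ℓ a | ℓ v Fin.≟ ℓ a
        ... | yes p | yes q = path-map old-joins (path u v (trans p (sym q)))
        ... | yes p | no _  = path-trans (path-map old-joins (path u a p)) (path-cons new-joins (path-map old-joins (path b v eq)))
        ... | no _  | yes q = path-trans (path-map old-joins (path u b eq)) (path-cons (Joins-sym new-joins) (path-map old-joins (path a v (sym q))))
        ... | no _  | no _  = path-map old-joins (path u v eq)

        FirstBridge : List (Fin n) → Set
        FirstBridge ws = ∃[ p ] ∃[ s ] ∃[ t ] ∃[ q ] ws ≡ p ++ s ∷ t ∷ q × IsEdge a b s t × Linked (Joins G T) (p ++ s ∷ []) × Linked (Joins G T′) (t ∷ q)

        first-bridge : ∀ ws → Linked (Joins G T′) ws → Linked (Joins G T) ws ⊎ FirstBridge ws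
        first-bridge []           _ = inj₁ []
        first-bridge (_ ∷ [])     _ = inj₁ [-]
        first-bridge (w ∷ z ∷ ws) (wz ∷ li) with split wz
        ... | inj₂ ab = inj₂ ([] , w , z , ws , refl , ab , [-] , li)
        ... | inj₁ old with first-bridge (z ∷ ws) li
        ...   | inj₁ all = inj₁ (old ∷ all)
        ...   | inj₂ ([]    , s , t , q , refl , ab , li₁ , li₂) = inj₂ (w ∷ []     , s , t , q , refl , ab , old ∷ li₁ , li₂)
        ...   | inj₂ (_ ∷ p , s , t , q , refl , ab , li₁ , li₂) = inj₂ (w ∷ z ∷ p , s , t , q , refl , ab , old ∷ li₁ , li₂)

        label-walk : ∀ w ws z → Linked (Joins G T) (w ∷ ws ++ z ∷ []) → ℓ w ≡ ℓ z
        label-walk w []       z (wz ∷ _)  = joined wz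
        label-walk w (v ∷ ws) z (wv ∷ li) = trans (joined wv) (label-walk v ws z li)

        label-prefix : ∀ {w ws} p {s q} → w ∷ ws ≡ p ++ s ∷ q → Linked (Joins G T) (p ++ s ∷ []) → ℓ w ≡ ℓ s
        label-prefix []      refl _  = refl
        label-prefix (w ∷ p) refl li = label-walk w p _ li

        label-suffix : ∀ {x} as t q {xs} → x ∷ xs List.∷ʳ x ≡ as ++ t ∷ q → as ≢ [] → Linked (Joins G T) (t ∷ q) → ℓ t ≡ ℓ x
        label-suffix as t q {xs} eq as≢ li with List.initLast q
        label-suffix {x} as t .[] {xs} eq as≢ li | [] = cong ℓ (sym (ListP.∷ʳ-injectiveʳ (x ∷ xs) as eq))
        label-suffix {x} as t .(q List.∷ʳ z) {xs} eq as≢ li | q List.∷ʳ′ z =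
          trans (label-walk t q z li) (cong ℓ (sym (ListP.∷ʳ-injectiveʳ (x ∷ xs) (as ++ t ∷ q) (trans eq (sym (ListP.++-assoc as (t ∷ q) (z ∷ [])))))))

        edge-bridge : ∀ {s t} → IsEdge a b s t → ℓ s ≢ ℓ t
        edge-bridge (inj₁ (refl , refl)) = bridge
        edge-bridge (inj₂ (refl , refl)) = bridge ∘ sym

        -- A walk over the new edge can only return over it in the opposite direction.
        return : ∀ {s t s′ t′} → IsEdge a b s t → IsEdge a b s′ t′ → ℓ t ≡ ℓ s′ → s′ ≡ t × t′ ≡ s
        return (inj₁ (refl , refl)) (inj₁ (refl , refl)) eq = contradiction (sym eq) bridge
        return (inj₁ (refl , refl)) (inj₂ (refl , refl)) eq = refl , refl
        return (inj₂ (refl , refl)) (inj₁ (refl , refl)) eq = refl , refl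
        return (inj₂ (refl , refl)) (inj₂ (refl , refl)) eq = contradiction eq bridge

        -- A cycle of T′ must use the new edge, say from s to t. If it does so once, the rest leads
        -- from t back to s inside T and gives both ends one label. If it does so again, the next
        -- use goes from t to s by `return`, so s or t recurs; by `closed-walk-repeat` the closed
        -- walk is then s , t , s, too short for a cycle.
        acyclic′ : Acyclic (Joins G T′)
        acyclic′ (x ∷ xs , unique , 3≤ , linked) with first-bridge (x ∷ xs List.∷ʳ x) linked
        ... | inj₁ old = acyclic (x ∷ xs , unique , 3≤ , old)
        ... | inj₂ (p , s , t , q , eq , ab , li₁ , li₂) = second (first-bridge (t ∷ q) li₂)
          where
          ℓx≡ℓs : ℓ x ≡ ℓ s
          ℓx≡ℓs = label-prefix p eq li₁
          eq′ : x ∷ xs List.∷ʳ x ≡ (p ++ s ∷ []) ++ t ∷ q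
          eq′ = trans eq (sym (ListP.++-assoc p (s ∷ []) (t ∷ q)))
          nonempty : p ++ s ∷ [] ≢ []
          nonempty p≡ = case ListP.++-conicalʳ p (s ∷ []) p≡ of λ ()
          second : Linked (Joins G T) (t ∷ q) ⊎ FirstBridge (t ∷ q) → ⊥
          second (inj₁ li) = edge-bridge ab (trans (sym ℓx≡ℓs) (sym (label-suffix (p ++ s ∷ []) t q eq′ nonempty li)))
          second (inj₂ (p′ , s′ , t′ , q′ , eq₂ , ab′ , li₃ , _)) with refl , refl ← return ab ab′ (label-prefix p′ eq₂ li₃) with p′ | eq₂
          ... | .t ∷ p″ | refl = nonempty (proj₁ (closed-walk-repeat unique (p ++ s ∷ []) p″ (s ∷ q′) eq′))
          ... | []      | refl with closed-walk-repeat unique p (t ∷ []) q′ eq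
          ...   | p≡ , q≡ = case ≤-trans (s≤s 3≤) (≤-reflexive too-short) of λ { (s≤s (s≤s (s≤s ()))) }
            where
            too-short : suc (length (x ∷ xs)) ≡ 3
            too-short = trans (sym (trans (ListP.length-++ (x ∷ xs)) (+-comm (length (x ∷ xs)) 1)))
              (trans (cong length eq) (cong₂ (λ p q → length (p ++ s ∷ t ∷ s ∷ q)) p≡ q≡))

      extend-forest : Forest T′ relabel
      extend-forest = record { joined = joined′ ; path = path′ ; acyclic = acyclic′ }

      relabel-occupied : ∀ c → (∃[ v ] ℓ v ≡ c) → c ≢ ℓ a → ∃[ v ] relabel v ≡ c
      relabel-occupied c (v , refl) c≢ = v , relabel-no c≢

      edge-new : e ∉ T
      edge-new e∈ = bridge (joined (e , e∈ , inj₁ refl))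

    occupied? : ∀ (ℓ : Labelling) c → Dec (∃[ v ] ℓ v ≡ c)
    occupied? ℓ c = FinP.any? λ v → ℓ v Fin.≟ c

    classes : Labelling → ℕ
    classes ℓ = ∑[ c ← allFin n ] 𝟙 (occupied? ℓ c)

    -- `rank` lets P be any set containing the offered edges: every edge added raises |P ∩ T| by one
    -- and merges two classes. Started from the empty forest with its n classes, it bounds |P ∩ T′|
    -- from below by n minus the number of classes, with P a colour class in the application.
    record Extension (T : EdgeSet G) (ℓ : Labelling) (es : List (Fin (∣E∣ G))) : Set where
      field
        T′     : EdgeSet G
        ℓ′     : Labelling
        forest : Forest T′ ℓ′
        grows  : T ⊆ T′
        coarse : ∀ {u v} → ℓ u ≡ ℓ v → ℓ′ u ≡ ℓ′ v
        spans  : All (λ e → ℓ′ (tail e) ≡ ℓ′ (head e)) es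
        rank   : ∀ P → All (_∈ P) es → ∣ P ∩ T ∣ + classes ℓ ≤ ∣ P ∩ T′ ∣ + classes ℓ′

    kruskal : ∀ {T ℓ} → Forest T ℓ → ∀ es → Extension T ℓ es
    kruskal {T} {ℓ} forest [] = record
      { T′ = T ; ℓ′ = ℓ ; forest = forest ; grows = id ; coarse = id ; spans = [] ; rank = λ _ _ → ≤-refl }
    kruskal {T} {ℓ} forest (e ∷ es) with ℓ (tail e) Fin.≟ ℓ (head e)
    ... | yes same = record
      { T′ = T′ ; ℓ′ = ℓ′ ; forest = forest′ ; grows = grows ; coarse = coarse ; spans = coarse same ∷ spans ; rank = λ { P (_ ∷ es⊆P) → rank P es⊆P } }
      where open Extension (kruskal forest es) renaming (forest to forest′)
    ... | no bridge = record
      { T′ = T′ ; ℓ′ = ℓ′ ; forest = forest′ ; grows = grows ∘ p⊆p∪q ⁅ e ⁆ ; coarse = coarse ∘ relabel-cong forest e bridge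
      ; spans = coarse (relabel-edge forest e bridge) ∷ spans ; rank = rank′ }
      where
      open Extension (kruskal (extend-forest forest e bridge) es) renaming (forest to forest′)
      ℓ₁ = relabel forest e bridge
      -- Merging renames the class of the tail after that of the head, so the label of the tail is
      -- the only one that can become vacant.
      lose-one : classes ℓ ≤ suc (classes ℓ₁)
      lose-one = begin
        classes ℓ
          ≤⟨ ∑-mono (allFin n) (λ c → 𝟙-≤ (occupied? ℓ c) (λ occ → kept c occ (ℓ (tail e) Fin.≟ c))) ⟩
        ∑[ c ← allFin n ] (𝟙 (ℓ (tail e) Fin.≟ c) + 𝟙 (occupied? ℓ₁ c))
          ≡⟨ ∑-+ (allFin n) (λ c → 𝟙 (ℓ (tail e) Fin.≟ c)) (λ c → 𝟙 (occupied? ℓ₁ c)) ⟩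
        (∑[ c ← allFin n ] 𝟙 (ℓ (tail e) Fin.≟ c)) + classes ℓ₁
          ≡⟨ cong (_+ classes ℓ₁) (∑-point₁ (ℓ (tail e))) ⟩
        suc (classes ℓ₁) ∎
        where
        open ≤-Reasoning
        kept : ∀ c → (∃[ v ] ℓ v ≡ c) → (eq? : Dec (ℓ (tail e) ≡ c)) → 1 ≤ 𝟙 eq? + 𝟙 (occupied? ℓ₁ c)
        kept c occ (yes _) = s≤s z≤n
        kept c occ (no ne) = 1≤𝟙 (occupied? ℓ₁ c) (relabel-occupied forest e bridge c occ (ne ∘ sym))
      rank′ : ∀ P → All (_∈ P) (e ∷ es) → ∣ P ∩ T ∣ + classes ℓ ≤ ∣ P ∩ T′ ∣ + classes ℓ′
      rank′ P (e∈P ∷ es⊆P) = begin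
        ∣ P ∩ T ∣ + classes ℓ ≤⟨ +-monoʳ-≤ ∣ P ∩ T ∣ lose-one ⟩
        ∣ P ∩ T ∣ + suc (classes ℓ₁) ≡⟨ +-suc ∣ P ∩ T ∣ (classes ℓ₁) ⟩
        suc ∣ P ∩ T ∣ + classes ℓ₁ ≤⟨ +-monoˡ-≤ (classes ℓ₁) (p⊂q⇒∣p∣<∣q∣ gain) ⟩
        ∣ P ∩ (T ∪ ⁅ e ⁆) ∣ + classes ℓ₁ ≤⟨ rank P es⊆P ⟩
        ∣ P ∩ T′ ∣ + classes ℓ′ ∎
        where
        open ≤-Reasoning
        gain : P ∩ T ⊂ P ∩ (T ∪ ⁅ e ⁆)
        gain = (λ x∈ → let x∈P , x∈T = x∈p∩q⁻ P T x∈ in x∈p∩q⁺ (x∈P , x∈p∪q⁺ (inj₁ x∈T))) ,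
               e , x∈p∩q⁺ (e∈P , x∈p∪q⁺ (inj₂ (x∈⁅x⁆ e))) , λ e∈ → edge-new forest e bridge (proj₂ (x∈p∩q⁻ P T e∈))

  -- Spanning trees with many edges of one colour

  ∑-lookup : ∀ {A : Set} (xs : List A) f → ∑[ i ← allFin (length xs) ] f (List.lookup xs i) ≡ ∑ xs f
  ∑-lookup xs f = trans (sym (∑-map (List.lookup xs) (allFin (length xs)) f))
    (cong (λ ys → ∑ ys f) (trans (ListP.map-tabulate id (List.lookup xs)) (ListP.tabulate-lookup xs)))

  module _ {n : ℕ} (G : Graph n) (simple : IsSimple G) where

    private
      E = ∣E∣ G
      pairs = List.cartesianProduct (allFin n) (allFin n)

      edge? : Decidable (λ ((u , v) : Fin n × Fin n) → u Fin.< v × Adj G u v)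
      edge? (u , v) = (u Fin.<? v) ×-dec (v ∈? neighbours G u)

    adjacent-ends : ∀ {u v} → Adj G u v → ∃[ e ] (endpoints G e ≡ (u , v) ⊎ endpoints G e ≡ (v , u))
    adjacent-ends {u} {v} uv with FinP.<-cmp u v
    ... | tri≈ _ refl _ = contradiction uv (proj₂ simple u)
    ... | tri< u<v _ _ = Any.index uv∈ , inj₁ (sym (AnyP.lookup-index uv∈))
      where uv∈ = ∈P.∈-filter⁺ edge? (∈P.∈-cartesianProduct⁺ (∈P.∈-allFin u) (∈P.∈-allFin v)) (u<v , uv)
    ... | tri> _ _ v<u = Any.index vu∈ , inj₂ (sym (AnyP.lookup-index vu∈))
      where vu∈ = ∈P.∈-filter⁺ edge? (∈P.∈-cartesianProduct⁺ (∈P.∈-allFin v) (∈P.∈-allFin u)) (v<u , proj₁ simple u v uv)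

    edgeInside? : ∀ (W : Subset n) e → Dec (tail G e ∈ W × head G e ∈ W)
    edgeInside? W e = tail G e ∈? W ×-dec head G e ∈? W

    edges-inside : ∀ W → 2 * (∑[ e ← allFin E ] 𝟙 (edgeInside? W e)) ≡ inner G W
    edges-inside W = begin
      2 * (∑[ e ← allFin E ] 𝟙 (edgeInside? W e))
        ≡⟨ cong (2 *_) (trans (∑-lookup (edges G) (λ (u , v) → 𝟙 (u ∈? W ×-dec v ∈? W)))
             (trans (∑-filter edge? pairs (λ (u , v) → 𝟙 (u ∈? W ×-dec v ∈? W)))
                    (∑-cartesianProduct (allFin n) (allFin n) (λ (u , v) → 𝟙 (edge? (u , v)) * 𝟙 (u ∈? W ×-dec v ∈? W))))) ⟩
      2 * ∑² ordered
        ≡⟨ cong (∑² ordered +_) (trans (+-identityʳ (∑² ordered)) (∑-swap (allFin n) (allFin n) ordered)) ⟩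
      ∑² ordered + ∑² (λ u v → ordered v u)
        ≡⟨ ∑²-+ ordered (λ u v → ordered v u) ⟨
      ∑² (λ u v → ordered u v + ordered v u)
        ≡⟨ (∑²-cong λ u v → either u v) ⟩
      inner G W ∎
      where
      open ≡-Reasoning
      ordered : Fin n → Fin n → ℕ
      ordered u v = 𝟙 (edge? (u , v)) * 𝟙 (u ∈? W ×-dec v ∈? W)
      ordered-yes : ∀ {u v} → u Fin.< v → ordered u v ≡ 𝟙 (inside? G W u v)
      ordered-yes {u} {v} u<v = trans (sym (𝟙-× (edge? (u , v)) (u ∈? W ×-dec v ∈? W)))
        (𝟙-cong (edge? (u , v) ×-dec (u ∈? W ×-dec v ∈? W)) (inside? G W u v) (λ ((_ , uv) , u∈ , v∈) → u∈ , v∈ , uv) (λ (u∈ , v∈ , uv) → (u<v , uv) , u∈ , v∈))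
      ordered-no : ∀ {u v} → ¬ (u Fin.< v) → ordered u v ≡ 0
      ordered-no {u} {v} u≮v = cong (_* 𝟙 (u ∈? W ×-dec v ∈? W)) (𝟙-no (edge? (u , v)) (u≮v ∘ proj₁))
      inside-sym : ∀ u v → 𝟙 (inside? G W v u) ≡ 𝟙 (inside? G W u v)
      inside-sym u v = 𝟙-cong (inside? G W v u) (inside? G W u v) (λ (p , q , r) → q , p , proj₁ simple v u r) (λ (p , q , r) → q , p , proj₁ simple u v r)
      either : ∀ u v → ordered u v + ordered v u ≡ 𝟙 (inside? G W u v)
      either u v with FinP.<-cmp u v
      ... | tri< u<v _ v≮u = trans (cong₂ _+_ (ordered-yes u<v) (ordered-no v≮u)) (+-identityʳ _)
      ... | tri> u≮v _ v<u = trans (cong₂ _+_ (ordered-no u≮v) (ordered-yes v<u)) (inside-sym u v)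
      ... | tri≈ u≮v refl _ = trans (cong₂ _+_ (ordered-no u≮v) (ordered-no u≮v)) (sym (𝟙-no (inside? G W u u) λ (_ , _ , loop) → proj₂ simple u loop))

    handshake : ∀ {d} → IsRegular d G → 2 * E ≡ n * d
    handshake {d} reg = begin
      2 * E
        ≡⟨ cong (2 *_) (trans (sym (*-identityʳ E)) (trans (sym (∑-fins-const E 1))
             (∑-cong (allFin E) λ e → sym (𝟙-yes (edgeInside? ⊤ₛ e) (∈⊤ , ∈⊤))))) ⟩
      2 * (∑[ e ← allFin E ] 𝟙 (edgeInside? ⊤ₛ e))
        ≡⟨ edges-inside ⊤ₛ ⟩
      inner G ⊤ₛ
        ≡⟨ (∑²-cong λ u v → 𝟙-cong (inside? G ⊤ₛ u v) (adj? G u v) (λ (_ , _ , uv) → uv) (λ uv → ∈⊤ , ∈⊤ , uv)) ⟩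
      ∑²[ u , v ] 𝟙 (adj? G u v)
        ≡⟨ total-degree {G = G} reg ⟩
      n * d ∎
      where open ≡-Reasoning

    module Components (ℓ : Labelling G) (es : List (Fin E)) (unique : Unique es)
                      (joined : All (λ e → ℓ (tail G e) ≡ ℓ (head G e)) es) where

      size links : Fin n → ℕ
      size  c = ∑[ v ← allFin n ] 𝟙 (ℓ v Fin.≟ c)
      links c = ∑[ e ← es ] 𝟙 (ℓ (tail G e) Fin.≟ c)

      -- In the application the classes are the components of `es`, and a component is a tree
      -- exactly when it has fewer links than vertices.
      Cyclic : Fin n → Set
      Cyclic c = 1 ≤ size c × size c ≤ links c

      cyclic? : Decidable Cyclic
      cyclic? c = (1 ≤? size c) ×-dec (size c ≤? links c)

      W : Subset n
      W = comprehension (cyclic? ∘ ℓ)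

      occupied-size : ∀ {c} → (∃[ v ] ℓ v ≡ c) → 1 ≤ size c
      occupied-size {c} (v , eq) = ≤-trans (1≤𝟙 (ℓ v Fin.≟ c) eq) (∑-∈ (λ v → 𝟙 (ℓ v Fin.≟ c)) (∈P.∈-allFin v))

      ∑-by-label : ∀ {A : Set} (xs : List A) (label : A → Fin n) w →
        ∑[ c ← allFin n ] (w c * (∑[ x ← xs ] 𝟙 (label x Fin.≟ c))) ≡ ∑[ x ← xs ] w (label x)
      ∑-by-label xs label w = begin
        ∑[ c ← allFin n ] (w c * (∑[ x ← xs ] 𝟙 (label x Fin.≟ c)))
          ≡⟨ (∑-cong (allFin n) λ c → trans (sym (∑-*ˡ xs (w c) (λ x → 𝟙 (label x Fin.≟ c)))) (∑-cong xs λ x → *-comm (w c) (𝟙 (label x Fin.≟ c)))) ⟩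
        ∑[ c ← allFin n ] ∑[ x ← xs ] (𝟙 (label x Fin.≟ c) * w c)
          ≡⟨ ∑-swap (allFin n) xs (λ c x → 𝟙 (label x Fin.≟ c) * w c) ⟩
        ∑[ x ← xs ] ∑[ c ← allFin n ] (𝟙 (label x Fin.≟ c) * w c)
          ≡⟨ ∑-cong xs (λ x → ∑-point (label x) w) ⟩
        ∑[ x ← xs ] w (label x) ∎
        where open ≡-Reasoning

      cyclicSize cyclicLinks cyclicCount : ℕ
      cyclicSize  = ∑[ c ← allFin n ] (𝟙 (cyclic? c) * size c)
      cyclicLinks = ∑[ c ← allFin n ] (𝟙 (cyclic? c) * links c)
      cyclicCount = ∑[ c ← allFin n ] 𝟙 (cyclic? c)

      size-W : cyclicSize ≡ ∣ W ∣
      size-W = trans (∑-by-label (allFin n) ℓ (λ c → 𝟙 (cyclic? c))) (trans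
        (∑-cong (allFin n) λ v → 𝟙-cong (cyclic? (ℓ v)) (v ∈? W) (∈-comprehension⁺ (cyclic? ∘ ℓ)) (∈-comprehension⁻ (cyclic? ∘ ℓ))) (sym (∣p∣≡∑ W)))

      links-inside : ∀ {P : Fin E → Set} (P? : Decidable P) K → (∀ {e} → e ∈ₗ es → P e → tail G e ∈ K × head G e ∈ K) →
                     2 * (∑[ e ← es ] 𝟙 (P? e)) ≤ inner G K
      links-inside P? K inside = begin
        2 * (∑[ e ← es ] 𝟙 (P? e)) ≤⟨ *-monoʳ-≤ 2 (∑-mono-∈ es λ {e} e∈ → 𝟙-mono (P? e) (edgeInside? K e) (inside e∈)) ⟩
        2 * (∑[ e ← es ] 𝟙 (edgeInside? K e)) ≤⟨ *-monoʳ-≤ 2 (∑-unique-⊆ (λ e → 𝟙 (edgeInside? K e)) unique λ {e} _ → ∈P.∈-allFin e) ⟩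
        2 * (∑[ e ← allFin E ] 𝟙 (edgeInside? K e)) ≡⟨ edges-inside K ⟩
        inner G K ∎
        where open ≤-Reasoning

      links-W : 2 * cyclicLinks ≤ inner G W
      links-W = ≤-trans (≤-reflexive (cong (2 *_) (∑-by-label es (ℓ ∘ tail G) (λ c → 𝟙 (cyclic? c)))))
        (links-inside (λ e → cyclic? (ℓ (tail G e))) W λ {e} e∈ cyc →
          ∈-comprehension⁺ (cyclic? ∘ ℓ) cyc , ∈-comprehension⁺ (cyclic? ∘ ℓ) (subst Cyclic (All.lookup joined e∈) cyc))

      size≤links : cyclicSize ≤ cyclicLinks
      size≤links = ∑-mono (allFin n) λ c → term c (cyclic? c)
        where
        term : ∀ c (cyc? : Dec (Cyclic c)) → 𝟙 cyc? * size c ≤ 𝟙 cyc? * links c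
        term c (yes (_ , le)) = *-monoʳ-≤ 1 le
        term c (no _)         = z≤n

      links-total : ∑ (allFin n) links ≡ length es
      links-total = trans (∑-cong (allFin n) λ c → sym (*-identityˡ (links c)))
        (trans (∑-by-label es (ℓ ∘ tail G) (λ _ → 1)) (trans (∑-const es 1) (*-identityʳ (length es))))

      cyclicLinks≤ : cyclicLinks ≤ length es
      cyclicLinks≤ = ≤-trans (∑-mono (allFin n) λ c → ≤-trans (*-monoˡ-≤ (links c) (𝟙≤1 (cyclic? c))) (≤-reflexive (*-identityˡ (links c)))) (≤-reflexive links-total)

      -- Summation over classes: a nonempty class that is not cyclic has links + 1 ≤ size, and an
      -- empty class has no links. Rearranged, the edges of `es` exceed n - classes, the size of a
      -- spanning forest, by at most the excess links of the cyclic classes plus one for each such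
      -- class.
      balance : length es + cyclicSize + classes G ℓ ≤ n + (cyclicLinks + cyclicCount)
      balance = begin
        length es + cyclicSize + classes G ℓ
          ≡⟨ cong (λ z → z + cyclicSize + classes G ℓ) (sym links-total) ⟩
        ∑ (allFin n) links + cyclicSize + classes G ℓ
          ≡⟨ trans (cong (_+ classes G ℓ) (sym (∑-+ (allFin n) links (λ c → 𝟙 (cyclic? c) * size c))))
               (sym (∑-+ (allFin n) (λ c → links c + 𝟙 (cyclic? c) * size c) (λ c → 𝟙 (occupied? G ℓ c)))) ⟩
        ∑[ c ← allFin n ] (links c + 𝟙 (cyclic? c) * size c + 𝟙 (occupied? G ℓ c))
          ≤⟨ ∑-mono (allFin n) (λ c → term c (cyclic? c)) ⟩
        ∑[ c ← allFin n ] (size c + (𝟙 (cyclic? c) * links c + 𝟙 (cyclic? c)))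
          ≡⟨ trans (∑-+ (allFin n) size (λ c → 𝟙 (cyclic? c) * links c + 𝟙 (cyclic? c)))
               (cong₂ _+_ total-size (∑-+ (allFin n) (λ c → 𝟙 (cyclic? c) * links c) (λ c → 𝟙 (cyclic? c)))) ⟩
        n + (cyclicLinks + cyclicCount) ∎
        where
        open ≤-Reasoning
        total-size : ∑ (allFin n) size ≡ n
        total-size = trans (∑-cong (allFin n) λ c → sym (*-identityˡ (size c)))
          (trans (∑-by-label (allFin n) ℓ (λ _ → 1)) (∑-ones n))
        occ : Fin n → ℕ
        occ c = 𝟙 (occupied? G ℓ c)
        term : ∀ c (cyc? : Dec (Cyclic c)) → links c + 𝟙 cyc? * size c + occ c ≤ size c + (𝟙 cyc? * links c + 𝟙 cyc?)
        term c (yes _) = ≤-trans (+-monoʳ-≤ (links c + 1 * size c) (𝟙≤1 (occupied? G ℓ c))) (≤-reflexive (lemma (links c) (size c)))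
          where
          lemma : ∀ l s → l + 1 * s + 1 ≡ s + (1 * l + 1)
          lemma = solve-∀
        term c (no ¬cyc) = ≤-trans (≤-reflexive (cong (_+ occ c) (+-identityʳ (links c)))) (≤-trans (acyclic (1 ≤? size c)) (≤-reflexive (sym (+-identityʳ (size c)))))
          where
          acyclic : Dec (1 ≤ size c) → links c + occ c ≤ size c
          acyclic (yes 1≤) = ≤-trans (+-monoʳ-≤ (links c) (𝟙≤1 (occupied? G ℓ c))) (≤-trans (≤-reflexive (+-comm (links c) 1)) (≰⇒> λ le → ¬cyc (1≤ , le)))
          acyclic (no ¬1≤) = ≤-trans (≤-reflexive (cong₂ _+_ no-links (𝟙-no (occupied? G ℓ c) (¬1≤ ∘ occupied-size)))) z≤n
            where
            no-links : links c ≡ 0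
            no-links = trans (∑-cong es λ e → 𝟙-no (ℓ (tail G e) Fin.≟ c) λ eq → ¬1≤ (occupied-size (tail G e , eq))) (∑-zero es)

      -- A cyclic class of at most L vertices is one of the sets counted by `cyclicSets`, and
      -- different classes are different sets. A larger one pays for its L out of its own size.
      cyclicCount-bound : ∀ L → L * cyclicCount ≤ L * cyclicSets L G + cyclicSize
      cyclicCount-bound L = begin
        L * cyclicCount
          ≡⟨ ∑-*ˡ (allFin n) L (λ c → 𝟙 (cyclic? c)) ⟨
        ∑[ c ← allFin n ] (L * 𝟙 (cyclic? c))
          ≤⟨ ∑-mono (allFin n) (λ c → term c (cyclic? c) (size c ≤? L)) ⟩
        ∑[ c ← allFin n ] (L * 𝟙 (small? c) + 𝟙 (cyclic? c) * size c)
          ≡⟨ ∑-+ (allFin n) (λ c → L * 𝟙 (small? c)) (λ c → 𝟙 (cyclic? c) * size c) ⟩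
        (∑[ c ← allFin n ] (L * 𝟙 (small? c))) + cyclicSize
          ≡⟨ cong (_+ cyclicSize) (∑-*ˡ (allFin n) L (λ c → 𝟙 (small? c))) ⟩
        L * (∑[ c ← allFin n ] 𝟙 (small? c)) + cyclicSize
          ≤⟨ +-monoˡ-≤ cyclicSize (*-monoʳ-≤ L (∑-injection K (UniqueP.allFin⁺ n) (λ {c} _ p → ∈-subsets (K c) , fits c (𝟙-positive (small? c) p))
               λ {c} {c′} _ _ p _ → injective (proj₁ (proj₁ (𝟙-positive (small? c) p))))) ⟩
        L * cyclicSets L G + cyclicSize ∎
        where
        open ≤-Reasoning
        small? : Decidable (λ c → Cyclic c × size c ≤ L)
        small? c = cyclic? c ×-dec (size c ≤? L)
        term : ∀ c (cyc? : Dec (Cyclic c)) (le? : Dec (size c ≤ L)) → L * 𝟙 cyc? ≤ L * 𝟙 (cyc? ×-dec le?) + 𝟙 cyc? * size c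
        term c (no _)  _       = ≤-trans (≤-reflexive (*-zeroʳ L)) z≤n
        term c (yes _) (yes _) = m≤m+n (L * 1) _
        term c (yes _) (no ≰L) = ≤-trans (≤-reflexive (*-identityʳ L)) (≤-trans (<⇒≤ (≰⇒> ≰L)) (≤-trans (≤-reflexive (sym (*-identityˡ (size c)))) (m≤n+m _ (L * 0))))
        K : Fin n → Subset n
        K c = comprehension (λ v → ℓ v Fin.≟ c)
        K⁺ : ∀ {c v} → ℓ v ≡ c → v ∈ K c
        K⁺ {c} = ∈-comprehension⁺ (λ v → ℓ v Fin.≟ c)
        K⁻ : ∀ {c v} → v ∈ K c → ℓ v ≡ c
        K⁻ {c} = ∈-comprehension⁻ (λ v → ℓ v Fin.≟ c)
        ∣K∣ : ∀ c → ∣ K c ∣ ≡ size c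
        ∣K∣ c = trans (∣p∣≡∑ (K c)) (∑-cong (allFin n) λ v → 𝟙-cong (v ∈? K c) (ℓ v Fin.≟ c) K⁻ K⁺)
        fits : ∀ c → Cyclic c × size c ≤ L → 𝟙 (small? c) ≤ 𝟙 ((1 ≤? ∣ K c ∣) ×-dec (∣ K c ∣ ≤? L)) * 𝟙 (2 * ∣ K c ∣ ≤? inner G (K c))
        fits c ((1≤ , le) , ≤L) = ≤-trans (𝟙≤1 (small? c)) (*-mono-≤
          (1≤𝟙 ((1 ≤? ∣ K c ∣) ×-dec (∣ K c ∣ ≤? L)) (subst (1 ≤_) (sym (∣K∣ c)) 1≤ , subst (_≤ L) (sym (∣K∣ c)) ≤L))
          (1≤𝟙 (2 * ∣ K c ∣ ≤? inner G (K c)) (≤-trans (*-monoʳ-≤ 2 (≤-trans (≤-reflexive (∣K∣ c)) le))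
            (links-inside (λ e → ℓ (tail G e) Fin.≟ c) (K c) λ e∈ eq → K⁺ eq , K⁺ (trans (sym (All.lookup joined e∈)) eq)))))
        injective : ∀ {c c′} → 1 ≤ size c → K c ≡ K c′ → c ≡ c′
        injective {c} {c′} 1≤ eq with v , _ , p ← ∑-positive (allFin n) (λ v → 𝟙 (ℓ v Fin.≟ c)) 1≤ =
          let ℓv≡c = 𝟙-positive (ℓ v Fin.≟ c) p in trans (sym ℓv≡c) (K⁻ (subst (v ∈_) eq (K⁺ ℓv≡c)))

      module _ {d q : ℕ} .{{_ : NonZero q}} (sparse : ¬ HasDenseSet d q G) (few : scale d q * length es ≤ n) where

        -- Sparsity is applied once, to the union W of all cyclic classes. This union is small
        -- enough because it has at least as many links as vertices, hence at most `length es`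
        -- vertices.
        cyclicLinks-bound : cyclicLinks ≤ ∣ W ∣ + ∣ W ∣ / q
        cyclicLinks-bound = by-cases (1 ≤? ∣ W ∣)
          where
          by-cases : Dec (1 ≤ ∣ W ∣) → cyclicLinks ≤ ∣ W ∣ + ∣ W ∣ / q
          by-cases (yes 1≤) = +-cancelʳ-≤ 1 _ _ (≤-trans (≤-reflexive (+-comm cyclicLinks 1))
            (≤-trans (*-cancelˡ-< 2 cyclicLinks (∣ W ∣ + (∣ W ∣ / q + 1)) (≤-<-trans links-W (≰⇒> λ dense → sparse (W , (1≤ , small) , dense))))
                     (≤-reflexive (sym (+-assoc ∣ W ∣ (∣ W ∣ / q) 1)))))
            where
            small : scale d q * ∣ W ∣ ≤ n
            small = ≤-trans (*-monoʳ-≤ (scale d q) (≤-trans (≤-reflexive (sym size-W)) (≤-trans size≤links cyclicLinks≤))) few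
          by-cases (no ¬1≤) = ≤-trans (*-cancelˡ-≤ 2 (≤-trans links-W (≤-trans (m≤m+n (inner G W) ∣ W ∣) (≤-trans (inner-complete {G = G} simple W)
            (≤-reflexive (cong (λ k → k * k) (n<1⇒n≡0 (≰⇒> ¬1≤)))))))) z≤n

        -- Two losses occur: the excess |W| / q, and the number of cyclic classes, which is at most
        -- `cyclicSets q G` plus cyclicSize / q. Since |W| and `cyclicSize` are both at most
        -- `length es`, multiplication by q produces the term `2 * length es`.
        components-rank : ∀ {k} → n ≤ k + classes G ℓ → q * length es ≤ q * k + (2 * length es + q * cyclicSets q G)
        components-rank {k} n≤ = begin
          q * length es
            ≤⟨ *-monoʳ-≤ q es≤ ⟩
          q * (k + (∣ W ∣ / q + cyclicCount))
            ≡⟨ lemma q k (∣ W ∣ / q) cyclicCount ⟩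
          q * k + (∣ W ∣ / q * q + q * cyclicCount)
            ≤⟨ +-monoʳ-≤ (q * k) (+-mono-≤ (m/n*n≤m ∣ W ∣ q) (cyclicCount-bound q)) ⟩
          q * k + (∣ W ∣ + (q * cyclicSets q G + cyclicSize))
            ≤⟨ +-monoʳ-≤ (q * k) (+-mono-≤ W≤ (+-monoʳ-≤ (q * cyclicSets q G) (≤-trans size≤links cyclicLinks≤))) ⟩
          q * k + (length es + (q * cyclicSets q G + length es))
            ≡⟨ lemma₂ q k (length es) (cyclicSets q G) ⟩
          q * k + (2 * length es + q * cyclicSets q G) ∎
          where
          open ≤-Reasoning
          W≤ : ∣ W ∣ ≤ length es
          W≤ = ≤-trans (≤-reflexive (sym size-W)) (≤-trans size≤links cyclicLinks≤)
          lemma : ∀ q k j c → q * (k + (j + c)) ≡ q * k + (j * q + q * c)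
          lemma = solve-∀
          lemma₂ : ∀ q k s z → q * k + (s + (q * z + s)) ≡ q * k + (2 * s + q * z)
          lemma₂ = solve-∀
          lemma₃ : ∀ s w c → s + (w + c) ≡ s + w + c
          lemma₃ = solve-∀
          lemma₄ : ∀ k c w j m → k + c + (w + j + m) ≡ k + (j + m) + (w + c)
          lemma₄ = solve-∀
          es≤ : length es ≤ k + (∣ W ∣ / q + cyclicCount)
          es≤ = +-cancelʳ-≤ (∣ W ∣ + classes G ℓ) _ _ (begin
            length es + (∣ W ∣ + classes G ℓ) ≡⟨ trans (lemma₃ (length es) ∣ W ∣ (classes G ℓ)) (cong (λ z → length es + z + classes G ℓ) (sym size-W)) ⟩
            length es + cyclicSize + classes G ℓ ≤⟨ balance ⟩
            n + (cyclicLinks + cyclicCount) ≤⟨ +-mono-≤ n≤ (+-monoˡ-≤ cyclicCount cyclicLinks-bound) ⟩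
            k + classes G ℓ + (∣ W ∣ + ∣ W ∣ / q + cyclicCount) ≡⟨ lemma₄ k (classes G ℓ) ∣ W ∣ (∣ W ∣ / q) cyclicCount ⟩
            k + (∣ W ∣ / q + cyclicCount) + (∣ W ∣ + classes G ℓ) ∎)

  module _ {n : ℕ} (G : Graph n) (simple : IsSimple G) where

    private
      E = ∣E∣ G

    classes-id : classes G id ≡ n
    classes-id = trans (∑-cong (allFin n) λ c → 𝟙-yes (occupied? G id c) (c , refl)) (∑-ones n)

    spanning : ¬ Disconnected G → ∀ {T ℓ} → Forest G T ℓ → (∀ e → ℓ (tail G e) ≡ ℓ (head G e)) → IsSpanningTree G T
    spanning connected {T} {ℓ} forest joins = (λ u v → path u v (all-equal u v)) , acyclic
      where
      open Forest forest
      adjacent-equal : ∀ {s t} → Adj G s t → ℓ s ≡ ℓ t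
      adjacent-equal st with adjacent-ends G simple st
      ... | e , inj₁ eq = subst (λ (u , v) → ℓ u ≡ ℓ v) eq (joins e)
      ... | e , inj₂ eq = sym (subst (λ (u , v) → ℓ u ≡ ℓ v) eq (joins e))
      all-equal : ∀ u v → ℓ u ≡ ℓ v
      all-equal u v with ℓ u Fin.≟ ℓ v
      ... | yes eq = eq
      ... | no ne = contradiction (V , ((u , ∈-comprehension⁺ same? refl) , v , ne ∘ ∈-comprehension⁻ same?) , closed) connected
        where
        same? : Decidable (λ w → ℓ u ≡ ℓ w)
        same? w = ℓ u Fin.≟ ℓ w
        V = comprehension same?
        closed : ∀ s t → ¬ Crossing G V s t
        closed s t ((s∈ , t∉) , st) = t∉ (∈-comprehension⁺ same? (trans (∈-comprehension⁻ same? s∈) (adjacent-equal st)))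

    tree-through : ∀ {d q} .{{_ : NonZero q}} → ¬ Disconnected G → ¬ HasDenseSet d q G →
      ∀ P es → Unique es → All (_∈ P) es → scale d q * length es ≤ n →
      ∃[ T ] IsSpanningTree G T × q * length es ≤ q * ∣ P ∩ T ∣ + (2 * length es + q * cyclicSets q G)
    tree-through {d} {q} connected sparse P es unique es⊆P few = T₂ , spanning connected forest₂ (λ e → All.lookup spans₂ (∈P.∈-allFin e)) ,
      ≤-trans (components-rank {d} {q} sparse few n≤)
        (+-monoˡ-≤ (2 * length es + q * cyclicSets q G) (*-monoʳ-≤ q (p⊆q⇒∣p∣≤∣q∣ λ x∈ → let x∈P , x∈T = x∈p∩q⁻ P T₁ x∈ in x∈p∩q⁺ (x∈P , grows₂ x∈T))))
      where
      -- Offering `es` before the other edges makes every edge of the first forest lie in P, so its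
      -- rank bound counts edges of P, and its labels are the components of `es`. The second run
      -- only has to keep these edges while completing the tree.
      open Extension (kruskal G (empty-forest G) es) renaming (T′ to T₁; ℓ′ to ℓ₁; forest to forest₁; spans to spans₁; rank to rank₁)
      open Extension (kruskal G forest₁ (allFin E)) renaming (T′ to T₂; forest to forest₂; spans to spans₂; grows to grows₂)
      open Components G simple ℓ₁ es unique spans₁
      n≤ : n ≤ ∣ P ∩ T₁ ∣ + classes G ℓ₁
      n≤ = ≤-trans (≤-reflexive (sym classes-id)) (≤-trans (m≤n+m (classes G id) ∣ P ∩ ⊥ₛ ∣) (rank₁ P es⊆P))

    module _ {r : ℕ} (f : Colouring r G) where

      ∈-class⁺ : ∀ {i e} → Vec.lookup f e ≡ i → e ∈ colourClass G f i
      ∈-class⁺ {i} {e} eq = VecP.lookup⇒[]= e _ (trans (VecP.lookup-map e (λ c → does (c Fin.≟ i)) f) (dec-true (Vec.lookup f e Fin.≟ i) eq))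

      ∈-class⁻ : ∀ {i e} → e ∈ colourClass G f i → Vec.lookup f e ≡ i
      ∈-class⁻ {i} {e} e∈ with Vec.lookup f e Fin.≟ i | trans (sym (VecP.lookup-map e (λ c → does (c Fin.≟ i)) f)) (VecP.[]=⇒lookup e∈)
      ... | yes eq | _ = eq

      class-size : ∀ i → ∣ colourClass G f i ∣ ≡ ∑[ e ← allFin E ] 𝟙 (Vec.lookup f e Fin.≟ i)
      class-size i = trans (∣p∣≡∑ (colourClass G f i)) (∑-cong (allFin E) λ e → 𝟙-cong (e ∈? colourClass G f i) (Vec.lookup f e Fin.≟ i) ∈-class⁻ ∈-class⁺)

      large-class : .{{_ : NonZero r}} → ∃[ i ] E / r ≤ ∣ colourClass G f i ∣
      large-class with FinP.any? (λ i → E / r ≤? ∣ colourClass G f i ∣)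
      ... | yes large = large
      ... | no ¬large = contradiction too-many (<⇒≱ (m<n+m E (>-nonZero⁻¹ r)))
        where
        open ≤-Reasoning
        total : ∑[ i ← allFin r ] ∣ colourClass G f i ∣ ≡ E
        total = trans (∑-cong (allFin r) class-size) (trans (∑-swap (allFin r) (allFin E) (λ i e → 𝟙 (Vec.lookup f e Fin.≟ i)))
          (trans (∑-cong (allFin E) λ e → ∑-point₁ (Vec.lookup f e)) (∑-ones E)))
        too-many : r + E ≤ E
        too-many = begin
          r + E ≡⟨ cong₂ _+_ (sym (∑-ones r)) (sym total) ⟩
          (∑[ i ← allFin r ] 1) + (∑[ i ← allFin r ] ∣ colourClass G f i ∣) ≡⟨ ∑-+ (allFin r) (λ _ → 1) (λ i → ∣ colourClass G f i ∣) ⟨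
          ∑[ i ← allFin r ] suc ∣ colourClass G f i ∣ ≤⟨ ∑-mono (allFin r) (λ i → ≰⇒> λ le → ¬large (i , le)) ⟩
          ∑[ i ← allFin r ] (E / r) ≡⟨ trans (∑-fins-const r (E / r)) (*-comm r (E / r)) ⟩
          E / r * r ≤⟨ m/n*n≤m E r ⟩
          E ∎

      -- A frequent colour may have far more than E / r edges, but sparsity reaches only selections
      -- of at most n / `scale d q` edges; hence the truncation to exactly E / r. The term `q * r`
      -- pays for rounding this quotient down.
      monochromatic-tree : ∀ {d q} .{{_ : NonZero q}} .{{_ : NonZero r}} → ¬ Disconnected G → ¬ HasDenseSet d q G → scale d q * (E / r) ≤ n →
        ∃[ T ] IsSpanningTree G T × q * E ≤ q * (r * largestClass G f T) + (2 * E + q * r + q * (r * cyclicSets q G))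
      monochromatic-tree {d} {q} connected sparse few =
        let i , large = large-class
            es = List.take (E / r) (filter (_∈? colourClass G f i) (allFin E))
            ∣es∣ = trans (ListP.length-take (E / r) (filter (_∈? colourClass G f i) (allFin E)))
                     (m≤n⇒m⊓n≡m (≤-trans large (≤-reflexive (trans (∣p∣≡∑ (colourClass G f i)) (sym (length-filter (_∈? colourClass G f i) (allFin E)))))))
            T , tree , bound = tree-through {d} {q} connected sparse (colourClass G f i) es
              (UniqueP.take⁺ (E / r) (UniqueP.filter⁺ (_∈? colourClass G f i) (UniqueP.allFin⁺ E)))
              (AllP.take⁺ (E / r) (AllP.all-filter (_∈? colourClass G f i) (allFin E)))
              (subst (λ s → scale d q * s ≤ n) (sym ∣es∣) few)
        in T , tree , arithmetic ∣ colourClass G f i ∩ T ∣ _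
             (All.lookup (ℕExtrema.xs≤max 0 (List.map (λ i → ∣ colourClass G f i ∩ T ∣) (allFin r))) (∈P.∈-map⁺ (λ i → ∣ colourClass G f i ∩ T ∣) (∈P.∈-allFin i)))
             (subst (λ s → q * s ≤ q * ∣ colourClass G f i ∩ T ∣ + (2 * s + q * cyclicSets q G)) ∣es∣ bound)
        where
        Z = cyclicSets q G
        arithmetic : ∀ k m → k ≤ m → q * (E / r) ≤ q * k + (2 * (E / r) + q * Z) → q * E ≤ q * (r * m) + (2 * E + q * r + q * (r * Z))
        arithmetic k m k≤m bound = begin
          q * E ≡⟨ cong (q *_) (m≡m%n+[m/n]*n E r) ⟩
          q * (E % r + E / r * r) ≤⟨ *-monoʳ-≤ q (+-monoˡ-≤ (E / r * r) (<⇒≤ (m%n<n E r))) ⟩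
          q * (r + E / r * r) ≡⟨ lemma₁ q r (E / r) ⟩
          q * r + r * (q * (E / r)) ≤⟨ +-monoʳ-≤ (q * r) (*-monoʳ-≤ r bound) ⟩
          q * r + r * (q * k + (2 * (E / r) + q * Z)) ≡⟨ lemma₂ q r k (E / r) Z ⟩
          q * (r * k) + (2 * (E / r * r) + q * r + q * (r * Z)) ≤⟨ +-mono-≤ (*-monoʳ-≤ q (*-monoʳ-≤ r k≤m))
                                                                                 (+-monoˡ-≤ (q * (r * Z)) (+-monoˡ-≤ (q * r) (*-monoʳ-≤ 2 (m/n*n≤m E r)))) ⟩
          q * (r * m) + (2 * E + q * r + q * (r * Z)) ∎
          where
          open ≤-Reasoning
          lemma₁ : ∀ q r s → q * (r + s * r) ≡ q * r + r * (q * s)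
          lemma₁ = solve-∀
          lemma₂ : ∀ q r k s Z → q * r + r * (q * k + (2 * s + q * Z)) ≡ q * (r * k) + (2 * (s * r) + q * r + q * (r * Z))
          lemma₂ = solve-∀

    module _ (r : ℕ) .{{_ : NonZero r}} where

      private
        block = suc (E / r)

        block-index : ∀ (e : Fin E) → toℕ e / block < r
        block-index e = m<n*o⇒m/o<n (<-≤-trans (FinP.toℕ<n e) (begin
          E ≡⟨ m≡m%n+[m/n]*n E r ⟩
          E % r + E / r * r ≤⟨ +-monoˡ-≤ (E / r * r) (<⇒≤ (m%n<n E r)) ⟩
          r + E / r * r ≡⟨ *-comm block r ⟩
          r * block ∎))
          where open ≤-Reasoning

      -- Consecutive blocks of `suc (E / r)` edges: rounding up makes r blocks suffice and costs at
      -- most r in r times the size of a class.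
      blockColouring : Colouring r G
      blockColouring = Vec.tabulate (λ e → fromℕ< (block-index e))

      blockColouring-bound : ∀ T → r * largestClass G blockColouring T ≤ E + r
      blockColouring-bound T = begin
        r * largestClass G blockColouring T ≤⟨ *-monoʳ-≤ r (ℕExtrema.max≤v⁺ z≤n (AllP.map⁺ {xs = allFin r} (All.tabulate λ {i} _ → ≤-trans (∣p∩q∣≤∣p∣ (colourClass G blockColouring i) T) (small i)))) ⟩
        r * block ≡⟨ *-comm r block ⟩
        r + E / r * r ≤⟨ +-monoʳ-≤ r (m/n*n≤m E r) ⟩
        r + E ≡⟨ +-comm r E ⟩
        E + r ∎
        where
        open ≤-Reasoning
        position : Fin E → Fin block
        position e = fromℕ< (m%n<n (toℕ e) block)
        small : ∀ i → ∣ colourClass G blockColouring i ∣ ≤ block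
        small i = begin
          ∣ colourClass G blockColouring i ∣
            ≡⟨ class-size blockColouring i ⟩
          ∑[ e ← allFin E ] 𝟙 (Vec.lookup blockColouring e Fin.≟ i)
            ≤⟨ ∑-injection position {f = λ e → 𝟙 (Vec.lookup blockColouring e Fin.≟ i)} {g = λ _ → 1} (UniqueP.allFin⁺ E)
                 (λ {e} _ _ → ∈P.∈-allFin (position e) , 𝟙≤1 (Vec.lookup blockColouring e Fin.≟ i))
                 (λ {e} {e′} _ _ p p′ eq → FinP.toℕ-injective (same-block (𝟙-positive (Vec.lookup blockColouring e Fin.≟ i) p) (𝟙-positive (Vec.lookup blockColouring e′ Fin.≟ i) p′) eq)) ⟩
          ∑[ j ← allFin block ] 1
            ≡⟨ ∑-ones block ⟩
          block ∎
          where
          quotient : ∀ {e} → Vec.lookup blockColouring e ≡ i → toℕ e / block ≡ toℕ i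
          quotient {e} eq = trans (sym (FinP.toℕ-fromℕ< (block-index e))) (cong toℕ (trans (sym (VecP.lookup∘tabulate (λ e → fromℕ< (block-index e)) e)) eq))
          same-block : ∀ {e e′} → Vec.lookup blockColouring e ≡ i → Vec.lookup blockColouring e′ ≡ i → position e ≡ position e′ → toℕ e ≡ toℕ e′
          same-block {e} {e′} p p′ eq = trans (m≡m%n+[m/n]*n (toℕ e) block) (trans
            (cong₂ (λ a b → a + b * block)
              (trans (sym (FinP.toℕ-fromℕ< (m%n<n (toℕ e) block))) (trans (cong toℕ eq) (FinP.toℕ-fromℕ< (m%n<n (toℕ e′) block))))
              (trans (quotient {e} p) (sym (quotient {e′} p′))))
            (sym (m≡m%n+[m/n]*n (toℕ e′) block)))

  -- Existence of regular graphs

  rangeSum : ℕ → (ℕ → ℕ) → ℕ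
  rangeSum n g = ∑[ i ← allFin n ] g (toℕ i)

  rangeSum-cong : ∀ n {f g} → (∀ i → i < n → f i ≡ g i) → rangeSum n f ≡ rangeSum n g
  rangeSum-cong n eq = ∑-cong (allFin n) λ i → eq (toℕ i) (FinP.toℕ<n i)

  rangeSum-+ : ∀ a b g → rangeSum (a + b) g ≡ rangeSum a g + rangeSum b (λ i → g (a + i))
  rangeSum-+ zero    b g = refl
  rangeSum-+ (suc a) b g = begin
    rangeSum (suc a + b) g ≡⟨ ∑-fins-suc {a + b} (g ∘ toℕ) ⟩
    g 0 + rangeSum (a + b) (g ∘ suc) ≡⟨ cong (g 0 +_) (rangeSum-+ a b (g ∘ suc)) ⟩
    g 0 + (rangeSum a (g ∘ suc) + rangeSum b (λ i → g (suc (a + i)))) ≡⟨ +-assoc (g 0) _ _ ⟨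
    g 0 + rangeSum a (g ∘ suc) + rangeSum b (λ i → g (suc (a + i))) ≡⟨ cong (_+ rangeSum b (λ i → g (suc (a + i)))) (∑-fins-suc {a} (g ∘ toℕ)) ⟨
    rangeSum (suc a) g + rangeSum b (λ i → g (suc (a + i))) ∎
    where open ≡-Reasoning

  module _ {P : ℕ → Set} (P? : Decidable P) where

    rangeSum-all : ∀ n → (∀ i → i < n → P i) → rangeSum n (𝟙 ∘ P?) ≡ n
    rangeSum-all n all = trans (rangeSum-cong n λ i i<n → 𝟙-yes (P? i) (all i i<n)) (∑-ones n)

    rangeSum-none : ∀ n → (∀ i → i < n → ¬ P i) → rangeSum n (𝟙 ∘ P?) ≡ 0
    rangeSum-none n none = trans (rangeSum-cong n λ i i<n → 𝟙-no (P? i) (none i i<n)) (∑-zero (allFin n))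

  -- The chords of a circulant graph on n vertices: those of length at most h around the circle, and the diameter if c = 1.
  Chord : ℕ → ℕ → ℕ → ℕ → Set
  Chord n h c δ = (1 ≤ δ × δ ≤ h) ⊎ (n ≤ δ + h × δ < n) ⊎ (c ≡ 1 × δ + δ ≡ n)

  chord? : ∀ n h c δ → Dec (Chord n h c δ)
  chord? n h c δ = ((1 ≤? δ) ×-dec (δ ≤? h)) ⊎-dec ((n ≤? δ + h) ×-dec (δ <? n)) ⊎-dec ((c ≟ 1) ×-dec (δ + δ ≟ n))

  chord-sym : ∀ {n h c δ δ′} → δ + δ′ ≡ n → 1 ≤ δ → 1 ≤ δ′ → Chord n h c δ → Chord n h c δ′
  chord-sym {h = h} {δ = δ} {δ′} refl 1≤δ 1≤δ′ (inj₁ (_ , δ≤h)) = inj₂ (inj₁ (≤-trans (+-monoˡ-≤ δ′ δ≤h) (≤-reflexive (+-comm h δ′)) , m<n+m δ′ 1≤δ))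
  chord-sym {δ = δ} refl 1≤δ 1≤δ′ (inj₂ (inj₁ (n≤ , _)))   = inj₁ (1≤δ′ , +-cancelˡ-≤ δ _ _ n≤)
  chord-sym {δ = δ} refl 1≤δ 1≤δ′ (inj₂ (inj₂ (c≡1 , eq))) with refl ← +-cancelˡ-≡ δ _ _ eq = inj₂ (inj₂ (c≡1 , refl))

  module _ (h m p c : ℕ) where

    private
      -- The distances 0 to n - 1 in segments: the vertex itself, h short chords, m non-chords, a
      -- middle segment of length p that holds the diameter if there is one, m non-chords, and h
      -- chords that are short the other way round.
      n = 1 + (h + (m + (p + (m + h))))
      chordAt? : ∀ a → Decidable (λ i → Chord n h c (a + i))
      chordAt? a i = chord? n h c (a + i)

      too-long : ∀ i → ¬ (1 + h + i ≤ h)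
      too-long i le = <⇒≱ (s≤s (m≤m+n h i)) le

      near : ∀ i → i < h → Chord n h c (1 + i)
      near i i<h = inj₁ (s≤s z≤n , i<h)

      none₁ : ∀ i → i < m → ¬ Chord n h c (1 + h + i)
      none₁ i i<m (inj₁ (_ , le)) = too-long i le
      none₁ i i<m (inj₂ (inj₁ (le , _))) = <⇒≱ (s≤s (begin-strict
        h + i + h ≡⟨ +-assoc h i h ⟩
        h + (i + h) <⟨ +-monoʳ-< h (+-monoˡ-< h i<m) ⟩
        h + (m + h) ≤⟨ +-monoʳ-≤ h (+-monoʳ-≤ m (≤-trans (m≤n+m h m) (m≤n+m (m + h) p))) ⟩
        h + (m + (p + (m + h))) ∎)) le
        where open ≤-Reasoning
      none₁ i i<m (inj₂ (inj₂ (_ , eq))) = <⇒≢ (begin-strict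
        1 + h + i + (1 + h + i) ≡⟨ lemma₁ h i ⟩
        suc i + suc i + (h + h) ≤⟨ +-monoˡ-≤ (h + h) (+-mono-≤ i<m i<m) ⟩
        m + m + (h + h) <⟨ s≤s (m≤n+m (m + m + (h + h)) p) ⟩
        1 + (p + (m + m + (h + h))) ≡⟨ lemma₂ h m p ⟩
        n ∎) eq
        where
        open ≤-Reasoning
        lemma₁ : ∀ h i → 1 + h + i + (1 + h + i) ≡ suc i + suc i + (h + h)
        lemma₁ = solve-∀
        lemma₂ : ∀ h m p → 1 + (p + (m + m + (h + h))) ≡ 1 + (h + (m + (p + (m + h))))
        lemma₂ = solve-∀

      none₂ : ∀ i → i < m → ¬ Chord n h c (1 + h + m + p + i)
      none₂ i i<m (inj₁ (_ , le)) = too-long (m + p + i) (≤-trans (≤-reflexive (lemma h m p i)) le)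
        where
        lemma : ∀ h m p i → 1 + h + (m + p + i) ≡ 1 + h + m + p + i
        lemma = solve-∀
      none₂ i i<m (inj₂ (inj₁ (le , _))) = <⇒≱ (begin-strict
        1 + h + m + p + i + h ≡⟨ lemma h m p i ⟩
        1 + (h + (m + (p + (i + h)))) <⟨ s≤s (+-monoʳ-< h (+-monoʳ-< m (+-monoʳ-< p (+-monoˡ-< h i<m)))) ⟩
        n ∎) le
        where
        open ≤-Reasoning
        lemma : ∀ h m p i → 1 + h + m + p + i + h ≡ 1 + (h + (m + (p + (i + h))))
        lemma = solve-∀
      none₂ i i<m (inj₂ (inj₂ (_ , eq))) = <⇒≢ (begin-strict
        n <⟨ s≤s (m≤m+n n (p + i + i)) ⟩
        1 + (n + (p + i + i)) ≡⟨ lemma h m p i ⟩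
        1 + h + m + p + i + (1 + h + m + p + i) ∎) (sym eq)
        where
        open ≤-Reasoning
        lemma : ∀ h m p i → 1 + (1 + (h + (m + (p + (m + h)))) + (p + i + i)) ≡ 1 + h + m + p + i + (1 + h + m + p + i)
        lemma = solve-∀

      far : ∀ i → i < h → Chord n h c (1 + h + m + p + m + i)
      far i i<h = inj₂ (inj₁ (≤-trans (m≤m+n n i) (≤-reflexive (lemma₁ h m p i)) , (begin-strict
        1 + h + m + p + m + i <⟨ +-monoʳ-< (1 + h + m + p + m) i<h ⟩
        1 + h + m + p + m + h ≡⟨ lemma₂ h m p ⟩
        n ∎)))
        where
        open ≤-Reasoning
        lemma₁ : ∀ h m p i → 1 + (h + (m + (p + (m + h)))) + i ≡ 1 + h + m + p + m + i + h
        lemma₁ = solve-∀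
        lemma₂ : ∀ h m p → 1 + h + m + p + m + h ≡ 1 + (h + (m + (p + (m + h))))
        lemma₂ = solve-∀

    chord-zero : ¬ Chord n h c 0
    chord-zero (inj₁ (() , _))
    chord-zero (inj₂ (inj₁ (le , _))) = <⇒≱ (s≤s (m≤m+n h _)) le
    chord-zero (inj₂ (inj₂ (_ , ())))

    chord-count : rangeSum p (𝟙 ∘ chordAt? (1 + h + m)) ≡ c → rangeSum n (𝟙 ∘ chord? n h c) ≡ h + (c + h)
    chord-count center = begin
      rangeSum n g
        ≡⟨ rangeSum-+ 1 (h + (m + (p + (m + h)))) g ⟩
      rangeSum 1 g + rangeSum (h + (m + (p + (m + h)))) (g ∘ (1 +_))
        ≡⟨ cong₂ _+_ (trans (+-identityʳ (g 0)) (𝟙-no (chord? n h c 0) chord-zero)) (rangeSum-+ h (m + (p + (m + h))) (g ∘ (1 +_))) ⟩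
      rangeSum h (𝟙 ∘ chordAt? 1) + rangeSum (m + (p + (m + h))) (g ∘ (1 + h +_))
        ≡⟨ cong₂ _+_ (rangeSum-all (chordAt? 1) h near) (rangeSum-+ m (p + (m + h)) (g ∘ (1 + h +_))) ⟩
      h + (rangeSum m (𝟙 ∘ chordAt? (1 + h)) + rangeSum (p + (m + h)) (λ i → g (1 + h + (m + i))))
        ≡⟨ cong (h +_) (cong₂ _+_ (rangeSum-none (chordAt? (1 + h)) m none₁) (shift (p + (m + h)) (1 + h) m)) ⟩
      h + rangeSum (p + (m + h)) (g ∘ (1 + h + m +_))
        ≡⟨ cong (h +_) (trans (rangeSum-+ p (m + h) (g ∘ (1 + h + m +_))) (cong₂ _+_ center (shift (m + h) (1 + h + m) p))) ⟩
      h + (c + rangeSum (m + h) (g ∘ (1 + h + m + p +_)))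
        ≡⟨ cong (λ z → h + (c + z)) (trans (rangeSum-+ m h (g ∘ (1 + h + m + p +_)))
             (cong₂ _+_ (rangeSum-none (chordAt? (1 + h + m + p)) m none₂) (shift h (1 + h + m + p) m))) ⟩
      h + (c + rangeSum h (𝟙 ∘ chordAt? (1 + h + m + p + m)))
        ≡⟨ cong (λ z → h + (c + z)) (rangeSum-all (chordAt? (1 + h + m + p + m)) h far) ⟩
      h + (c + h) ∎
      where
      open ≡-Reasoning
      g : ℕ → ℕ
      g = 𝟙 ∘ chord? n h c
      shift : ∀ k a b → rangeSum k (λ i → g (a + (b + i))) ≡ rangeSum k (λ i → g (a + b + i))
      shift k a b = rangeSum-cong k λ i _ → cong g (sym (+-assoc a b i))

  -- For p = 1 the segment is the single distance 1 + h + m = n / 2, which is a chord exactly when c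
  -- = 1.
  chord-center : ∀ h m p c → p ≤ 1 → c ≤ p →
    rangeSum p (λ i → 𝟙 (chord? (1 + (h + (m + (p + (m + h))))) h c (1 + h + m + i))) ≡ c
  chord-center h m zero    zero          _         _         = refl
  chord-center h m (suc zero) zero       _         _         = rangeSum-none (λ i → chord? (1 + (h + (m + (1 + (m + h))))) h 0 (1 + h + m + i)) 1 λ
    { zero    _         (inj₁ (_ , le))              → <⇒≱ (s≤s (≤-trans (m≤m+n h m) (≤-reflexive (sym (+-identityʳ (h + m)))))) le
    ; zero    _         (inj₂ (inj₁ (le , _)))       → <⇒≱ (≤-trans (m≤m+n _ m) (≤-reflexive (lemma h m))) le
    ; zero    _         (inj₂ (inj₂ (() , _)))
    ; (suc _) (s≤s ()) _ }
    where
    lemma : ∀ h m → suc (1 + h + m + 0 + h) + m ≡ 1 + (h + (m + (1 + (m + h))))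
    lemma = solve-∀
  chord-center h m (suc zero) (suc zero) _         _         = rangeSum-all (λ i → chord? (1 + (h + (m + (1 + (m + h))))) h 1 (1 + h + m + i)) 1 λ
    { zero _ → inj₂ (inj₂ (refl , lemma h m)) ; (suc _) (s≤s ()) }
    where
    lemma : ∀ h m → 1 + h + m + 0 + (1 + h + m + 0) ≡ 1 + (h + (m + (1 + (m + h))))
    lemma = solve-∀
  chord-center h m (suc zero) (suc (suc _)) _ (s≤s ())
  chord-center h m (suc (suc _)) _ (s≤s ()) _

  module _ (n h c : ℕ) where

    circulant : Graph n
    circulant = Vec.tabulate λ u → comprehension λ v → chord? n h c (distance (toℕ u) (toℕ v))

    private
      row : ∀ u → neighbours circulant u ≡ comprehension (λ v → chord? n h c (distance (toℕ u) (toℕ v)))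
      row = VecP.lookup∘tabulate _

      adj⁺ : ∀ {u v} → Chord n h c (distance (toℕ u) (toℕ v)) → Adj circulant u v
      adj⁺ {u} {v} ch = subst (v ∈_) (sym (row u)) (∈-comprehension⁺ (λ v → chord? n h c (distance (toℕ u) (toℕ v))) ch)

      adj⁻ : ∀ {u v} → Adj circulant u v → Chord n h c (distance (toℕ u) (toℕ v))
      adj⁻ {u} {v} uv = ∈-comprehension⁻ (λ v → chord? n h c (distance (toℕ u) (toℕ v))) (subst (v ∈_) (row u) uv)

    circulant-simple : ¬ Chord n h c 0 → IsSimple circulant
    circulant-simple no-loop =
      (λ u v uv → adj⁺ (subst (Chord n h c) (∣-∣-comm (toℕ u) (toℕ v)) (adj⁻ uv))) ,
      λ v vv → no-loop (subst (Chord n h c) (∣n-n∣≡0 (toℕ v)) (adj⁻ vv))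

    circulant-degree : ∀ u → ∣ neighbours circulant u ∣ ≡ rangeSum n (𝟙 ∘ chord? n h c)
    circulant-degree u = trans (∣p∣≡∑ (neighbours circulant u))
      (trans (∑-cong (allFin n) λ v → 𝟙-cong (adj? circulant u v) (chord? n h c (distance (toℕ u) (toℕ v))) adj⁻ adj⁺)
             (around (toℕ u) (n ∸ toℕ u) (m+[n∸m]≡n (<⇒≤ (FinP.toℕ<n u))) (m<n⇒0<n∸m (FinP.toℕ<n u))))
      where
      -- A vertex v before a has distance a - v, which `chord-sym` trades for n - (a - v) = w + v.
      -- So the vertices before a supply the distances w to n - 1, and those from a on supply 0 to w
      -- - 1.
      around : ∀ a w → a + w ≡ n → 1 ≤ w → rangeSum n (λ v → 𝟙 (chord? n h c (distance a v))) ≡ rangeSum n (𝟙 ∘ chord? n h c)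
      around a w refl 1≤w = begin
        rangeSum (a + w) (λ v → 𝟙 (chord? n h c (distance a v)))
          ≡⟨ rangeSum-+ a w (λ v → 𝟙 (chord? n h c (distance a v))) ⟩
        rangeSum a (λ v → 𝟙 (chord? n h c (distance a v))) + rangeSum w (λ i → 𝟙 (chord? n h c (distance a (a + i))))
          ≡⟨ cong₂ _+_ (rangeSum-cong a before) (rangeSum-cong w λ i _ → cong (𝟙 ∘ chord? n h c) (∣m-m+n∣≡n a i)) ⟩
        rangeSum a (λ v → 𝟙 (chord? n h c (w + v))) + rangeSum w (𝟙 ∘ chord? n h c)
          ≡⟨ +-comm (rangeSum a (λ v → 𝟙 (chord? n h c (w + v)))) _ ⟩
        rangeSum w (𝟙 ∘ chord? n h c) + rangeSum a (λ v → 𝟙 (chord? n h c (w + v)))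
          ≡⟨ rangeSum-+ w a (𝟙 ∘ chord? n h c) ⟨
        rangeSum (w + a) (𝟙 ∘ chord? n h c)
          ≡⟨ cong (λ k → rangeSum k (𝟙 ∘ chord? n h c)) (+-comm w a) ⟩
        rangeSum (a + w) (𝟙 ∘ chord? n h c) ∎
        where
        open ≡-Reasoning
        before : ∀ v → v < a → 𝟙 (chord? n h c (distance a v)) ≡ 𝟙 (chord? n h c (w + v))
        before v v<a with a ∸ v | m∸n+n≡m (<⇒≤ v<a) | m<n⇒0<n∸m v<a
        ... | δ | refl | 1≤δ = trans (cong (𝟙 ∘ chord? n h c) distance≡δ)
          (𝟙-cong (chord? n h c δ) (chord? n h c (w + v)) (chord-sym total 1≤δ 1≤w+v) (chord-sym (trans (+-comm (w + v) δ) total) 1≤w+v 1≤δ))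
          where
          distance≡δ : distance (δ + v) v ≡ δ
          distance≡δ = trans (∣-∣-comm (δ + v) v) (trans (cong (distance v) (+-comm δ v)) (∣m-m+n∣≡n v δ))
          total : δ + (w + v) ≡ n
          total = lemma δ w v
            where
            lemma : ∀ δ w v → δ + (w + v) ≡ δ + v + w
            lemma = solve-∀
          1≤w+v : 1 ≤ w + v
          1≤w+v = ≤-trans 1≤w (m≤m+n w v)

  -- An empty list has probability 0, so the limit 1 requires a witness. With d = 2 h + c and n = 1
  -- + 2 h + 2 m + p, a circulant graph needs the diameter when d is odd; then n is even because d n
  -- is, which forces p = 1.
  regularGraph-exists : ∀ n d → suc d ≤ n → 2 ∣ d * n → 1 ≤ length (regularGraphs n d)
  regularGraph-exists n d d<n (divides k dn≡) = nonempty (∈-regularGraphs⁺ {n} {d} {circulant n h c} simple regular)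
    where
    h = d / 2
    c = d % 2
    M = n ∸ (1 + (h + h))
    m = M / 2
    p = M % 2
    d≡ : d ≡ h + (c + h)
    d≡ = trans (m≡m%n+[m/n]*n d 2) (lemma c h)
      where
      lemma : ∀ c h → c + h * 2 ≡ h + (c + h)
      lemma = solve-∀
    n≡ : n ≡ 1 + (h + (m + (p + (m + h))))
    n≡ = trans (sym (m∸n+n≡m (≤-trans (s≤s (≤-trans (+-monoʳ-≤ h (m≤n+m h c)) (≤-reflexive (sym d≡)))) d<n)))
      (trans (cong (_+ (1 + (h + h))) (m≡m%n+[m/n]*n M 2)) (lemma p m h))
      where
      lemma : ∀ p m h → p + m * 2 + (1 + (h + h)) ≡ 1 + (h + (m + (p + (m + h))))
      lemma = solve-∀
    parity : ∀ c p → c ≤ 1 → d ≡ h + (c + h) → n ≡ 1 + (h + (m + (p + (m + h)))) → c ≤ p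
    parity zero          _       _ _  _  = z≤n
    parity (suc zero)    (suc _) _ _  _  = s≤s z≤n
    parity (suc (suc _)) _       (s≤s ()) _ _
    parity (suc zero)    zero    _ d≡ n≡ = contradiction
      (trans (trans (*-comm 2 k) (sym dn≡)) (trans (cong₂ _*_ d≡ n≡) (lemma h m))) (even≢odd k (h + (h + m) + 2 * (h * (h + m))))
      where
      lemma : ∀ h m → (h + (1 + h)) * (1 + (h + (m + (0 + (m + h))))) ≡ suc (2 * (h + (h + m) + 2 * (h * (h + m))))
      lemma = solve-∀
    simple : IsSimple (circulant n h c)
    simple = circulant-simple n h c (subst (λ k → ¬ Chord k h c 0) (sym n≡) (chord-zero h m p c))
    regular : IsRegular d (circulant n h c)
    regular u = trans (circulant-degree n h c u) (trans
      (subst (λ k → rangeSum k (𝟙 ∘ chord? k h c) ≡ h + (c + h)) (sym n≡)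
        (chord-count h m p c (chord-center h m p c (≤-pred (m%n<n M 2)) (parity c p (≤-pred (m%n<n d 2)) d≡ n≡))))
      (sym d≡))
    nonempty : ∀ {A : Set} {x : A} {xs} → x ∈ₗ xs → 1 ≤ length xs
    nonempty (here _)  = s≤s z≤n
    nonempty (there _) = s≤s z≤n

  -- Typical regular graphs

  module _ (d p : ℕ) (3≤d : 3 ≤ d) .{{p≢0 : NonZero p}} where

    private
      instance
        d≢0 : NonZero d
        d≢0 = >-nonZero (≤-trans (s≤s z≤n) 3≤d)

    -- The locality parameter for a discrepancy error of n / p.
    locality : ℕ
    locality = 4 * p * d

    private
      q = locality
      instance
        q≢0 : NonZero q
        q≢0 = m*n≢0 (4 * p) d {{m*n≢0 4 p}}
      C = scale d q
      8≤q : 8 ≤ q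
      8≤q = ≤-trans (m≤m+n 8 4) (*-mono-≤ (m≤m*n 4 p) 3≤d)

    -- From r ≥ C d it follows that E / r ≤ n d / r ≤ n / C, the range in which sparsity can be
    -- applied.
    colourThreshold : ℕ
    colourThreshold = C * d

    module _ (r : ℕ) .{{r≢0 : NonZero r}} where

      -- Outside the third alternative the loss r * `cyclicSets` is below n / (4 p). As p and r are
      -- fixed and the mean of `cyclicSets` is bounded, Markov's inequality makes this alternative
      -- as rare as the other two.
      Exceptional : ∀ {n} → Graph n → Set
      Exceptional {n} G = HasDenseSet d q G ⊎ (Disconnected G × ¬ HasDenseSet d q G) ⊎ n ≤ 4 * p * r * cyclicSets q G

      exceptional? : ∀ {n} → Decidable (Exceptional {n})
      exceptional? {n} G = hasDenseSet? d q G ⊎-dec (disconnected? G ×-dec ¬? (hasDenseSet? d q G)) ⊎-dec (n ≤? 4 * p * r * cyclicSets q G)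

      -- The summands provide, in turn, room for the switchings, for the sets of up to q vertices in
      -- `cyclicSets-count`, and for a rounding error r of at most n / (4 p).
      sizeThreshold : ℕ
      sizeThreshold = 4 * (2 * d + 1) + 4 * q + 4 * p * r

      exceptionalConstant : ℕ
      exceptionalConstant = 2 * C + 8 * (C * C * C) + 4 * p * r * ∑ (List.upTo (suc q)) (growth d ^_)

      module _ {n : ℕ} (large : sizeThreshold ≤ n) where

        private
          R = regularGraphs n d
          B = ∑ (List.upTo (suc q)) (growth d ^_)
          big₁ : 4 * (2 * d + 1) ≤ n
          big₁ = ≤-trans (m≤m+n _ (4 * q)) (≤-trans (m≤m+n _ (4 * p * r)) large)
          big₂ : 4 * q ≤ n
          big₂ = ≤-trans (m≤n+m _ (4 * (2 * d + 1))) (≤-trans (m≤m+n _ (4 * p * r)) large)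
          big₃ : 4 * p * r ≤ n
          big₃ = ≤-trans (m≤n+m _ (4 * (2 * d + 1) + 4 * q)) large

        exceptional-count : n * (∑[ G ← R ] 𝟙 (exceptional? G)) ≤ exceptionalConstant * length R
        exceptional-count = begin
          n * (∑[ G ← R ] 𝟙 (exceptional? G))
            ≤⟨ *-monoʳ-≤ n (∑-mono R λ G → ≤-trans (𝟙-⊎ (hasDenseSet? d q G) _) (+-monoʳ-≤ (X₁ G) (𝟙-⊎ (disconnected? G ×-dec ¬? (hasDenseSet? d q G)) _))) ⟩
          n * (∑[ G ← R ] (X₁ G + (X₂ G + X₃ G)))
            ≡⟨ cong (n *_) (trans (∑-+ R X₁ (λ G → X₂ G + X₃ G)) (cong (∑ R X₁ +_) (∑-+ R X₂ X₃))) ⟩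
          n * (∑ R X₁ + (∑ R X₂ + ∑ R X₃))
            ≡⟨ lemma₁ n (∑ R X₁) (∑ R X₂) (∑ R X₃) ⟩
          n * ∑ R X₁ + n * ∑ R X₂ + ∑ R X₃ * n
            ≤⟨ +-mono-≤ (+-mono-≤ (hasDenseSet-count d q (≤-trans (n≤1+n 2) 3≤d) (≤-trans (s≤s (s≤s z≤n)) 8≤q) big₁) (disconnected-count {n} {d} {q} 3≤d 8≤q big₁))
                        (≤-trans (markov R (cyclicSets q) (4 * p * r) n) (*-monoʳ-≤ (4 * p * r) (cyclicSets-count d q (≤-trans (n≤1+n 2) 3≤d) big₁ big₂))) ⟩
          2 * (C * length R) + 8 * (C * C * C) * length R + 4 * p * r * (B * length R)
            ≡⟨ lemma₂ C (8 * (C * C * C)) (4 * p * r) B (length R) ⟩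
          exceptionalConstant * length R ∎
          where
          open ≤-Reasoning
          X₁ X₂ X₃ : Graph n → ℕ
          X₁ G = 𝟙 (hasDenseSet? d q G)
          X₂ G = 𝟙 (disconnected? G ×-dec ¬? (hasDenseSet? d q G))
          X₃ G = 𝟙 (n ≤? 4 * p * r * cyclicSets q G)
          lemma₁ : ∀ n a b c → n * (a + (b + c)) ≡ n * a + n * b + c * n
          lemma₁ = solve-∀
          lemma₂ : ∀ C D m B R → 2 * (C * R) + D * R + m * (B * R) ≡ (2 * C + D + m * B) * R
          lemma₂ = solve-∀

        module _ {G : Graph n} (G∈ : G ∈ₗ R) where

          private
            E = ∣E∣ G
            simple = proj₁ (∈-regularGraphs⁻ G∈)
            2E≡ : 2 * E ≡ n * d
            2E≡ = handshake G simple (proj₂ (∈-regularGraphs⁻ G∈))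

          typical-lower : colourThreshold ≤ r → ¬ Exceptional G → ∀ (f : Colouring r G) →
            ∃[ T ] IsSpanningTree G T × p * (n * d) ≤ p * (2 * (r * largestClass G f T)) + 2 * n
          typical-lower many typical f =
            let T , tree , bound = monochromatic-tree G simple f {d} {q} connected sparse few in T , tree , arithmetic (largestClass G f T) bound
            where
            open ≤-Reasoning
            Z = cyclicSets q G
            sparse : ¬ HasDenseSet d q G
            sparse = typical ∘ inj₁
            connected : ¬ Disconnected G
            connected disc = typical (inj₂ (inj₁ (disc , sparse)))
            cycles : 4 * p * r * Z ≤ n
            cycles = <⇒≤ (≰⇒> λ le → typical (inj₂ (inj₂ le)))
            few : C * (E / r) ≤ n
            few = *-cancelʳ-≤ _ _ r (begin
              C * (E / r) * r ≡⟨ *-assoc C (E / r) r ⟩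
              C * (E / r * r) ≤⟨ *-monoʳ-≤ C (≤-trans (m/n*n≤m E r) (m≤n*m E 2)) ⟩
              C * (2 * E) ≡⟨ cong (C *_) 2E≡ ⟩
              C * (n * d) ≡⟨ lemma C n d ⟩
              n * (C * d) ≤⟨ *-monoʳ-≤ n many ⟩
              n * r ∎)
              where
              lemma : ∀ C n d → C * (n * d) ≡ n * (C * d)
              lemma = solve-∀
            arithmetic : ∀ m → q * E ≤ q * (r * m) + (2 * E + q * r + q * (r * Z)) → p * (n * d) ≤ p * (2 * (r * m)) + 2 * n
            arithmetic m bound = *-cancelˡ-≤ (4 * d) {{m*n≢0 4 d}} (begin
              4 * d * (p * (n * d))
                ≡⟨ lemma₁ d p (n * d) ⟩
              q * (n * d)
                ≡⟨ cong (q *_) 2E≡ ⟨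
              q * (2 * E)
                ≡⟨ lemma₂ q E ⟩
              2 * (q * E)
                ≤⟨ *-monoʳ-≤ 2 bound ⟩
              2 * (q * (r * m) + (2 * E + q * r + q * (r * Z)))
                ≡⟨ cong (λ e → 2 * (q * (r * m) + (e + q * r + q * (r * Z)))) 2E≡ ⟩
              2 * (q * (r * m) + (n * d + q * r + q * (r * Z)))
                ≡⟨ lemma₃ p d r m n Z ⟩
              -- The errors from 2 E = n d, from rounding and from short cycles are at most n each,
              -- and a fourth n is slack. The factor 4 in `locality` makes the total 2 n after
              -- division by 4 d.
              4 * d * (p * (2 * (r * m))) + 2 * d * (n + 4 * p * r + 4 * p * r * Z)
                ≤⟨ +-monoʳ-≤ (4 * d * (p * (2 * (r * m)))) (*-monoʳ-≤ (2 * d) (≤-trans (+-mono-≤ (+-monoʳ-≤ n big₃) cycles) (m≤m+n (n + n + n) n))) ⟩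
              4 * d * (p * (2 * (r * m))) + 2 * d * (n + n + n + n)
                ≡⟨ lemma₄ d (p * (2 * (r * m))) n ⟩
              4 * d * (p * (2 * (r * m)) + 2 * n) ∎)
              where
              lemma₁ : ∀ d p x → 4 * d * (p * x) ≡ 4 * p * d * x
              lemma₁ = solve-∀
              lemma₂ : ∀ q E → q * (2 * E) ≡ 2 * (q * E)
              lemma₂ = solve-∀
              lemma₃ : ∀ p d r m n Z → 2 * (4 * p * d * (r * m) + (n * d + 4 * p * d * r + 4 * p * d * (r * Z))) ≡
                       4 * d * (p * (2 * (r * m))) + 2 * d * (n + 4 * p * r + 4 * p * r * Z)
              lemma₃ = solve-∀
              lemma₄ : ∀ d x n → 4 * d * x + 2 * d * (n + n + n + n) ≡ 4 * d * (x + 2 * n)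
              lemma₄ = solve-∀

          -- The summand 2 is twice the 1 in r m - (n - 1). Together with the rounding error r of
          -- the block colouring it stays below n / p, since 4 p r ≤ n.
          regular-upper : ∀ T → p * (2 * (r * largestClass G (blockColouring G simple r) T) + 2) ≤ p * (n * d) + 2 * n
          regular-upper T = begin
            p * (2 * (r * largestClass G (blockColouring G simple r) T) + 2)
              ≤⟨ *-monoʳ-≤ p (+-monoˡ-≤ 2 (*-monoʳ-≤ 2 (blockColouring-bound G simple r T))) ⟩
            p * (2 * (E + r) + 2)
              ≡⟨ lemma₁ p E r ⟩
            p * (2 * E) + 2 * (p * r + p)
              ≤⟨ +-mono-≤ (≤-reflexive (cong (p *_) 2E≡)) (*-monoʳ-≤ 2 (≤-trans (+-monoʳ-≤ (p * r) (≤-trans (m≤m*n p r) (m≤m+n (p * r) (2 * (p * r)))))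
                   (≤-trans (≤-reflexive (lemma₂ p r)) big₃))) ⟩
            p * (n * d) + 2 * n ∎
            where
            open ≤-Reasoning
            lemma₁ : ∀ p E r → p * (2 * (E + r) + 2) ≡ p * (2 * E) + 2 * (p * r + p)
            lemma₁ = solve-∀
            lemma₂ : ∀ p r → p * r + (p * r + 2 * (p * r)) ≡ 4 * p * r
            lemma₂ = solve-∀

open RegularGraphs

open import Data.Integer as ℤ using (ℤ; +_; +[1+_])
import Data.Integer.Properties as ℤP
open import Data.List as List using (List; []; _∷_; length; filter; allFin; mapMaybe)
import Data.List.Extrema
import Data.List.Properties as ListP
open import Data.List.Membership.Propositional using () renaming (_∈_ to _∈ₗ_)
import Data.List.Membership.Propositional.Properties as ∈P
open import Data.List.Relation.Unary.All as All using (All)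
import Data.List.Relation.Unary.All.Properties as AllP
open import Data.List.Relation.Unary.Any as ListAny using (here; there)
import Data.List.Relation.Unary.Any.Properties as AnyP
open import Data.Maybe.Relation.Unary.All as MaybeAll using ()
open import Data.Maybe.Relation.Unary.Any using (Any; just; dec)
open import Data.Nat using (ℕ; suc; NonZero)
open import Data.Nat using () renaming (_≤_ to _≤ℕ_)
import Data.Nat as ℕ
open import Data.Nat.Divisibility using (_∣_)
import Data.Nat.Properties as ℕP
open import Data.Nat.Tactic.RingSolver using (solve-∀)
open import Data.Product using (∃-syntax; _×_; _,_; proj₁)
open import Data.Rational using (ℚ; mkℚ; 0ℚ; 1ℚ; _/_; _+_; _-_; -_; _*_; _≤_; _<_; _≤?_; ∣_∣; Positive; NonNegative; positive; nonNegative; fromℚᵘ)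
import Data.Rational.Properties as ℚP
open import Data.Rational.Solver using (module +-*-Solver)
open import Data.Rational.Unnormalised as ℚᵘ using (ℚᵘ; mkℚᵘ; *≡*; *≤*; *<*)
import Data.Rational.Unnormalised.Properties as ℚᵘP
open import Data.Sum using (_⊎_; inj₁; inj₂)
open import Level using (0ℓ)
open import Relation.Binary using (DecTotalOrder)
open import Relation.Binary.PropositionalEquality
open import Relation.Nullary using (Dec; yes; no; ¬_)
open import Relation.Nullary.Decidable using (_×-dec_)
open import Relation.Unary using (Pred; Decidable)

-- Rational arithmetic

ι : ℕ → ℚ
ι n = + n / 1

fromℚᵘ-homo-+ : ∀ x y → fromℚᵘ x + fromℚᵘ y ≡ fromℚᵘ (x ℚᵘ.+ y)
fromℚᵘ-homo-+ x y = ℚP.toℚᵘ-injective (ℚᵘP.≃-trans (ℚP.toℚᵘ-homo-+ (fromℚᵘ x) (fromℚᵘ y))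
  (ℚᵘP.≃-trans (ℚᵘP.+-cong (ℚP.toℚᵘ-fromℚᵘ x) (ℚP.toℚᵘ-fromℚᵘ y)) (ℚᵘP.≃-sym (ℚP.toℚᵘ-fromℚᵘ (x ℚᵘ.+ y)))))

fromℚᵘ-homo-* : ∀ x y → fromℚᵘ x * fromℚᵘ y ≡ fromℚᵘ (x ℚᵘ.* y)
fromℚᵘ-homo-* x y = ℚP.toℚᵘ-injective (ℚᵘP.≃-trans (ℚP.toℚᵘ-homo-* (fromℚᵘ x) (fromℚᵘ y))
  (ℚᵘP.≃-trans (ℚᵘP.*-cong (ℚP.toℚᵘ-fromℚᵘ x) (ℚP.toℚᵘ-fromℚᵘ y)) (ℚᵘP.≃-sym (ℚP.toℚᵘ-fromℚᵘ (x ℚᵘ.* y)))))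

fraction-numerator : ∀ r .{{_ : NonZero r}} i → ι r * (i / r) ≡ i / 1
fraction-numerator (suc r) i = trans (fromℚᵘ-homo-* (mkℚᵘ (+ suc r) 0) (mkℚᵘ i r))
  (ℚP.fromℚᵘ-cong {mkℚᵘ (+ suc r) 0 ℚᵘ.* mkℚᵘ i r} {mkℚᵘ i 0} (*≡* (trans (cong (ℤ._* + 1) (ℤP.*-comm (+ suc r) i))
    (trans (ℤP.*-identityʳ (i ℤ.* + suc r)) (cong (λ k → i ℤ.* + suc k) (sym (ℕP.+-identityʳ r)))))))

integer-+ : ∀ i j → i / 1 + j / 1 ≡ (i ℤ.+ j) / 1
integer-+ i j = trans (fromℚᵘ-homo-+ (mkℚᵘ i 0) (mkℚᵘ j 0)) (cong (_/ 1) (cong₂ ℤ._+_ (ℤP.*-identityʳ i) (ℤP.*-identityʳ j)))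

ι-+ : ∀ a b → ι (a ℕ.+ b) ≡ ι a + ι b
ι-+ a b = sym (integer-+ (+ a) (+ b))

ι-* : ∀ a b → ι (a ℕ.* b) ≡ ι a * ι b
ι-* a b = sym (trans (fromℚᵘ-homo-* (mkℚᵘ (+ a) 0) (mkℚᵘ (+ b) 0)) (cong (_/ 1) (sym (ℤP.pos-* a b))))

ι-mono-≤ : ∀ {a b} → a ≤ℕ b → ι a ≤ ι b
ι-mono-≤ {a} {b} a≤b = ℚP.toℚᵘ-cancel-≤ (ℚᵘP.≤-respˡ-≃ (ℚᵘP.≃-sym (ℚP.toℚᵘ-fromℚᵘ (mkℚᵘ (+ a) 0)))
  (ℚᵘP.≤-respʳ-≃ (ℚᵘP.≃-sym (ℚP.toℚᵘ-fromℚᵘ (mkℚᵘ (+ b) 0))) (*≤* (ℤP.*-monoʳ-≤-nonNeg (+ 1) (ℤ.+≤+ a≤b)))))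

ι-mono-< : ∀ {a b} → a ℕ.< b → ι a < ι b
ι-mono-< {a} {b} a<b = ℚP.toℚᵘ-cancel-< (ℚᵘP.<-respˡ-≃ (ℚᵘP.≃-sym (ℚP.toℚᵘ-fromℚᵘ (mkℚᵘ (+ a) 0)))
  (ℚᵘP.<-respʳ-≃ (ℚᵘP.≃-sym (ℚP.toℚᵘ-fromℚᵘ (mkℚᵘ (+ b) 0))) (*<* (ℤP.*-monoʳ-<-pos (+ 1) (ℤ.+<+ a<b)))))

ι-nonNegative : ∀ n → NonNegative (ι n)
ι-nonNegative n = nonNegative (ι-mono-≤ {0} {n} ℕ.z≤n)

ι-positive : ∀ n .{{_ : NonZero n}} → Positive (ι n)
ι-positive n = positive (ι-mono-< {0} {n} (ℕ.>-nonZero⁻¹ n))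

archimedean : ∀ δ → 0ℚ < δ → ∃[ b ] 1ℚ ≤ ι (suc b) * δ
archimedean δ 0<δ with δ | positive 0<δ
-- The denominator `suc b` serves: it turns δ into its numerator, a positive integer.
... | mkℚ +[1+ a ] b c | _ = b , ℚP.≤-trans (ι-mono-≤ {1} {suc a} (ℕ.s≤s ℕ.z≤n)) (ℚP.≤-reflexive (sym
  (trans (cong (ι (suc b) *_) (sym (ℚP.↥p/↧p≡p (mkℚ +[1+ a ] b c)))) (fraction-numerator (suc b) +[1+ a ]))))

-- Discrepancy bounds

module _ (d n p r m : ℕ) .{{p≢0 : NonZero p}} .{{r≢0 : NonZero r}} (ε : ℚ) (1≤pε : 1ℚ ≤ ι p * ε) where

  private
    open +-*-Solver
    N x y : ℚ
    N = ι n
    x = + d / 2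
    y = (+ n ℤ.- + 1) / r

    twice : ι 2 * x ≡ ι d
    twice = fraction-numerator 2 (+ d)

    mean : ι r * (ι m - y) ≡ (ι r * ι m + 1ℚ) - N
    mean = begin
      ι r * (ι m - y) ≡⟨ solve 3 (λ r m y → r :* (m :- y) := r :* m :- r :* y) refl (ι r) (ι m) y ⟩
      ι r * ι m - ι r * y ≡⟨ cong (λ z → ι r * ι m - z) (trans (fraction-numerator r (+ n ℤ.- + 1)) (sym (integer-+ (+ n) (ℤ.- + 1)))) ⟩
      ι r * ι m - (N + - 1ℚ) ≡⟨ solve 3 (λ a N o → a :- (N :+ :- o) := (a :+ o) :- N) refl (ι r * ι m) N 1ℚ ⟩
      (ι r * ι m + 1ℚ) - N ∎
      where open ≡-Reasoning

    cancel : ∀ {a b} → ι 2 * ι p * a ≤ ι 2 * ι p * b → a ≤ b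
    cancel = ℚP.*-cancelˡ-≤-pos (ι 2 * ι p) {{subst Positive (ι-* 2 p) (ι-positive (2 ℕ.* p) {{ℕP.m*n≢0 2 p}})}}

    error : ι 2 * N ≤ ι 2 * (ι p * ε * N)
    error = ℚP.*-monoˡ-≤-nonNeg (ι 2) (ℚP.≤-trans (ℚP.≤-reflexive (sym (ℚP.*-identityˡ N))) (ℚP.*-monoʳ-≤-nonNeg N {{ι-nonNegative n}} 1≤pε))

    edge-count : ι (p ℕ.* (n ℕ.* d)) ≡ ι 2 * ι p * (x * N)
    edge-count = begin
      ι (p ℕ.* (n ℕ.* d)) ≡⟨ trans (ι-* p (n ℕ.* d)) (cong (ι p *_) (trans (ι-* n d) (cong (N *_) (sym twice)))) ⟩
      ι p * (N * (ι 2 * x)) ≡⟨ solve 4 (λ p N t x → p :* (N :* (t :* x)) := t :* p :* (x :* N)) refl (ι p) N (ι 2) x ⟩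
      ι 2 * ι p * (x * N) ∎
      where open ≡-Reasoning

  lower-bound : p ℕ.* (n ℕ.* d) ≤ℕ p ℕ.* (2 ℕ.* (r ℕ.* m)) ℕ.+ 2 ℕ.* n → (+ d / 2 - 1ℚ - ε) * ι n ≤ ι r * (ι m - y)
  lower-bound le = begin
    (x - 1ℚ - ε) * N ≡⟨ trans (solve 4 (λ x o ε N → (x :- o :- ε) :* N := x :* N :+ (:- (o :* N) :- ε :* N)) refl x 1ℚ ε N)
                                         (cong (λ z → x * N + (- z - ε * N)) (ℚP.*-identityˡ N)) ⟩
    x * N + (- N - ε * N) ≤⟨ ℚP.+-monoˡ-≤ (- N - ε * N) key ⟩
    ι r * ι m + ε * N + (- N - ε * N) ≡⟨ solve 3 (λ a e N → a :+ e :+ (:- N :- e) := a :- N) refl (ι r * ι m) (ε * N) N ⟩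
    -- The 1 that stems from the n - 1 edges of a tree is in favour of this bound; `upper-bound` has
    -- to pay for it.
    ι r * ι m - N ≤⟨ ℚP.+-monoˡ-≤ (- N) (ℚP.≤-trans (ℚP.≤-reflexive (sym (ℚP.+-identityʳ (ι r * ι m)))) (ℚP.+-monoʳ-≤ (ι r * ι m) (ι-mono-≤ {0} {1} ℕ.z≤n))) ⟩
    (ι r * ι m + 1ℚ) - N ≡⟨ mean ⟨
    ι r * (ι m - y) ∎
    where
    open ℚP.≤-Reasoning
    key : x * N ≤ ι r * ι m + ε * N
    key = cancel (begin
      ι 2 * ι p * (x * N) ≡⟨ edge-count ⟨
      ι (p ℕ.* (n ℕ.* d)) ≤⟨ ι-mono-≤ le ⟩
      ι (p ℕ.* (2 ℕ.* (r ℕ.* m)) ℕ.+ 2 ℕ.* n) ≡⟨ trans (ι-+ (p ℕ.* (2 ℕ.* (r ℕ.* m))) (2 ℕ.* n)) (cong₂ _+_ (trans (ι-* p (2 ℕ.* (r ℕ.* m)))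
                                                                 (cong (ι p *_) (trans (ι-* 2 (r ℕ.* m)) (cong (ι 2 *_) (ι-* r m))))) (ι-* 2 n)) ⟩
      ι p * (ι 2 * (ι r * ι m)) + ι 2 * N ≤⟨ ℚP.+-monoʳ-≤ (ι p * (ι 2 * (ι r * ι m))) error ⟩
      ι p * (ι 2 * (ι r * ι m)) + ι 2 * (ι p * ε * N) ≡⟨ solve 5 (λ p t a ε N → p :* (t :* a) :+ t :* (p :* ε :* N) := t :* p :* (a :+ ε :* N)) refl (ι p) (ι 2) (ι r * ι m) ε N ⟩
      ι 2 * ι p * (ι r * ι m + ε * N) ∎)

  upper-bound : p ℕ.* (2 ℕ.* (r ℕ.* m) ℕ.+ 2) ≤ℕ p ℕ.* (n ℕ.* d) ℕ.+ 2 ℕ.* n → ι r * (ι m - y) ≤ (+ d / 2 - 1ℚ + ε) * ι n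
  upper-bound le = begin
    ι r * (ι m - y) ≡⟨ mean ⟩
    (ι r * ι m + 1ℚ) - N ≤⟨ ℚP.+-monoˡ-≤ (- N) key ⟩
    x * N + ε * N - N ≡⟨ trans (cong (λ z → x * N + ε * N - z) (sym (ℚP.*-identityˡ N)))
                                         (solve 4 (λ x o ε N → x :* N :+ ε :* N :- o :* N := (x :- o :+ ε) :* N) refl x 1ℚ ε N) ⟩
    (x - 1ℚ + ε) * N ∎
    where
    open ℚP.≤-Reasoning
    key : ι r * ι m + 1ℚ ≤ x * N + ε * N
    key = cancel (begin
      ι 2 * ι p * (ι r * ι m + 1ℚ) ≡⟨ trans (solve 4 (λ t p a o → t :* p :* (a :+ o) := p :* (t :* a :+ t :* o)) refl (ι 2) (ι p) (ι r * ι m) 1ℚ)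
                                                                 (cong (λ z → ι p * (ι 2 * (ι r * ι m) + z)) (ℚP.*-identityʳ (ι 2))) ⟩
      ι p * (ι 2 * (ι r * ι m) + ι 2) ≡⟨ trans (ι-* p (2 ℕ.* (r ℕ.* m) ℕ.+ 2)) (cong (ι p *_) (trans (ι-+ (2 ℕ.* (r ℕ.* m)) 2)
                                                                 (cong (_+ ι 2) (trans (ι-* 2 (r ℕ.* m)) (cong (ι 2 *_) (ι-* r m)))))) ⟨
      ι (p ℕ.* (2 ℕ.* (r ℕ.* m) ℕ.+ 2)) ≤⟨ ι-mono-≤ le ⟩
      ι (p ℕ.* (n ℕ.* d) ℕ.+ 2 ℕ.* n) ≡⟨ trans (ι-+ (p ℕ.* (n ℕ.* d)) (2 ℕ.* n)) (cong₂ _+_ edge-count (ι-* 2 n)) ⟩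
      ι 2 * ι p * (x * N) + ι 2 * N ≤⟨ ℚP.+-monoʳ-≤ (ι 2 * ι p * (x * N)) error ⟩
      ι 2 * ι p * (x * N) + ι 2 * (ι p * ε * N) ≡⟨ solve 5 (λ t p z ε N → t :* p :* z :+ t :* (p :* ε :* N) := t :* p :* (z :+ ε :* N)) refl (ι 2) (ι p) (x * N) ε N ⟩
      ι 2 * ι p * (x * N + ε * N) ∎)

-- Extrema over colourings and spanning trees

module _ {lo hi : ℚ} where
  private module Ext = Data.List.Extrema (DecTotalOrder.totalOrder ℚP.≤-decTotalOrder)

  maximum-≥ : ∀ {xs} → ListAny.Any (lo ≤_) xs → Any (lo ≤_) (maximum xs)
  maximum-≥ {x ∷ xs} (here lo≤x) = just (Ext.v≤max⁺ x xs (inj₁ lo≤x))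
  maximum-≥ {x ∷ xs} (there lo≤) = just (Ext.v≤max⁺ x xs (inj₂ lo≤))

  maximum-≤ : ∀ {xs} → All (_≤ hi) xs → MaybeAll.All (_≤ hi) (maximum xs)
  maximum-≤ {[]}     _             = MaybeAll.nothing
  maximum-≤ {x ∷ xs} (x≤ All.∷ xs≤) = MaybeAll.just (Ext.max≤v⁺ x≤ xs≤)

  minimum-between : ∀ {xs} → All (lo ≤_) xs → ListAny.Any (_≤ hi) xs → Any (λ D → lo ≤ D × D ≤ hi) (minimum xs)
  minimum-between {x ∷ xs} (lo≤x All.∷ lo≤) ≤hi = just (Ext.v≤min⁺ lo≤x lo≤ , Ext.min≤v⁺ x xs (head-or-tail ≤hi))
    where
    head-or-tail : ListAny.Any (_≤ hi) (x ∷ xs) → _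
    head-or-tail (here p)  = inj₁ p
    head-or-tail (there p) = inj₂ p

  -- `lower` also shows that every inner maximum is defined, so `mapMaybe` discards nothing. All
  -- values are then at least `lo`, and the value at `a₀` is present and at most `hi`.
  minimax-between : ∀ {A B : Set} (D : A → B → ℚ) (as : List A) (bs : List B) →
    (∀ a → ∃[ b ] b ∈ₗ bs × lo ≤ D a b) → ∀ {a₀} → a₀ ∈ₗ as → (∀ b → D a₀ b ≤ hi) →
    Any (λ D → lo ≤ D × D ≤ hi) (minimum (mapMaybe (λ a → maximum (List.map (D a) bs)) as))
  minimax-between D as bs lower {a₀} a₀∈ upper = minimum-between
    (AllP.mapMaybe⁺ {xs = as} {f = best} (AllP.map⁺ {xs = as} (All.tabulate λ {a} _ → any⇒all (largest a))))
    (AnyP.mapMaybe⁺ best as (AnyP.map⁺ (ListAny.map (λ { refl → both (largest a₀) (maximum-≤ (AllP.map⁺ (All.tabulate λ {b} _ → upper b))) }) a₀∈)))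
    where
    best = λ a → maximum (List.map (D a) bs)
    largest : ∀ a → Any (lo ≤_) (best a)
    largest a with b , b∈ , lo≤ ← lower a = maximum-≥ (AnyP.map⁺ (ListAny.map (λ { refl → lo≤ }) b∈))
    any⇒all : ∀ {mx} → Any (lo ≤_) mx → MaybeAll.All (lo ≤_) mx
    any⇒all (just p) = MaybeAll.just p
    both : ∀ {mx} → Any (lo ≤_) mx → MaybeAll.All (_≤ hi) mx → Any (_≤ hi) mx
    both (just _) (MaybeAll.just p) = just p

  discrepancy-between : ∀ r .{{_ : NonZero r}} {n} (G : Graph n) →
    (∀ f → ∃[ T ] IsSpanningTree G T × lo ≤ treeDiscrepancy {r = r} G f T) →
    ∃[ f ] (∀ T → treeDiscrepancy {r = r} G f T ≤ hi) →
    Any (λ D → lo ≤ D × D ≤ hi) (discrepancy r G)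
  discrepancy-between r G lower (f₀ , upper) = minimax-between (treeDiscrepancy G) (colourings r G) (spanningTrees G) tree
    (∈-vectors {xs = allFin r} ∈P.∈-allFin {∣E∣ G} f₀) upper
    where
    tree : ∀ f → ∃[ T ] T ∈ₗ spanningTrees G × lo ≤ treeDiscrepancy G f T
    tree f = let T , isTree , lo≤ = lower f in T , ∈P.∈-filter⁺ (isSpanningTree? G) {xs = subsets (∣E∣ G)} (∈-subsets T) isTree , lo≤

-- Probability

module _ {A : Set} {P : Pred A 0ℓ} (P? : Decidable P) where

  -- The exceptional fraction bad / length xs is below 1 / D, which is at most δ. The comparison is
  -- made after multiplication by D and `length xs`, where it is one of natural numbers.
  uniformProbability-near-1 : ∀ xs D bad δ → 1ℚ ≤ ι D * δ → length xs ≤ℕ length (filter P? xs) ℕ.+ bad → D ℕ.* bad ℕ.< length xs →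
    ∣ uniformProbability xs P? - 1ℚ ∣ < δ
  uniformProbability-near-1 xs@(_ ∷ _) D bad δ 1≤Dδ few small = cases (ℚP.∣p∣≡p∨∣p∣≡-p (q - 1ℚ))
    where
    open ℚP.≤-Reasoning
    n = length xs
    k = length (filter P? xs)
    q = + k / n
    nq≡k : ι n * q ≡ ι k
    nq≡k = fraction-numerator n (+ k)
    instance
      n⁺ : Positive (ι n)
      n⁺ = ι-positive n
      n≥0 : NonNegative (ι n)
      n≥0 = ι-nonNegative n
    instance
      D≥0 : NonNegative (ι D)
      D≥0 = ι-nonNegative D
    count : D ℕ.* n ℕ.< D ℕ.* k ℕ.+ n
    count = ℕP.≤-<-trans (ℕP.≤-trans (ℕP.*-monoʳ-≤ D few) (ℕP.≤-reflexive (ℕP.*-distribˡ-+ D k bad))) (ℕP.+-monoʳ-< (D ℕ.* k) small)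
    q≤1 : q ≤ 1ℚ
    q≤1 = ℚP.*-cancelˡ-≤-pos (ι n) (begin
      ι n * q ≡⟨ nq≡k ⟩
      ι k ≤⟨ ι-mono-≤ (ListP.length-filter P? xs) ⟩
      ι n ≡⟨ ℚP.*-identityʳ (ι n) ⟨
      ι n * 1ℚ ∎)
    1<q+δ : 1ℚ < q + δ
    1<q+δ = ℚP.*-cancelˡ-<-nonNeg (ι n) (ℚP.*-cancelˡ-<-nonNeg (ι D) (begin-strict
      ι D * (ι n * 1ℚ) ≡⟨ trans (cong (ι D *_) (ℚP.*-identityʳ (ι n))) (sym (ι-* D n)) ⟩
      ι (D ℕ.* n) <⟨ ι-mono-< count ⟩
      ι (D ℕ.* k ℕ.+ n) ≡⟨ trans (ι-+ (D ℕ.* k) n) (cong₂ _+_ (trans (ι-* D k) (cong (ι D *_) (sym nq≡k))) (sym (ℚP.*-identityˡ (ι n)))) ⟩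
      ι D * (ι n * q) + 1ℚ * ι n ≤⟨ ℚP.+-monoʳ-≤ (ι D * (ι n * q)) (ℚP.*-monoʳ-≤-nonNeg (ι n) 1≤Dδ) ⟩
      ι D * (ι n * q) + ι D * δ * ι n ≡⟨ solve 4 (λ D n q δ → D :* (n :* q) :+ D :* δ :* n := D :* (n :* (q :+ δ))) refl (ι D) (ι n) q δ ⟩
      ι D * (ι n * (q + δ)) ∎))
      where open +-*-Solver
    0<δ : 0ℚ < δ
    0<δ = ℚP.*-cancelˡ-<-nonNeg (ι D) (begin-strict
      ι D * 0ℚ ≡⟨ ℚP.*-zeroʳ (ι D) ⟩
      0ℚ <⟨ ι-mono-< {0} {1} (ℕ.s≤s ℕ.z≤n) ⟩
      1ℚ ≤⟨ 1≤Dδ ⟩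
      ι D * δ ∎)
    cases : (∣ q - 1ℚ ∣ ≡ q - 1ℚ) ⊎ (∣ q - 1ℚ ∣ ≡ - (q - 1ℚ)) → ∣ q - 1ℚ ∣ < δ
    cases (inj₁ eq) = begin-strict
      ∣ q - 1ℚ ∣ ≡⟨ eq ⟩
      q - 1ℚ ≤⟨ ℚP.+-monoˡ-≤ (- 1ℚ) q≤1 ⟩
      1ℚ - 1ℚ <⟨ 0<δ ⟩
      δ ∎
    cases (inj₂ eq) = begin-strict
      ∣ q - 1ℚ ∣ ≡⟨ eq ⟩
      - (q - 1ℚ) ≡⟨ solve 2 (λ q o → :- (q :- o) := o :- q) refl q 1ℚ ⟩
      1ℚ - q <⟨ ℚP.+-monoˡ-< (- q) 1<q+δ ⟩
      q + δ - q ≡⟨ solve 2 (λ q δ → q :+ δ :- q := δ) refl q δ ⟩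
      δ ∎
      where open +-*-Solver

-- An exceptional fraction of at most K / n drops below δ as soon as n > D K with 1 ≤ D δ.
-- Nonemptiness of the list makes the comparison of counts strict.
withHighProbability : ∀ d (P : ∀ {n} → Pred (Graph n) 0ℓ) (P? : ∀ {n} → Decidable (P {n})) K N₀ →
  (∀ n → N₀ ≤ℕ n → 2 ∣ d ℕ.* n → 1 ≤ℕ length (regularGraphs n d) ×
    ∃[ bad ] length (regularGraphs n d) ≤ℕ length (filter P? (regularGraphs n d)) ℕ.+ bad × n ℕ.* bad ≤ℕ K ℕ.* length (regularGraphs n d)) →
  WithHighProbability d P P?
withHighProbability d P P? K N₀ bounds δ 0<δ with b , 1≤Dδ ← archimedean δ 0<δ = N₀ ℕ.+ suc (D b ℕ.* K) , close
  where
  D : ℕ → ℕ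
  D = suc
  close : ∀ n → N₀ ℕ.+ suc (D b ℕ.* K) ≤ℕ n → 2 ∣ d ℕ.* n → ∣ uniformProbability (regularGraphs n d) P? - 1ℚ ∣ < δ
  close n large 2∣dn with nonempty , bad , covered , few ← bounds n (ℕP.≤-trans (ℕP.m≤m+n N₀ _) large) 2∣dn =
    uniformProbability-near-1 P? R (D b) bad δ 1≤Dδ covered (ℕP.*-cancelˡ-< n (D b ℕ.* bad) (length R) (begin-strict
      n ℕ.* (D b ℕ.* bad) ≡⟨ lemma n (D b) bad ⟩
      D b ℕ.* (n ℕ.* bad) ≤⟨ ℕP.*-monoʳ-≤ (D b) few ⟩
      D b ℕ.* (K ℕ.* length R) ≡⟨ ℕP.*-assoc (D b) K (length R) ⟨
      D b ℕ.* K ℕ.* length R <⟨ ℕP.*-monoˡ-< (length R) {{ℕ.>-nonZero nonempty}} (ℕP.≤-trans (ℕP.m≤n+m _ N₀) large) ⟩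
      n ℕ.* length R ∎))
    where
    open ℕP.≤-Reasoning
    R = regularGraphs n d
    lemma : ∀ n D b → n ℕ.* (D ℕ.* b) ≡ D ℕ.* (n ℕ.* b)
    lemma = solve-∀

-- Concentration of the discrepancy around (d / 2 - 1) n

module _ (d : ℕ) (3≤d : 3 ≤ℕ d) (ε : ℚ) (p : ℕ) .{{p≢0 : NonZero p}} (1≤pε : 1ℚ ≤ ι p * ε) (r : ℕ) .{{r≢0 : NonZero r}} where

  Near : ∀ {n} → Pred (Graph n) 0ℓ
  Near {n} G = Any (λ D → ((+ d / 2 - 1ℚ - ε) * (+ n / 1) ≤ D) × (D ≤ (+ d / 2 - 1ℚ + ε) * (+ n / 1))) (discrepancy r G)

  near? : ∀ {n} → Decidable (Near {n})
  near? {n} G = dec (λ D → ((+ d / 2 - 1ℚ - ε) * (+ n / 1) ≤? D) ×-dec (D ≤? (+ d / 2 - 1ℚ + ε) * (+ n / 1))) (discrepancy r G)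

  many-vertices : suc d ≤ℕ sizeThreshold d p 3≤d r
  many-vertices = begin
    suc d ≡⟨ ℕP.+-comm 1 d ⟩
    d ℕ.+ 1 ≤⟨ ℕP.+-monoˡ-≤ 1 (ℕP.m≤n*m d 2) ⟩
    2 ℕ.* d ℕ.+ 1 ≤⟨ ℕP.m≤n*m (2 ℕ.* d ℕ.+ 1) 4 ⟩
    4 ℕ.* (2 ℕ.* d ℕ.+ 1) ≤⟨ ℕP.m≤m+n _ (4 ℕ.* locality d p 3≤d) ⟩
    4 ℕ.* (2 ℕ.* d ℕ.+ 1) ℕ.+ 4 ℕ.* locality d p 3≤d ≤⟨ ℕP.m≤m+n _ (4 ℕ.* p ℕ.* r) ⟩
    sizeThreshold d p 3≤d r ∎
    where open ℕP.≤-Reasoning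

  module _ (many : colourThreshold d p 3≤d ≤ℕ r) {n : ℕ} (large : sizeThreshold d p 3≤d r ≤ℕ n) where

    private R = regularGraphs n d

    typical-near : ∀ {G} → G ∈ₗ R → ¬ Exceptional d p 3≤d r G → Near G
    typical-near {G} G∈ typical = discrepancy-between r G
      (λ f → let T , tree , le = typical-lower d p 3≤d r large G∈ many typical f in T , tree , lower-bound d n p r (largestClass G f T) ε 1≤pε le)
      (f₀ , λ T → upper-bound d n p r (largestClass G f₀ T) ε 1≤pε (regular-upper d p 3≤d r large G∈ T))
      where f₀ = blockColouring G (proj₁ (∈-regularGraphs⁻ G∈)) r

    exceptional-or-near : length R ≤ℕ length (filter near? R) ℕ.+ ∑ R (λ G → 𝟙 (exceptional? d p 3≤d r G))
    exceptional-or-near = begin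
      length R
        ≡⟨ trans (∑-const R 1) (ℕP.*-identityʳ (length R)) ⟨
      ∑ R (λ _ → 1)
        ≤⟨ ∑-mono-∈ R (λ {G} G∈ → cases G∈ (exceptional? d p 3≤d r G)) ⟩
      ∑ R (λ G → 𝟙 (near? G) ℕ.+ 𝟙 (exceptional? d p 3≤d r G))
        ≡⟨ ∑-+ R (λ G → 𝟙 (near? G)) (λ G → 𝟙 (exceptional? d p 3≤d r G)) ⟩
      ∑ R (λ G → 𝟙 (near? G)) ℕ.+ ∑ R (λ G → 𝟙 (exceptional? d p 3≤d r G))
        ≡⟨ cong (ℕ._+ ∑ R (λ G → 𝟙 (exceptional? d p 3≤d r G))) (length-filter near? R) ⟨
      length (filter near? R) ℕ.+ ∑ R (λ G → 𝟙 (exceptional? d p 3≤d r G)) ∎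
      where
      open ℕP.≤-Reasoning
      cases : ∀ {G} → G ∈ₗ R → (exc? : Dec (Exceptional d p 3≤d r G)) → 1 ≤ℕ 𝟙 (near? G) ℕ.+ 𝟙 exc?
      cases {G} _  (yes _)      = ℕP.m≤n+m 1 (𝟙 (near? G))
      cases {G} G∈ (no typical) = ℕP.≤-trans (1≤𝟙 (near? G) (typical-near G∈ typical)) (ℕP.m≤m+n _ 0)

  near-withHighProbability : colourThreshold d p 3≤d ≤ℕ r → WithHighProbability d Near near?
  near-withHighProbability many = withHighProbability d Near near? (exceptionalConstant d p 3≤d r) (sizeThreshold d p 3≤d r) λ n large 2∣dn →
    regularGraph-exists n d (ℕP.≤-trans many-vertices large) 2∣dn ,
    ∑ (regularGraphs n d) (λ G → 𝟙 (exceptional? d p 3≤d r G)) ,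
    exceptional-or-near many large , exceptional-count d p 3≤d r large

theorem1p6 :
  ∀ (d : ℕ) → 3 ≤ℕ d → ∀ (ε : ℚ) → 0ℚ < ε →
    ∃[ r₀ ] ∀ (r : ℕ) .{{_ : NonZero r}} → r₀ ≤ℕ r →
      WithHighProbability d
        (λ {n} G → Any (λ D → ((+ d / 2 - 1ℚ - ε) * (+ n / 1) ≤ D)
                            × (D ≤ (+ d / 2 - 1ℚ + ε) * (+ n / 1)))
                       (discrepancy r G))
        (λ {n} G → dec (λ D → ((+ d / 2 - 1ℚ - ε) * (+ n / 1) ≤? D)
                        ×-dec (D ≤? (+ d / 2 - 1ℚ + ε) * (+ n / 1)))
                       (discrepancy r G))
theorem1p6 d 3≤d ε 0<ε = let b , 1≤pε = archimedean ε 0<ε in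
  -- With p = `suc b` the error n / p of the combinatorial bounds is at most ε n, and the threshold
  -- for r depends on d and p only.
  colourThreshold d (suc b) 3≤d , λ r → near-withHighProbability d 3≤d ε (suc b) 1≤pε r
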